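{- Let $\phi$ be a fixed constant. There is an algorithm which, given $\varepsilon>0$, an instance of Server Cloud Scheduling whose task graph has maximum cardinality source and sink dividing cut at most $\phi$, and a deadline $d$, runs in time polynomial in $n=|\mathcal{J}|$ and $1/\varepsilon$ and finds a valid schedule whose cost is at most the minimum cost of any valid schedule with makespan at most $d$, and whose makespan is at most $(1+\varepsilon)d$.
   Context: Server Cloud Scheduling: the input is a directed acyclic task graph $G=(\mathcal{J},E)$ with exactly one source $s$ and one sink $t$; each job $j\in\mathcal{J}$ has a server processing time $p_s(j)\in\mathbb{N}_0$ and a cloud processing time $p_c(j)\in\mathbb{N}_0$, where $p_s(s)=p_s(t)=0$ and $p_c(s)=p_c(t)=\infty$; each edge $(i,j)\in E$ has a communication delay $c(i,j)\in\mathbb{N}_0$. There is one server machine (processing at most one job at a time) and unboundedly many cloud machines. A schedule is a partition $\mathcal{J}=\mathcal{J}_s\cup\mathcal{J}_c$ together with completion times $C:\mathcal{J}\to\mathbb{N}_0$; let $p_\pi(j)=p_s(j)$ if $j\in\mathcal{J}_s$ and $p_\pi(j)=p_c(j)$ if $j\in\mathcal{J}_c$. It is valid if (a) for distinct $i,j\in\mathcal{J}_s$: $C(i)\le C(j)-p_\pi(j)$ or $C(i)-p_\pi(i)\ge C(j)$; (b) for every edge $(i,j)$ with $i,j$ on the same side: $C(i)\le C(j)-p_\pi(j)$, and for every edge with $i,j$ on different sides: $C(i)+c(i,j)\le C(j)-p_\pi(j)$. The makespan is $C(t)$ and the cost is $\sum_{j\in\mathcal{J}_c}p_c(j)$. Maximum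 cardinality source and sink dividing cut: let $\mathcal{S}$ be the family of all sets $A\subseteq\mathcal{J}$ with $s\in A$ such that there is no edge $(j,k)\in E$ with $j\notin A$ and $k\in A$; then $\phi(G)=\max_{A\in\mathcal{S}}|\{(j,k)\in E: j\in A,\ k\notin A\}|$. -}

module Defs where

open import Data.Bool.Base using (Bool; true; false; T)
open import Data.Bool.Properties using (T?)
open import Data.Fin.Base using (Fin; toℕ)
open import Data.Fin.Properties using (all?)
open import Data.Fin.Subset using (Subset; inside; outside; _∈_; _∉_)
open import Data.Fin.Subset.Properties using (_∈?_)
open import Data.Integer.Base using (+_; ∣_∣)
open import Data.List.Base
  using (List; []; _∷_; _++_; map; filter; foldr; length; tabulate; allFin; cartesianProduct)
open import Data.List.Extrema.Nat using (max)
import Data.List.Membership.Propositional as List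
open import Data.List.Relation.Unary.All as All using (All; []; _∷_)
open import Data.Maybe.Base using (maybe′; zipWith)
open import Data.Nat.Base using (ℕ; zero; suc; _+_; _∸_; _≤_; _≤ᵇ_)
open import Data.Product.Base using (∃-syntax; _×_; _,_)
open import Data.Rational.Base as ℚ using (ℚ; Positive; 1ℚ; 1/_; ceiling; ↥_; ↧ₙ_)
open import Data.Rational.Properties using (pos⇒nonZero)
open import Data.Sum.Base using (_⊎_; inj₁; inj₂)
open import Data.Unit.Base using (⊤; tt)
open import Data.Vec.Base using ([]; _∷_)
open import Function.Bundles using (_⇔_)
open import Relation.Binary.Construct.Closure.Transitive using (TransClosure)
import Relation.Binary.Construct.Add.Supremum.NonStrict as AddSupremum
open import Relation.Binary.PropositionalEquality.Core using (_≡_; _≢_; refl)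
open import Relation.Nullary.Construct.Add.Supremum using (_⁺; [_]; ⊤⁺)
open import Relation.Nullary.Decidable using (Dec; yes; no; _×-dec_; ¬?)
open import Relation.Nullary.Negation.Core using (¬_)

open AddSupremum _≤_ public using (_≤⁺_)

------------------------------------------------------------------------
-- Extended naturals

ℕ∞ : Set
ℕ∞ = ℕ ⁺

infixl 6 _+∞_

_+∞_ : ℕ∞ → ℕ∞ → ℕ∞
_+∞_ = zipWith _+_

sum∞ : List ℕ∞ → ℕ∞
sum∞ = foldr _+∞_ [ 0 ]

------------------------------------------------------------------------
-- Instances of Server Cloud Scheduling

record Instance : Set where
  field
    jobs       : ℕ
    edge       : Fin jobs → Fin jobs → Bool
    -- Only the delays of pairs satisfying `edge` are relevant.
    delay      : Fin jobs → Fin jobs → ℕ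
    serverTime : Fin jobs → ℕ
    cloudTime  : Fin jobs → ℕ∞
    source     : Fin jobs
    sink       : Fin jobs

  _⟶_ : Fin jobs → Fin jobs → Set
  i ⟶ j = T (edge i j)

  field
    acyclic           : ∀ j → ¬ TransClosure _⟶_ j j
    unique-source     : ∀ j → (∀ i → ¬ (i ⟶ j)) ⇔ (j ≡ source)
    unique-sink       : ∀ i → (∀ j → ¬ (i ⟶ j)) ⇔ (i ≡ sink)
    source-serverTime : serverTime source ≡ 0
    sink-serverTime   : serverTime sink ≡ 0
    source-cloudTime  : cloudTime source ≡ ⊤⁺
    sink-cloudTime    : cloudTime sink ≡ ⊤⁺
    other-cloudTime   : ∀ j → j ≢ source → j ≢ sink → ∃[ p ] cloudTime j ≡ [ p ]

------------------------------------------------------------------------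
-- Maximum cardinality source and sink dividing cut

subsets : ∀ n → List (Subset n)
subsets zero    = [] ∷ []
subsets (suc n) = map (inside ∷_) (subsets n) ++ map (outside ∷_) (subsets n)

module _ (I : Instance) where
  open Instance I

  Dividing : Subset jobs → Set
  Dividing A = source ∈ A × (∀ j k → ¬ (j ⟶ k × j ∉ A × k ∈ A))

  Crosses : Subset jobs → Fin jobs × Fin jobs → Set
  Crosses A (j , k) = j ⟶ k × j ∈ A × k ∉ A

  dividing? : ∀ A → Dec (Dividing A)
  dividing? A = (source ∈? A) ×-dec
    all? λ j → all? λ k →
      ¬? (T? (edge j k) ×-dec ¬? (j ∈? A) ×-dec (k ∈? A))

  crosses? : ∀ A e → Dec (Crosses A e)
  crosses? A (j , k) = T? (edge j k) ×-dec (j ∈? A) ×-dec ¬? (k ∈? A)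

  cutSize : Subset jobs → ℕ
  cutSize A = length (filter (crosses? A) (cartesianProduct (allFin jobs) (allFin jobs)))

  -- The set of all jobs is dividing, so the default 0 does not
  -- influence the maximum.
  maxDividingCut : ℕ
  maxDividingCut = max 0 (map cutSize (filter dividing? (subsets jobs)))

------------------------------------------------------------------------
-- Schedules

data Side : Set where
  server cloud : Side

_≟ˢ_ : (a b : Side) → Dec (a ≡ b)
server ≟ˢ server = yes refl
server ≟ˢ cloud  = no λ ()
cloud  ≟ˢ server = no λ ()
cloud  ≟ˢ cloud  = yes refl

record Schedule (n : ℕ) : Set where
  field
    side       : Fin n → Side
    completion : Fin n → ℕ

module _ (I : Instance) (π : Schedule (Instance.jobs I)) where
  open Instance I
  open Schedule π renaming (completion to C)

  timeOn : Side → Fin jobs → ℕ∞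
  timeOn server j = [ serverTime j ]
  timeOn cloud  j = cloudTime j

  procTime : Fin jobs → ℕ∞
  procTime j = timeOn (side j) j

  -- t ≤ C j − p j, where a difference that would be negative (or −∞) is
  -- not truncated.
  StartsAfter : ℕ → Fin jobs → Set
  StartsAfter t j = [ t ] +∞ procTime j ≤⁺ [ C j ]

  record Valid : Set where
    field
      -- Time starts at 0.  For jobs other than the source this follows
      -- from `same-side` and `cross-side`; for the source it is what makes
      -- an infinite cloud time exclude the cloud.
      starts     : ∀ j → StartsAfter 0 j
      exclusive  : ∀ i j → i ≢ j → side i ≡ server → side j ≡ server →
                   StartsAfter (C i) j ⊎ StartsAfter (C j) i
      same-side  : ∀ i j → i ⟶ j → side i ≡ side j → StartsAfter (C i) j
      cross-side : ∀ i j → i ⟶ j → side i ≢ side j → StartsAfter (C i + delay i j) j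

  makespan : ℕ
  makespan = C sink

  cost : ℕ∞
  cost = sum∞ (map cloudTime (filter (λ j → side j ≟ˢ cloud) (allFin jobs)))

------------------------------------------------------------------------
-- Model of computation: a first-order call-by-value language with
-- naturals, pairs, sums, lists and unbounded iteration, whose cost
-- semantics charges one unit per evaluated construct.  The only unit-cost
-- arithmetic is addition, truncated subtraction and comparison (no
-- multiplication), so in T steps the bit length of numbers grows by at
-- most T; values can be shared, so each step is a constant number of
-- operations of a unit-cost RAM.

infixr 7 _⊗_
infixr 6 _⊕_

data Ty : Set where
  unit nat : Ty
  _⊗_ _⊕_  : Ty → Ty → Ty
  list     : Ty → Ty

bool : Ty
bool = unit ⊕ unit

⟦_⟧ : Ty → Set
⟦ unit ⟧   = ⊤
⟦ nat ⟧    = ℕ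
⟦ σ ⊗ τ ⟧  = ⟦ σ ⟧ × ⟦ τ ⟧
⟦ σ ⊕ τ ⟧  = ⟦ σ ⟧ ⊎ ⟦ τ ⟧
⟦ list τ ⟧ = List ⟦ τ ⟧

-- inj₂ is truth.
encodeBool : Bool → ⟦ bool ⟧
encodeBool false = inj₁ tt
encodeBool true  = inj₂ tt

Ctx : Set
Ctx = List Ty

Env : Ctx → Set
Env = All ⟦_⟧

infix 4 _∋_

_∋_ : Ctx → Ty → Set
Γ ∋ τ = τ List.∈ Γ

data Tm (Γ : Ctx) : Ty → Set where
  var      : ∀ {τ} → Γ ∋ τ → Tm Γ τ
  bind     : ∀ {σ τ} → Tm Γ σ → Tm (σ ∷ Γ) τ → Tm Γ τ
  lit      : ℕ → Tm Γ nat
  add sub  : Tm Γ nat → Tm Γ nat → Tm Γ nat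
  leq      : Tm Γ nat → Tm Γ nat → Tm Γ bool
  triv     : Tm Γ unit
  pair     : ∀ {σ τ} → Tm Γ σ → Tm Γ τ → Tm Γ (σ ⊗ τ)
  fst      : ∀ {σ τ} → Tm Γ (σ ⊗ τ) → Tm Γ σ
  snd      : ∀ {σ τ} → Tm Γ (σ ⊗ τ) → Tm Γ τ
  inl      : ∀ {σ τ} → Tm Γ σ → Tm Γ (σ ⊕ τ)
  inr      : ∀ {σ τ} → Tm Γ τ → Tm Γ (σ ⊕ τ)
  caseSum  : ∀ {ρ σ τ} → Tm Γ (ρ ⊕ σ) → Tm (ρ ∷ Γ) τ → Tm (σ ∷ Γ) τ → Tm Γ τ
  nil      : ∀ {τ} → Tm Γ (list τ)
  cons     : ∀ {τ} → Tm Γ τ → Tm Γ (list τ) → Tm Γ (list τ)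
  caseList : ∀ {σ τ} → Tm Γ (list σ) → Tm Γ τ → Tm (σ ∷ list σ ∷ Γ) τ → Tm Γ τ
  -- Repeat the body, which either updates the state (left) or returns a
  -- result (right).
  iter     : ∀ {σ τ} → Tm Γ σ → Tm (σ ∷ Γ) (σ ⊕ τ) → Tm Γ τ

infix 4 _⊢_⇓_∣_ _⊢_↻_⇓_∣_

mutual

  -- ρ ⊢ e ⇓ v ∣ t : in environment ρ, e evaluates to v in t steps.
  data _⊢_⇓_∣_ {Γ : Ctx} (ρ : Env Γ) : ∀ {τ} → Tm Γ τ → ⟦ τ ⟧ → ℕ → Set where

    ⇓var : ∀ {τ} {x : Γ ∋ τ} → ρ ⊢ var x ⇓ All.lookup ρ x ∣ 1

    ⇓bind : ∀ {σ τ} {e : Tm Γ σ} {f : Tm (σ ∷ Γ) τ} {v w s t} →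
            ρ ⊢ e ⇓ v ∣ s → v ∷ ρ ⊢ f ⇓ w ∣ t → ρ ⊢ bind e f ⇓ w ∣ suc (s + t)

    ⇓lit : ∀ {n} → ρ ⊢ lit n ⇓ n ∣ 1

    ⇓add : ∀ {e f : Tm Γ nat} {m n s t} →
           ρ ⊢ e ⇓ m ∣ s → ρ ⊢ f ⇓ n ∣ t → ρ ⊢ add e f ⇓ m + n ∣ suc (s + t)

    ⇓sub : ∀ {e f : Tm Γ nat} {m n s t} →
           ρ ⊢ e ⇓ m ∣ s → ρ ⊢ f ⇓ n ∣ t → ρ ⊢ sub e f ⇓ m ∸ n ∣ suc (s + t)

    ⇓leq : ∀ {e f : Tm Γ nat} {m n s t} →
           ρ ⊢ e ⇓ m ∣ s → ρ ⊢ f ⇓ n ∣ t →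
           ρ ⊢ leq e f ⇓ encodeBool (m ≤ᵇ n) ∣ suc (s + t)

    ⇓triv : ρ ⊢ triv ⇓ tt ∣ 1

    ⇓pair : ∀ {σ τ} {e : Tm Γ σ} {f : Tm Γ τ} {v w s t} →
            ρ ⊢ e ⇓ v ∣ s → ρ ⊢ f ⇓ w ∣ t → ρ ⊢ pair e f ⇓ (v , w) ∣ suc (s + t)

    ⇓fst : ∀ {σ τ} {e : Tm Γ (σ ⊗ τ)} {v w t} →
           ρ ⊢ e ⇓ (v , w) ∣ t → ρ ⊢ fst e ⇓ v ∣ suc t

    ⇓snd : ∀ {σ τ} {e : Tm Γ (σ ⊗ τ)} {v w t} →
           ρ ⊢ e ⇓ (v , w) ∣ t → ρ ⊢ snd e ⇓ w ∣ suc t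

    ⇓inl : ∀ {σ τ} {e : Tm Γ σ} {v t} →
           ρ ⊢ e ⇓ v ∣ t → ρ ⊢ inl {τ = τ} e ⇓ inj₁ v ∣ suc t

    ⇓inr : ∀ {σ τ} {e : Tm Γ τ} {v t} →
           ρ ⊢ e ⇓ v ∣ t → ρ ⊢ inr {σ = σ} e ⇓ inj₂ v ∣ suc t

    ⇓case₁ : ∀ {π σ τ} {e : Tm Γ (π ⊕ σ)} {f : Tm (π ∷ Γ) τ} {g : Tm (σ ∷ Γ) τ} {v w s t} →
             ρ ⊢ e ⇓ inj₁ v ∣ s → v ∷ ρ ⊢ f ⇓ w ∣ t →
             ρ ⊢ caseSum e f g ⇓ w ∣ suc (s + t)

    ⇓case₂ : ∀ {π σ τ} {e : Tm Γ (π ⊕ σ)} {f : Tm (π ∷ Γ) τ} {g : Tm (σ ∷ Γ) τ} {v w s t} →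
             ρ ⊢ e ⇓ inj₂ v ∣ s → v ∷ ρ ⊢ g ⇓ w ∣ t →
             ρ ⊢ caseSum e f g ⇓ w ∣ suc (s + t)

    ⇓nil : ∀ {τ} → ρ ⊢ nil {τ = τ} ⇓ [] ∣ 1

    ⇓cons : ∀ {τ} {e : Tm Γ τ} {f : Tm Γ (list τ)} {v vs s t} →
            ρ ⊢ e ⇓ v ∣ s → ρ ⊢ f ⇓ vs ∣ t → ρ ⊢ cons e f ⇓ v ∷ vs ∣ suc (s + t)

    ⇓case[] : ∀ {σ τ} {e : Tm Γ (list σ)} {f : Tm Γ τ} {g : Tm (σ ∷ list σ ∷ Γ) τ} {w s t} →
              ρ ⊢ e ⇓ [] ∣ s → ρ ⊢ f ⇓ w ∣ t →
              ρ ⊢ caseList e f g ⇓ w ∣ suc (s + t)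

    ⇓case∷ : ∀ {σ τ} {e : Tm Γ (list σ)} {f : Tm Γ τ} {g : Tm (σ ∷ list σ ∷ Γ) τ} {v vs w s t} →
             ρ ⊢ e ⇓ v ∷ vs ∣ s → v ∷ vs ∷ ρ ⊢ g ⇓ w ∣ t →
             ρ ⊢ caseList e f g ⇓ w ∣ suc (s + t)

    ⇓iter : ∀ {σ τ} {e : Tm Γ σ} {b : Tm (σ ∷ Γ) (σ ⊕ τ)} {v w s t} →
            ρ ⊢ e ⇓ v ∣ s → ρ ⊢ b ↻ v ⇓ w ∣ t → ρ ⊢ iter e b ⇓ w ∣ suc (s + t)

  -- ρ ⊢ b ↻ v ⇓ w ∣ t : iterating b from state v returns w after t steps.
  data _⊢_↻_⇓_∣_ {Γ : Ctx} (ρ : Env Γ) {σ τ : Ty} (b : Tm (σ ∷ Γ) (σ ⊕ τ)) :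
                 ⟦ σ ⟧ → ⟦ τ ⟧ → ℕ → Set where

    stop : ∀ {v w t} → v ∷ ρ ⊢ b ⇓ inj₂ w ∣ t → ρ ⊢ b ↻ v ⇓ w ∣ suc t

    step : ∀ {v v′ w s t} → v ∷ ρ ⊢ b ⇓ inj₁ v′ ∣ s → ρ ⊢ b ↻ v′ ⇓ w ∣ t →
           ρ ⊢ b ↻ v ⇓ w ∣ suc (s + t)

Program : Ty → Ty → Set
Program σ τ = Tm (σ ∷ []) τ

Runs : ∀ {σ τ} → Program σ τ → ⟦ σ ⟧ → ⟦ τ ⟧ → ℕ → Set
Runs p v w t = v ∷ [] ⊢ p ⇓ w ∣ t

------------------------------------------------------------------------
-- Inputs and outputs

-- (numerator and denominator of ε), deadline, source, sink,
-- (server time, cloud time) of each job, matrix of (is edge?, delay).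
-- Jobs are numbered from 0; a left cloud time is infinite.
Input : Ty
Input = (nat ⊗ nat) ⊗ nat ⊗ nat ⊗ nat ⊗ list (nat ⊗ (unit ⊕ nat)) ⊗ list (list (bool ⊗ nat))

encodeInput : Instance → ℚ → ℕ → ⟦ Input ⟧
encodeInput I ε d =
  (∣ ↥ ε ∣ , ↧ₙ ε) , d , toℕ source , toℕ sink ,
  tabulate (λ j → serverTime j , maybe′ inj₂ (inj₁ tt) (cloudTime j)) ,
  tabulate (λ i → tabulate λ j → encodeBool (edge i j) , delay i j)
  where open Instance I

-- (is on the server?, completion time) of each job.
ScheduleTy : Ty
ScheduleTy = list (bool ⊗ nat)

encodeSide : Side → ⟦ bool ⟧
encodeSide server = encodeBool true
encodeSide cloud  = encodeBool false

encodeSchedule : ∀ {n} → Schedule n → ⟦ ScheduleTy ⟧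
encodeSchedule π = tabulate λ j → encodeSide (side j) , completion j
  where open Schedule π

-- The left summand reports that no schedule meets the deadline.
Output : Ty
Output = unit ⊕ ScheduleTy

------------------------------------------------------------------------
-- Specification

fromℕ : ℕ → ℚ
fromℕ n = + n ℚ./ 1

Approximates : (I : Instance) → ℚ → ℕ → Schedule (Instance.jobs I) → Set
Approximates I ε d π =
  Valid I π ×
  (∀ π′ → Valid I π′ → makespan I π′ ≤ d → cost I π ≤⁺ cost I π′) ×
  fromℕ (makespan I π) ℚ.≤ (1ℚ ℚ.+ ε) ℚ.* fromℕ d

Infeasible : Instance → ℕ → Set
Infeasible I d = ∀ π → Valid I π → ¬ makespan I π ≤ d

Solves : Instance → ℚ → ℕ → ⟦ Output ⟧ → Set
Solves I ε d (inj₁ _) = Infeasible I d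
Solves I ε d (inj₂ o) = ∃[ π ] o ≡ encodeSchedule π × Approximates I ε d π

-- ⌈ 1 / ε ⌉.  As a task graph has n ≥ 1 jobs, a quantity is polynomially
-- bounded in n and 1 / ε iff it is at most a · (n + ⌈ 1 / ε ⌉) ^ k for some
-- constants a and k.
inverseCeil : (ε : ℚ) → .{{Positive ε}} → ℕ
inverseCeil ε = ∣ ceiling ((1/ ε) {{pos⇒nonZero ε}}) ∣

{-# OPTIONS --safe #-}
module Submission where

-- A dynamic program schedules the jobs one by one.  A state is a partial
-- schedule in which every job starts as early as the previous choices
-- allow.  What the future needs to know about it is captured by the edges
-- that leave the set of scheduled jobs, the sides and completion times of
-- their tails, and the time at which the server becomes free.  The set
-- itself is determined by these edges, as it consists of the jobs that can
-- be reached from the source without using them; it is dividing, so there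
-- are at most φ of them.  With m = ⌈ 1 / ε ⌉, times are grouped into buckets of length
-- d / (n m), and of all states that agree up to buckets only a cheapest
-- one survives a step.  This leaves polynomially many states.  Compared
-- with an arbitrary schedule that meets the deadline, some surviving state
-- is never more expensive and falls behind by at most one bucket per step,
-- hence by at most d / m in total.

open import Defs
open import Data.Bool.Base using (Bool; true; false; T; if_then_else_; _∧_; _∨_; not)
open import Data.Bool.Properties using (T?)
open import Data.Empty using (⊥-elim)
open import Data.Fin.Base using (Fin; zero; suc; toℕ)
open import Data.Fin.Induction using (spo-wellFounded)
open import Data.Fin.Properties as F using (toℕ-injective; toℕ<n)
open import Data.Fin.Subset as S using (Subset; inside; outside)
open import Data.Integer.Base as ℤ using (-[1+_]; ∣_∣) renaming (+_ to pos)
import Data.Integer.DivMod as ℤ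
import Data.Integer.Properties as ℤ
open import Data.Integer.Tactic.RingSolver using () renaming (solve-∀ to solve-∀ℤ)
open import Data.List.Base as L
  using (List; []; _∷_; _++_; map; foldr; foldl; length; reverse; filter; upTo; allFin; cartesianProduct; cartesianProductWith)
open import Data.List.Extrema.Nat using (xs≤max)
open import Data.List.Membership.Propositional using (_∈_; find; lose)
open import Data.List.Membership.Propositional.Properties
  using (∈-concatMap⁺; ∈-concatMap⁻; ∈-tabulate⁺; ∈-tabulate⁻; ∈-++⁺ˡ; ∈-++⁺ʳ; ∈-++⁻; ∈-filter⁺; ∈-filter⁻;
         ∈-∃++; ∈-upTo⁺; ∈-cartesianProduct⁺; ∈-cartesianProductWith⁺; ∈-map⁺; ∈-map⁻)
open import Data.List.Properties
  using (reverse-foldl; map-tabulate; tabulate-cong; length-tabulate; length-++; length-map; length-upTo;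
         filter-++; filter-accept; filter-reject)
open import Data.List.Relation.Unary.All as All using (All; []; _∷_)
open import Data.List.Relation.Unary.AllPairs as AllPairs using (AllPairs; []; _∷_)
import Data.List.Relation.Unary.AllPairs.Properties as AllPairs
open import Data.List.Relation.Unary.Any using (here; there)
open import Data.List.Relation.Unary.Unique.Propositional using (Unique)
open import Data.Maybe.Base using (maybe′; just; nothing)
import Data.Maybe.Properties as Maybe
open import Data.Nat.Base
open import Data.Nat.Induction using (<-wellFounded)
open import Data.Nat.Properties
open import Data.Nat.Tactic.RingSolver using (solve-∀)
open import Data.Product.Base using (Σ-syntax; ∃-syntax; _×_; _,_; proj₁; proj₂)
open import Data.Rational.Base as ℚ using (ℚ; mkℚ; Positive; 1ℚ; ↥_; ↧ₙ_; toℚᵘ)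
import Data.Rational.Properties as ℚ
open import Data.Rational.Unnormalised.Base as ℚᵘ using (mkℚᵘ)
import Data.Rational.Unnormalised.Properties as ℚᵘ
open import Data.Sum.Base using (_⊎_; inj₁; inj₂; [_,_]′)
open import Data.Sum.Properties using (inj₂-injective)
open import Data.Unit.Base using (⊤; tt)
import Data.Vec.Base as V
open import Data.Vec.Properties using (lookup⇒[]=; []=⇒lookup; lookup∘tabulate)
open import Function.Base using (_∘_)
open import Function.Bundles using (module Equivalence)
open import Induction.WellFounded using (WellFounded; Acc; acc; module Subrelation)
open import Relation.Binary.Construct.Add.Supremum.NonStrict _≤_ using ([_]; _≤⊤⁺)
open import Relation.Binary.Construct.Closure.Transitive as TC using (TransClosure)
open import Relation.Binary.PropositionalEquality
open import Relation.Binary.Structures using (IsStrictPartialOrder)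
open import Relation.Nullary.Decidable using (decidable-stable)
open import Relation.Nullary.Decidable.Core using (Dec; yes; no; _×-dec_)
open import Relation.Nullary.Negation.Core using (¬_)

-- Polynomial bounds

-- Rounding never touches the states themselves: completion times stay exact, and every surviving
-- state is a correct partial schedule. Buckets only decide which states count as interchangeable,
-- so the loss appears solely in the comparison with the target schedule (`Dom`). The comparison is
-- carried out in integers, with times scaled by K = n m: a bucket then has length d, and the n
-- buckets that may be lost turn K d into the cap n (m + 1) d.
--
-- Sides must agree exactly between similar states, because they determine later communication
-- delays. The times of jobs without edges to unscheduled jobs are forgotten, apart from the release
-- of the server, so the invariant may speak only of leaving edges, the server and the cost.
--
-- The running time is obtained by pairing each function with a term and a bound (`Poly`). A loop
-- preserves such bounds only if its accumulator grows additively. One round of the outer loop can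
-- multiply the number of states, so the bound for that loop has to come from counting states, and
-- this is where φ enters.

infixl 6 _⊞_
infixl 7 _⊠_
infixr 8 _⊚_

-- Syntax with natural coefficients: monotonicity and the bound by a single monomial then hold for
-- all bounds at once, by induction. Composition is a constructor because the bound of a
-- continuation is evaluated at the size of an intermediate result.
data Pol : Set where
  X           : Pol
  con         : ℕ → Pol
  _⊞_ _⊠_ _⊚_ : Pol → Pol → Pol

eval : Pol → ℕ → ℕ
eval X       n = n
eval (con c) n = c
eval (p ⊞ q) n = eval p n + eval q n
eval (p ⊠ q) n = eval p n * eval q n
eval (p ⊚ q) n = eval p (eval q n)

eval-mono : ∀ p {m n} → m ≤ n → eval p m ≤ eval p n
eval-mono X       m≤n = m≤n
eval-mono (con c) m≤n = ≤-refl
eval-mono (p ⊞ q) m≤n = +-mono-≤ (eval-mono p m≤n) (eval-mono q m≤n)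
eval-mono (p ⊠ q) m≤n = *-mono-≤ (eval-mono p m≤n) (eval-mono q m≤n)
eval-mono (p ⊚ q) m≤n = eval-mono p (eval-mono q m≤n)

private
  1≤suc^ : ∀ n k → 1 ≤ suc n ^ k
  1≤suc^ n k = m^n>0 (suc n) k

  ^-pad : ∀ n k l → suc n ^ k ≤ suc n ^ (k + l)
  ^-pad n k l = ^-monoʳ-≤ (suc n) (m≤m+n k l)

  swap-middle : ∀ a x b y → (a * x) * (b * y) ≡ (a * b) * (x * y)
  swap-middle = solve-∀

^-distrib-* : ∀ m n k → (m * n) ^ k ≡ m ^ k * n ^ k
^-distrib-* m n zero    = refl
^-distrib-* m n (suc k) = trans (cong (m * n *_) (^-distrib-* m n k)) (swap-middle m n (m ^ k) (n ^ k))

-- The base `suc n` is at least 1, so lower powers are absorbed by higher ones even for n = 0. For a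
-- composition the exponents multiply, and the 1 added to the inner bound is absorbed into its
-- coefficient, which becomes `suc b`.
eval-bound : ∀ p → ∃[ a ] ∃[ k ] ∀ n → eval p n ≤ a * suc n ^ k
eval-bound X = 1 , 1 , λ n → begin
  n                  ≤⟨ n≤1+n n ⟩
  suc n              ≡⟨ sym (trans (*-identityˡ _) (^-identityʳ (suc n))) ⟩
  1 * suc n ^ 1      ∎
  where open ≤-Reasoning
eval-bound (con c) = c , 0 , λ n → ≤-reflexive (sym (*-identityʳ c))
eval-bound (p ⊞ q) with eval-bound p | eval-bound q
... | a , k , hp | b , l , hq = a + b , k + l , λ n → begin
  eval p n + eval q n                             ≤⟨ +-mono-≤ (hp n) (hq n) ⟩
  a * suc n ^ k + b * suc n ^ l                   ≤⟨ +-mono-≤ (*-monoʳ-≤ a (^-pad n k l))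
                                                       (*-monoʳ-≤ b (subst (λ e → suc n ^ l ≤ suc n ^ e) (+-comm l k) (^-pad n l k))) ⟩
  a * suc n ^ (k + l) + b * suc n ^ (k + l)       ≡⟨ sym (*-distribʳ-+ (suc n ^ (k + l)) a b) ⟩
  (a + b) * suc n ^ (k + l)                       ∎
  where open ≤-Reasoning
eval-bound (p ⊠ q) with eval-bound p | eval-bound q
... | a , k , hp | b , l , hq = a * b , k + l , λ n → begin
  eval p n * eval q n                     ≤⟨ *-mono-≤ (hp n) (hq n) ⟩
  (a * suc n ^ k) * (b * suc n ^ l)       ≡⟨ swap-middle a (suc n ^ k) b (suc n ^ l) ⟩
  (a * b) * (suc n ^ k * suc n ^ l)       ≡⟨ cong (a * b *_) (sym (^-distribˡ-+-* (suc n) k l)) ⟩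
  (a * b) * suc n ^ (k + l)               ∎
  where open ≤-Reasoning
eval-bound (p ⊚ q) with eval-bound p | eval-bound q
... | a , k , hp | b , l , hq = a * suc b ^ k , l * k , λ n → begin
  eval p (eval q n)                   ≤⟨ hp (eval q n) ⟩
  a * suc (eval q n) ^ k              ≤⟨ *-monoʳ-≤ a (^-monoˡ-≤ k (s≤s (hq n))) ⟩
  a * suc (b * suc n ^ l) ^ k         ≤⟨ *-monoʳ-≤ a (^-monoˡ-≤ k (+-monoˡ-≤ (b * suc n ^ l) (1≤suc^ n l))) ⟩
  a * (suc b * suc n ^ l) ^ k         ≡⟨ cong (a *_) (^-distrib-* (suc b) (suc n ^ l) k) ⟩
  a * (suc b ^ k * (suc n ^ l) ^ k)   ≡⟨ sym (*-assoc a (suc b ^ k) _) ⟩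
  a * suc b ^ k * (suc n ^ l) ^ k     ≡⟨ cong (a * suc b ^ k *_) (^-*-assoc (suc n) l k) ⟩
  a * suc b ^ k * suc n ^ (l * k)     ∎
  where open ≤-Reasoning

-- Renaming of terms

Ren : Ctx → Ctx → Set
Ren Γ Δ = ∀ {τ} → Γ ∋ τ → Δ ∋ τ

lift : ∀ {Γ Δ σ} → Ren Γ Δ → Ren (σ ∷ Γ) (σ ∷ Δ)
lift r (here eq) = here eq
lift r (there x) = there (r x)

rename : ∀ {Γ Δ τ} → Ren Γ Δ → Tm Γ τ → Tm Δ τ
rename r (var x)          = var (r x)
rename r (bind e f)       = bind (rename r e) (rename (lift r) f)
rename r (lit n)          = lit n
rename r (add e f)        = add (rename r e) (rename r f)
rename r (sub e f)        = sub (rename r e) (rename r f)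
rename r (leq e f)        = leq (rename r e) (rename r f)
rename r triv             = triv
rename r (pair e f)       = pair (rename r e) (rename r f)
rename r (fst e)          = fst (rename r e)
rename r (snd e)          = snd (rename r e)
rename r (inl e)          = inl (rename r e)
rename r (inr e)          = inr (rename r e)
rename r (caseSum e f g)  = caseSum (rename r e) (rename (lift r) f) (rename (lift r) g)
rename r nil              = nil
rename r (cons e f)       = cons (rename r e) (rename r f)
rename r (caseList e f g) = caseList (rename r e) (rename r f) (rename (lift (lift r)) g)
rename r (iter e b)       = iter (rename r e) (rename (lift r) b)

Respects : ∀ {Γ Δ} → Ren Γ Δ → Env Γ → Env Δ → Set
Respects {Γ} r ρ ρ′ = ∀ {τ} (x : Γ ∋ τ) → All.lookup ρ′ (r x) ≡ All.lookup ρ x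

lift-respects : ∀ {Γ Δ σ} {r : Ren Γ Δ} {ρ ρ′} {v : ⟦ σ ⟧} →
                Respects r ρ ρ′ → Respects (lift r) (v ∷ ρ) (v ∷ ρ′)
lift-respects h (here refl) = refl
lift-respects h (there x)   = h x

mutual
  -- A variable costs 1 wherever it sits in the environment, so even the step count is preserved.
  -- Time bounds therefore survive weakening under further binders.
  rename-⇓ : ∀ {Γ Δ τ} {r : Ren Γ Δ} {ρ ρ′} {e : Tm Γ τ} {v t} → Respects r ρ ρ′ →
             ρ ⊢ e ⇓ v ∣ t → ρ′ ⊢ rename r e ⇓ v ∣ t
  rename-⇓ {r = r} {ρ′ = ρ′} h (⇓var {x = x}) =
    subst (λ v → ρ′ ⊢ var (r x) ⇓ v ∣ 1) (h x) ⇓var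
  rename-⇓ {r = r} h (⇓bind p q)  = ⇓bind (rename-⇓ h p) (rename-⇓ (lift-respects {r = r} h) q)
  rename-⇓ h ⇓lit         = ⇓lit
  rename-⇓ h (⇓add p q)   = ⇓add (rename-⇓ h p) (rename-⇓ h q)
  rename-⇓ h (⇓sub p q)   = ⇓sub (rename-⇓ h p) (rename-⇓ h q)
  rename-⇓ h (⇓leq p q)   = ⇓leq (rename-⇓ h p) (rename-⇓ h q)
  rename-⇓ h ⇓triv        = ⇓triv
  rename-⇓ h (⇓pair p q)  = ⇓pair (rename-⇓ h p) (rename-⇓ h q)
  rename-⇓ h (⇓fst p)     = ⇓fst (rename-⇓ h p)
  rename-⇓ h (⇓snd p)     = ⇓snd (rename-⇓ h p)
  rename-⇓ h (⇓inl p)     = ⇓inl (rename-⇓ h p)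
  rename-⇓ h (⇓inr p)     = ⇓inr (rename-⇓ h p)
  rename-⇓ {r = r} h (⇓case₁ p q) = ⇓case₁ (rename-⇓ h p) (rename-⇓ (lift-respects {r = r} h) q)
  rename-⇓ {r = r} h (⇓case₂ p q) = ⇓case₂ (rename-⇓ h p) (rename-⇓ (lift-respects {r = r} h) q)
  rename-⇓ h ⇓nil         = ⇓nil
  rename-⇓ h (⇓cons p q)  = ⇓cons (rename-⇓ h p) (rename-⇓ h q)
  rename-⇓ h (⇓case[] p q) = ⇓case[] (rename-⇓ h p) (rename-⇓ h q)
  rename-⇓ {r = r} h (⇓case∷ p q) =
    ⇓case∷ (rename-⇓ h p) (rename-⇓ (lift-respects {r = lift r} (lift-respects {r = r} h)) q)
  rename-⇓ h (⇓iter p q)  = ⇓iter (rename-⇓ h p) (rename-↻ h q)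

  rename-↻ : ∀ {Γ Δ σ τ} {r : Ren Γ Δ} {ρ ρ′} {b : Tm (σ ∷ Γ) (σ ⊕ τ)} {v w t} → Respects r ρ ρ′ →
             ρ ⊢ b ↻ v ⇓ w ∣ t → ρ′ ⊢ rename (lift r) b ↻ v ⇓ w ∣ t
  rename-↻ {r = r} h (stop p)   = stop (rename-⇓ (lift-respects {r = r} h) p)
  rename-↻ {r = r} h (step p q) = step (rename-⇓ (lift-respects {r = r} h) p) (rename-↻ h q)

-- Numbers have size 1, as arithmetic has unit cost: the size of a value
-- measures its lists.

mutual
  size : ∀ τ → ⟦ τ ⟧ → ℕ
  size unit     _        = 1
  size nat      _        = 1
  size (σ ⊗ τ)  (v , w)  = size σ v + size τ w
  size (σ ⊕ τ)  (inj₁ v) = size σ v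
  size (σ ⊕ τ)  (inj₂ w) = size τ w
  size (list τ) vs       = suc (sizes τ vs)

  sizes : ∀ τ → List ⟦ τ ⟧ → ℕ
  sizes τ []       = 0
  sizes τ (v ∷ vs) = size τ v + sizes τ vs

size≥1 : ∀ τ v → 1 ≤ size τ v
size≥1 unit     _        = ≤-refl
size≥1 nat      _        = ≤-refl
size≥1 (σ ⊗ τ)  (v , w)  = m≤n⇒m≤n+o _ (size≥1 σ v)
size≥1 (σ ⊕ τ)  (inj₁ v) = size≥1 σ v
size≥1 (σ ⊕ τ)  (inj₂ w) = size≥1 τ w
size≥1 (list τ) vs       = s≤s z≤n

length≤sizes : ∀ τ vs → length vs ≤ sizes τ vs
length≤sizes τ []       = z≤n
length≤sizes τ (v ∷ vs) = +-mono-≤ (size≥1 τ v) (length≤sizes τ vs)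

sizes-++ : ∀ τ vs ws → sizes τ (vs ++ ws) ≡ sizes τ vs + sizes τ ws
sizes-++ τ []       ws = refl
sizes-++ τ (v ∷ vs) ws = trans (cong (size τ v +_) (sizes-++ τ vs ws)) (sym (+-assoc (size τ v) _ _))

sizes≤ : ∀ τ {c} vs → (∀ {v} → v ∈ vs → size τ v ≤ c) → sizes τ vs ≤ length vs * c
sizes≤ τ []       h = z≤n
sizes≤ τ (v ∷ vs) h = +-mono-≤ (h (here refl)) (sizes≤ τ vs (h ∘ there))

-- Environments as nested pairs, whose η-equality lets unification infer
-- functions of an environment.

Val : Ctx → Set
Val []      = ⊤
Val (σ ∷ Γ) = ⟦ σ ⟧ × Val Γ

toEnv : ∀ {Γ} → Val Γ → Env Γ
toEnv {[]}    _       = []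
toEnv {σ ∷ Γ} (v , ρ) = v ∷ toEnv ρ

sizeᵉ : ∀ Γ → Val Γ → ℕ
sizeᵉ []      _       = 0
sizeᵉ (σ ∷ Γ) (v , ρ) = size σ v + sizeᵉ Γ ρ

look : ∀ {Γ τ} → Γ ∋ τ → Val Γ → ⟦ τ ⟧
look (here refl) (v , ρ) = v
look (there x)   (v , ρ) = look x ρ

lookup-toEnv : ∀ {Γ τ} (x : Γ ∋ τ) (ρ : Val Γ) → All.lookup (toEnv ρ) x ≡ look x ρ
lookup-toEnv (here refl) ρ       = refl
lookup-toEnv (there x)   (v , ρ) = lookup-toEnv x ρ

size-look : ∀ {Γ τ} (x : Γ ∋ τ) (ρ : Val Γ) → size τ (look x ρ) ≤ sizeᵉ Γ ρ
size-look (here refl) (v , ρ)     = m≤m+n _ _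
size-look {σ ∷ Γ} (there x) (v , ρ) = m≤n⇒m≤o+n (size σ v) (size-look x ρ)

-- One bound for both the time and the size of the result, because the
-- latter enters the bounds of the continuation.

Ev : ∀ {Γ τ} → Val Γ → Tm Γ τ → ⟦ τ ⟧ → ℕ → Set
Ev {τ = τ} ρ e v b = ∃[ t ] (toEnv ρ ⊢ e ⇓ v ∣ t) × t + size τ v ≤ b

Ev-size : ∀ {Γ τ} {ρ : Val Γ} {e : Tm Γ τ} {v b} → Ev ρ e v b → size τ v ≤ b
Ev-size (t , _ , h) = m+n≤o⇒n≤o t h

Ev-weaken : ∀ {Γ τ} {ρ : Val Γ} {e : Tm Γ τ} {v b c} → b ≤ c → Ev ρ e v b → Ev ρ e v c
Ev-weaken b≤c (t , p , h) = t , p , ≤-trans h b≤c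

private
  rearrange : ∀ s t v w → suc (s + t) + (v + w) ≡ suc ((s + v) + (t + w))
  rearrange = solve-∀

  binary-bound : ∀ s t v w {x b c} → x ≤ v + w → s + v ≤ b → t + w ≤ c → suc (s + t) + x ≤ suc (b + c)
  binary-bound s t v w x≤ p q = ≤-trans (+-monoʳ-≤ (suc (s + t)) x≤)
    (≤-trans (≤-reflexive (rearrange s t v w)) (s≤s (+-mono-≤ p q)))

Ev-bind : ∀ {Γ σ τ} {ρ : Val Γ} {e : Tm Γ σ} {f : Tm (σ ∷ Γ) τ} {v w b c} →
          Ev ρ e v b → Ev (v , ρ) f w c → Ev ρ (bind e f) w (suc (b + c))
Ev-bind {σ = σ} {τ} {v = v} {w} (s , p , h) (t , q , k) =
  suc (s + t) , ⇓bind p q , binary-bound s t (size σ v) (size τ w) (m≤n+m _ (size σ v)) h k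

-- Polynomial-time computable functions of an environment

record Poly {Γ τ} (f : Val Γ → ⟦ τ ⟧) : Set where
  constructor poly
  field
    term  : Tm Γ τ
    bound : Pol
    runs  : ∀ ρ → Ev ρ term (f ρ) (eval bound (sizeᵉ Γ ρ))

open Poly public

PolyB : ∀ {Γ} → (Val Γ → Bool) → Set
PolyB b = Poly (encodeBool ∘ b)

size≤bound : ∀ {Γ τ} {f : Val Γ → ⟦ τ ⟧} (p : Poly f) ρ → size τ (f ρ) ≤ eval (bound p) (sizeᵉ Γ ρ)
size≤bound p ρ = Ev-size (runs p ρ)

Poly-ext : ∀ {Γ τ} {f g : Val Γ → ⟦ τ ⟧} → (∀ ρ → f ρ ≡ g ρ) → Poly f → Poly g
Poly-ext eq (poly e b r) = poly e b λ ρ → subst (λ v → Ev ρ e v _) (eq ρ) (r ρ)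

-- Closure of polynomial time under the constructs of the language

varP : ∀ {Γ τ} (x : Γ ∋ τ) → Poly (look x)
varP x = poly (var x) (con 1 ⊞ X) λ ρ →
  1 , subst (λ v → toEnv ρ ⊢ var x ⇓ v ∣ 1) (lookup-toEnv x ρ) ⇓var , s≤s (size-look x ρ)

pattern ix0 = here refl
pattern ix1 = there ix0
pattern ix2 = there ix1
pattern ix3 = there ix2

v0 : ∀ {Γ σ} → Poly {σ ∷ Γ} proj₁
v0 = varP ix0

v1 : ∀ {Γ σ τ} → Poly {σ ∷ τ ∷ Γ} (λ ρ → proj₁ (proj₂ ρ))
v1 = varP ix1

v2 : ∀ {Γ σ τ υ} → Poly {σ ∷ τ ∷ υ ∷ Γ} (λ ρ → proj₁ (proj₂ (proj₂ ρ)))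
v2 = varP ix2

v3 : ∀ {Γ σ τ υ ω} → Poly {σ ∷ τ ∷ υ ∷ ω ∷ Γ} (λ ρ → proj₁ (proj₂ (proj₂ (proj₂ ρ))))
v3 = varP ix3

v4 : ∀ {Γ σ τ υ ω ζ} → Poly {σ ∷ τ ∷ υ ∷ ω ∷ ζ ∷ Γ} (λ ρ → proj₁ (proj₂ (proj₂ (proj₂ (proj₂ ρ)))))
v4 = varP (there ix3)

bindP : ∀ {Γ σ τ} {e : Val Γ → ⟦ σ ⟧} {f : Val (σ ∷ Γ) → ⟦ τ ⟧} →
        Poly e → Poly f → Poly (λ ρ → f (e ρ , ρ))
bindP pe pf = poly (bind (term pe) (term pf)) (con 1 ⊞ (bound pe ⊞ bound pf ⊚ (bound pe ⊞ X))) λ ρ →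
  Ev-bind (runs pe ρ)
    (Ev-weaken (eval-mono (bound pf) (+-monoˡ-≤ _ (size≤bound pe ρ))) (runs pf (_ , ρ)))

litP : ∀ {Γ} n → Poly {Γ} {nat} (λ _ → n)
litP n = poly (lit n) (con 2) λ ρ → 1 , ⇓lit , ≤-refl

addP : ∀ {Γ} {e f : Val Γ → ℕ} → Poly {τ = nat} e → Poly {τ = nat} f → Poly {τ = nat} (λ ρ → e ρ + f ρ)
addP pe pf = poly (add (term pe) (term pf)) (con 1 ⊞ (bound pe ⊞ bound pf)) λ ρ →
  let (s , p , h) = runs pe ρ ; (t , q , k) = runs pf ρ in
  suc (s + t) , ⇓add p q , binary-bound s t 1 1 (s≤s z≤n) h k

subP : ∀ {Γ} {e f : Val Γ → ℕ} → Poly {τ = nat} e → Poly {τ = nat} f → Poly {τ = nat} (λ ρ → e ρ ∸ f ρ)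
subP pe pf = poly (sub (term pe) (term pf)) (con 1 ⊞ (bound pe ⊞ bound pf)) λ ρ →
  let (s , p , h) = runs pe ρ ; (t , q , k) = runs pf ρ in
  suc (s + t) , ⇓sub p q , binary-bound s t 1 1 (s≤s z≤n) h k

size-bool : ∀ b → size bool b ≡ 1
size-bool (inj₁ _) = refl
size-bool (inj₂ _) = refl

leqP : ∀ {Γ} {e f : Val Γ → ℕ} → Poly {τ = nat} e → Poly {τ = nat} f → PolyB (λ ρ → e ρ ≤ᵇ f ρ)
leqP {e = e} {f} pe pf = poly (leq (term pe) (term pf)) (con 1 ⊞ (bound pe ⊞ bound pf)) λ ρ →
  let (s , p , h) = runs pe ρ ; (t , q , k) = runs pf ρ in
  suc (s + t) , ⇓leq p q ,
  binary-bound s t 1 1 (≤-trans (≤-reflexive (size-bool (encodeBool (e ρ ≤ᵇ f ρ)))) (s≤s z≤n)) h k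

ttP : ∀ {Γ} → Poly {Γ} {unit} (λ _ → tt)
ttP = poly triv (con 2) λ ρ → 1 , ⇓triv , ≤-refl

pairP : ∀ {Γ σ τ} {e : Val Γ → ⟦ σ ⟧} {f : Val Γ → ⟦ τ ⟧} →
        Poly e → Poly f → Poly {τ = σ ⊗ τ} (λ ρ → e ρ , f ρ)
pairP {σ = σ} {τ} {e} {f} pe pf = poly (pair (term pe) (term pf)) (con 1 ⊞ (bound pe ⊞ bound pf)) λ ρ →
  let (s , p , h) = runs pe ρ ; (t , q , k) = runs pf ρ in
  suc (s + t) , ⇓pair p q , binary-bound s t (size σ (e ρ)) (size τ (f ρ)) ≤-refl h k

fstP : ∀ {Γ σ τ} {e : Val Γ → ⟦ σ ⟧ × ⟦ τ ⟧} → Poly {τ = σ ⊗ τ} e → Poly {τ = σ} (λ ρ → proj₁ (e ρ))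
fstP pe = poly (fst (term pe)) (con 1 ⊞ bound pe) λ ρ →
  let (s , p , h) = runs pe ρ in
  suc s , ⇓fst p , s≤s (≤-trans (+-monoʳ-≤ s (m≤m+n _ _)) h)

sndP : ∀ {Γ σ τ} {e : Val Γ → ⟦ σ ⟧ × ⟦ τ ⟧} → Poly {τ = σ ⊗ τ} e → Poly {τ = τ} (λ ρ → proj₂ (e ρ))
sndP {σ = σ} {e = e} pe = poly (snd (term pe)) (con 1 ⊞ bound pe) λ ρ →
  let (s , p , h) = runs pe ρ in
  suc s , ⇓snd p , s≤s (≤-trans (+-monoʳ-≤ s (m≤n+m _ (size σ (proj₁ (e ρ))))) h)

inlP : ∀ {Γ σ τ} {e : Val Γ → ⟦ σ ⟧} → Poly e → Poly {τ = σ ⊕ τ} (λ ρ → inj₁ (e ρ))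
inlP pe = poly (inl (term pe)) (con 1 ⊞ bound pe) λ ρ →
  let (s , p , h) = runs pe ρ in suc s , ⇓inl p , s≤s h

inrP : ∀ {Γ σ τ} {e : Val Γ → ⟦ τ ⟧} → Poly e → Poly {τ = σ ⊕ τ} (λ ρ → inj₂ (e ρ))
inrP pe = poly (inr (term pe)) (con 1 ⊞ bound pe) λ ρ →
  let (s , p , h) = runs pe ρ in suc s , ⇓inr p , s≤s h

[]P : ∀ {Γ τ} → Poly {Γ} {list τ} (λ _ → [])
[]P = poly nil (con 2) λ ρ → 1 , ⇓nil , ≤-refl

consP : ∀ {Γ τ} {e : Val Γ → ⟦ τ ⟧} {f : Val Γ → List ⟦ τ ⟧} →
        Poly e → Poly {τ = list τ} f → Poly {τ = list τ} (λ ρ → e ρ ∷ f ρ)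
consP {τ = τ} {e} {f} pe pf = poly (cons (term pe) (term pf)) (con 1 ⊞ (bound pe ⊞ bound pf)) λ ρ →
  let (s , p , h) = runs pe ρ ; (t , q , k) = runs pf ρ in
  suc (s + t) , ⇓cons p q , binary-bound s t (size τ (e ρ)) (suc (sizes τ (f ρ))) (≤-reflexive (sym (+-suc (size τ (e ρ)) _))) h k

caseP : ∀ {Γ ρ σ τ} {e : Val Γ → ⟦ ρ ⟧ ⊎ ⟦ σ ⟧} {f : Val (ρ ∷ Γ) → ⟦ τ ⟧} {g : Val (σ ∷ Γ) → ⟦ τ ⟧} →
        Poly {τ = ρ ⊕ σ} e → Poly f → Poly g →
        Poly {τ = τ} (λ ρ → [ (λ v → f (v , ρ)) , (λ v → g (v , ρ)) ]′ (e ρ))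
caseP {Γ} {π} {σ} {τ} {e} {f} {g} pe pf pg =
  poly (caseSum (term pe) (term pf) (term pg)) b go
  where
  b : Pol
  b = con 1 ⊞ (bound pe ⊞ (bound pf ⊞ bound pg) ⊚ (bound pe ⊞ X))

  go : ∀ ρ → Ev ρ (caseSum (term pe) (term pf) (term pg))
                  ([ (λ v → f (v , ρ)) , (λ v → g (v , ρ)) ]′ (e ρ)) (eval b (sizeᵉ Γ ρ))
  go ρ with e ρ | runs pe ρ
  ... | inj₁ v | (s , p , h) =
    let (t , q , k) = runs pf (v , ρ) in
    suc (s + t) , ⇓case₁ p q , binary-bound s t (size π v) (size τ (f (v , ρ))) (m≤n+m _ (size π v)) h
      (≤-trans k (≤-trans (eval-mono (bound pf) (+-monoˡ-≤ _ (m+n≤o⇒n≤o s h))) (m≤m+n _ _)))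
  ... | inj₂ v | (s , p , h) =
    let (t , q , k) = runs pg (v , ρ) in
    suc (s + t) , ⇓case₂ p q , binary-bound s t (size σ v) (size τ (g (v , ρ))) (m≤n+m _ (size σ v)) h
      (≤-trans k (≤-trans (eval-mono (bound pg) (+-monoˡ-≤ _ (m+n≤o⇒n≤o s h))) (m≤n+m _ (eval (bound pf) _))))

renameP : ∀ {Γ Δ τ} (r : Ren Γ Δ) (φ : Val Δ → Val Γ) {f : Val Γ → ⟦ τ ⟧} →
          (∀ ρ → Respects r (toEnv (φ ρ)) (toEnv ρ)) → (∀ ρ → sizeᵉ Γ (φ ρ) ≤ sizeᵉ Δ ρ) →
          Poly f → Poly (λ ρ → f (φ ρ))
renameP r φ h k pf = poly (rename r (term pf)) (bound pf) λ ρ →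
  let (t , p , b) = runs pf (φ ρ) in
  t , rename-⇓ (h ρ) p , ≤-trans b (eval-mono (bound pf) (k ρ))

wkP : ∀ {Γ σ τ} {f : Val Γ → ⟦ τ ⟧} → Poly f → Poly {σ ∷ Γ} (λ ρ → f (proj₂ ρ))
wkP {σ = σ} = renameP there proj₂ (λ ρ x → refl) (λ (v , ρ) → m≤n+m _ (size σ v))

-- Calling a function from a different context

infixr 5 _∷ᵃ_

-- The last index is the function that computes the whole argument environment; it lets `callP` be
-- stated for any `f`, as precomposition with that function.
data Args (Γ : Ctx) : ∀ Δ → (Val Γ → Val Δ) → Set where
  []ᵃ  : Args Γ [] (λ _ → tt)
  _∷ᵃ_ : ∀ {σ Δ e a} → Poly {Γ} {σ} e → Args Γ Δ a → Args Γ (σ ∷ Δ) (λ ρ → e ρ , a ρ)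

private
  append : ∀ Δ {Γ} → Val Δ → Val Γ → Val (Δ ++ Γ)
  append []      _       ρ = ρ
  append (σ ∷ Δ) (v , δ) ρ = v , append Δ δ ρ

  left : ∀ Δ {Γ} → Val (Δ ++ Γ) → Val Δ
  left []      ρ       = tt
  left (σ ∷ Δ) (v , ρ) = v , left Δ ρ

  right : ∀ Δ {Γ} → Val (Δ ++ Γ) → Val Γ
  right []      ρ       = ρ
  right (σ ∷ Δ) (v , ρ) = right Δ ρ

  left-append : ∀ Δ {Γ} (δ : Val Δ) (ρ : Val Γ) → left Δ (append Δ δ ρ) ≡ δ
  left-append []      δ       ρ = refl
  left-append (σ ∷ Δ) (v , δ) ρ = cong (v ,_) (left-append Δ δ ρ)

  right-append : ∀ Δ {Γ} (δ : Val Δ) (ρ : Val Γ) → right Δ (append Δ δ ρ) ≡ ρ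
  right-append []      δ       ρ = refl
  right-append (σ ∷ Δ) (v , δ) ρ = right-append Δ δ ρ

  intoLeft : ∀ Δ {Γ} → Ren Δ (Δ ++ Γ)
  intoLeft (σ ∷ Δ) (here eq) = here eq
  intoLeft (σ ∷ Δ) (there x) = there (intoLeft Δ x)

  intoLeft-respects : ∀ Δ {Γ} (ρ : Val (Δ ++ Γ)) → Respects (intoLeft Δ) (toEnv (left Δ ρ)) (toEnv ρ)
  intoLeft-respects (σ ∷ Δ) (v , ρ) (here refl) = refl
  intoLeft-respects (σ ∷ Δ) (v , ρ) (there x)   = intoLeft-respects Δ ρ x

  size-left : ∀ Δ {Γ} (ρ : Val (Δ ++ Γ)) → sizeᵉ Δ (left Δ ρ) ≤ sizeᵉ (Δ ++ Γ) ρ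
  size-left []      ρ       = z≤n
  size-left (σ ∷ Δ) (v , ρ) = +-monoʳ-≤ (size σ v) (size-left Δ ρ)

  weakenBy : ∀ Δ {Γ τ} {f : Val Γ → ⟦ τ ⟧} → Poly f → Poly (λ ρ → f (right Δ ρ))
  weakenBy []      pf = pf
  weakenBy (σ ∷ Δ) pf = wkP (weakenBy Δ pf)

  -- The tail is bound outermost, so the first argument is evaluated last, underneath the values of
  -- the others. It is weakened past them, and `right-append` shows that it still sees the original
  -- environment.
  bindArgs : ∀ {Γ} Δ {τ} {f : Val (Δ ++ Γ) → ⟦ τ ⟧} {a} → Poly f → Args Γ Δ a → Poly (λ ρ → f (append Δ (a ρ) ρ))
  bindArgs []      pf []ᵃ                       = pf
  bindArgs (σ ∷ Δ) {f = f} pf (_∷ᵃ_ {e = e} {a = a} pe as) =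
    Poly-ext (λ ρ → cong (λ ρ′ → f (e ρ′ , append Δ (a ρ) ρ)) (right-append Δ (a ρ) ρ))
      (bindArgs Δ (bindP (weakenBy Δ pe) pf) as)

callP : ∀ {Γ Δ τ} {f : Val Δ → ⟦ τ ⟧} {a} → Poly f → Args Γ Δ a → Poly (λ ρ → f (a ρ))
callP {Γ} {Δ} {f = f} {a} pf as = Poly-ext (λ ρ → cong f (left-append Δ (a ρ) ρ))
  (bindArgs Δ (renameP (intoLeft Δ) (left Δ) (intoLeft-respects Δ) (size-left Δ) pf) as)

-- Loops over lists

module _ {Γ : Ctx} {σ τ : Ty} where

  underLoop : Ren (σ ∷ τ ∷ Γ) (σ ∷ τ ∷ σ ∷ list σ ∷ list σ ⊗ τ ∷ Γ)
  underLoop (here eq)         = here eq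
  underLoop (there (here eq)) = there (here eq)
  underLoop (there (there x)) = there (there (there (there (there x))))

  -- The iteration state is the remaining list together with the accumulator. Once the list is taken
  -- apart, accumulator and head are bound again on top, where `b` expects them; `underLoop` skips
  -- what the iteration has left in between.
  loopBody : Tm (σ ∷ τ ∷ Γ) τ → Tm (list σ ⊗ τ ∷ Γ) ((list σ ⊗ τ) ⊕ τ)
  loopBody b = caseList (fst (var ix0)) (inr (snd (var ix0)))
    (inl (pair (var ix1) (bind (snd (var ix2)) (bind (var ix1) (rename underLoop b)))))

  foldlTm : Tm (σ ∷ τ ∷ Γ) τ → Tm Γ τ → Tm Γ (list σ) → Tm Γ τ
  foldlTm b z xs = iter (pair xs z) (loopBody b)

  module _ (b : Tm (σ ∷ τ ∷ Γ) τ) (g : ⟦ τ ⟧ → ⟦ σ ⟧ → ⟦ τ ⟧) (ρ : Val Γ) (c : ℕ) where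

    -- The bound `c` is demanded only at the accumulators that the fold really visits. The outer
    -- loop of the algorithm depends on this: its rounds are cheap only because the lists that occur
    -- are small.
    EachStep : ⟦ τ ⟧ → List ⟦ σ ⟧ → Set
    EachStep z []       = ⊤
    EachStep z (x ∷ xs) = Ev (x , z , ρ) b (g z x) c × EachStep (g z x) xs

    -- Recognising the empty list and returning takes 7 steps; every other round takes 12 on top of
    -- the body.
    loop-⇓ : ∀ z xs → EachStep z xs →
             ∃[ t ] (toEnv ρ ⊢ loopBody b ↻ (xs , z) ⇓ foldl g z xs ∣ t) × t ≤ 7 + length xs * (12 + c)
    loop-⇓ z []       _ = 7 , stop (⇓case[] (⇓fst ⇓var) (⇓inr (⇓snd ⇓var))) , ≤-refl
    loop-⇓ z (x ∷ xs) ((t , p , h) , steps) with loop-⇓ (g z x) xs steps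
    ... | u , q , k = _ ,
      step (⇓case∷ (⇓fst ⇓var)
        (⇓inl (⇓pair ⇓var (⇓bind (⇓snd ⇓var) (⇓bind ⇓var (rename-⇓ agrees p)))))) q , (begin
      12 + t + u                                  ≤⟨ +-mono-≤ (+-monoʳ-≤ 12 (m+n≤o⇒m≤o t h)) k ⟩
      12 + c + (7 + length xs * (12 + c))         ≡⟨ shift (12 + c) (length xs * (12 + c)) ⟩
      7 + (12 + c + length xs * (12 + c))         ∎)
      where
      open ≤-Reasoning
      shift : ∀ a d → a + (7 + d) ≡ 7 + (a + d)
      shift = solve-∀
      agrees : Respects underLoop (toEnv (x , z , ρ)) (x ∷ z ∷ x ∷ xs ∷ (x ∷ xs , z) ∷ toEnv ρ)
      agrees (here refl)         = refl
      agrees (there (here refl)) = refl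
      agrees (there (there y))   = refl

    foldl-Ev : ∀ {e d ez exs z xs} → Ev ρ ez z d → Ev ρ exs xs e → EachStep z xs →
               ∀ {m} → size τ (foldl g z xs) ≤ m →
               Ev ρ (foldlTm b ez exs) (foldl g z xs) (9 + (e + d) + length xs * (12 + c) + m)
    foldl-Ev {e} {d} {z = z} {xs} (s , p , h) (t , q , k) steps {m} hm with loop-⇓ z xs steps
    ... | u , r , l = _ , ⇓iter (⇓pair q p) r , +-mono-≤ (begin
      suc (suc (t + s) + u)                        ≤⟨ s≤s (+-mono-≤ (s≤s (+-mono-≤ (m+n≤o⇒m≤o t k) (m+n≤o⇒m≤o s h))) l) ⟩
      suc (suc (e + d) + (7 + length xs * (12 + c))) ≡⟨ shift (e + d) (length xs * (12 + c)) ⟩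
      9 + (e + d) + length xs * (12 + c)           ∎) hm
      where
      open ≤-Reasoning
      shift : ∀ a f → suc (suc a + (7 + f)) ≡ 9 + a + f
      shift = solve-∀

-- The accumulator may grow in each round only by an amount that does not
-- depend on it; otherwise its size could double in each round.
module _ {Γ : Ctx} {σ τ : Ty} {g : ⟦ σ ⟧ → ⟦ τ ⟧ → Val Γ → ⟦ τ ⟧} (growth : Pol)
  (grows : ∀ x z ρ → size τ (g x z ρ) ≤ size τ z + eval growth (size σ x + sizeᵉ Γ ρ))
  (body : Poly {σ ∷ τ ∷ Γ} (λ ρ → g (proj₁ ρ) (proj₁ (proj₂ ρ)) (proj₂ (proj₂ ρ))))
  {z : Val Γ → ⟦ τ ⟧} {xs : Val Γ → List ⟦ σ ⟧} (pz : Poly z) (pxs : Poly {τ = list σ} xs) where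

  private
    accBound stepBound : Pol
    accBound  = bound pz ⊞ bound pxs ⊠ growth ⊚ (bound pxs ⊞ X)
    stepBound = bound body ⊚ (bound pxs ⊞ (accBound ⊞ X))

    module _ (ρ : Val Γ) where
      N a : ℕ
      N = sizeᵉ Γ ρ
      a = eval growth (eval (bound pxs) N + N)

      -- The size of the accumulator plus `a` for each remaining round is a potential that never
      -- increases, so its initial bound `accBound` also bounds every later accumulator.
      next : ∀ z x xs → sizes σ (x ∷ xs) ≤ eval (bound pxs) N →
             size τ z + length (x ∷ xs) * a ≤ eval accBound N →
             size τ (g x z ρ) + length xs * a ≤ eval accBound N
      next z x xs hxs hz = begin
        size τ (g x z ρ) + length xs * a
          ≤⟨ +-monoˡ-≤ _ (≤-trans (grows x z ρ) (+-monoʳ-≤ (size τ z)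
               (eval-mono growth (+-monoˡ-≤ N (m+n≤o⇒m≤o (size σ x) hxs))))) ⟩
        size τ z + a + length xs * a      ≡⟨ +-assoc (size τ z) a _ ⟩
        size τ z + (a + length xs * a)    ≤⟨ hz ⟩
        eval accBound N                   ∎
        where open ≤-Reasoning

      steps : ∀ z xs → sizes σ xs ≤ eval (bound pxs) N → size τ z + length xs * a ≤ eval accBound N →
              EachStep (term body) (λ z x → g x z ρ) ρ (eval stepBound N) z xs
      steps z []       hxs hz = tt
      steps z (x ∷ xs) hxs hz =
        Ev-weaken (eval-mono (bound body) (+-mono-≤ (m+n≤o⇒m≤o (size σ x) hxs) (+-monoˡ-≤ N (m+n≤o⇒m≤o (size τ z) hz))))
          (runs body (x , z , ρ)) ,
        steps (g x z ρ) xs (m+n≤o⇒n≤o (size σ x) hxs) (next z x xs hxs hz)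

      result : ∀ z xs → sizes σ xs ≤ eval (bound pxs) N → size τ z + length xs * a ≤ eval accBound N →
               size τ (foldl (λ z x → g x z ρ) z xs) ≤ eval accBound N
      result z []       hxs hz = m+n≤o⇒m≤o (size τ z) hz
      result z (x ∷ xs) hxs hz = result (g x z ρ) xs (m+n≤o⇒n≤o (size σ x) hxs) (next z x xs hxs hz)

      sizes-xs : sizes σ (xs ρ) ≤ eval (bound pxs) N
      sizes-xs = ≤-trans (n≤1+n _) (size≤bound pxs ρ)

      initial : size τ (z ρ) + length (xs ρ) * a ≤ eval accBound N
      initial = +-mono-≤ (size≤bound pz ρ) (*-monoˡ-≤ a (≤-trans (length≤sizes σ (xs ρ)) sizes-xs))

  foldlP : Poly (λ ρ → foldl (λ z x → g x z ρ) (z ρ) (xs ρ))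
  foldlP = poly (foldlTm (term body) (term pz) (term pxs))
    (con 9 ⊞ (bound pxs ⊞ bound pz) ⊞ bound pxs ⊠ (con 12 ⊞ stepBound) ⊞ accBound) λ ρ →
    Ev-weaken (+-monoˡ-≤ (eval accBound (N ρ)) (+-monoʳ-≤ (9 + (eval (bound pxs) (N ρ) + eval (bound pz) (N ρ)))
        (*-monoˡ-≤ (12 + eval stepBound (N ρ)) (≤-trans (length≤sizes σ (xs ρ)) (sizes-xs ρ)))))
      (foldl-Ev (term body) (λ z x → g x z ρ) ρ (eval stepBound (N ρ)) (runs pz ρ) (runs pxs ρ)
        (steps ρ (z ρ) (xs ρ) (sizes-xs ρ) (initial ρ)) (result ρ (z ρ) (xs ρ) (sizes-xs ρ) (initial ρ)))

-- List functions, conditionals and Booleans derived from the loop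

reverseP : ∀ {Γ σ} {xs : Val Γ → List ⟦ σ ⟧} →
           Poly {τ = list σ} xs → Poly {τ = list σ} (λ ρ → reverse (xs ρ))
reverseP {σ = σ} pxs = foldlP {g = λ x z ρ → x ∷ z} X
  (λ x z ρ → s≤s (≤-trans (≤-reflexive (+-comm (size σ x) _)) (+-monoʳ-≤ (sizes σ z) (m≤m+n _ _))))
  (consP v0 v1) []P pxs

foldrP : ∀ {Γ σ τ} {g : ⟦ σ ⟧ → ⟦ τ ⟧ → Val Γ → ⟦ τ ⟧} (growth : Pol) →
  (∀ x z ρ → size τ (g x z ρ) ≤ size τ z + eval growth (size σ x + sizeᵉ Γ ρ)) →
  Poly {σ ∷ τ ∷ Γ} (λ ρ → g (proj₁ ρ) (proj₁ (proj₂ ρ)) (proj₂ (proj₂ ρ))) →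
  {z : Val Γ → ⟦ τ ⟧} {xs : Val Γ → List ⟦ σ ⟧} → Poly z → Poly {τ = list σ} xs →
  Poly (λ ρ → foldr (λ x z → g x z ρ) (z ρ) (xs ρ))
foldrP {g = g} growth grows body {z} {xs} pz pxs =
  Poly-ext (λ ρ → reverse-foldl (λ z x → g x z ρ) (z ρ) (xs ρ))
    (foldlP growth grows body pz (reverseP pxs))

foldr₁P : ∀ {Γ σ τ} {g : ⟦ σ ⟧ → ⟦ τ ⟧ → Val Γ → ⟦ τ ⟧} → (∀ v → size τ v ≡ 1) →
  Poly {σ ∷ τ ∷ Γ} (λ ρ → g (proj₁ ρ) (proj₁ (proj₂ ρ)) (proj₂ (proj₂ ρ))) →
  {z : Val Γ → ⟦ τ ⟧} {xs : Val Γ → List ⟦ σ ⟧} → Poly z → Poly {τ = list σ} xs →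
  Poly (λ ρ → foldr (λ x z → g x z ρ) (z ρ) (xs ρ))
foldr₁P {g = g} size-1 = foldrP (con 1) λ x z ρ →
  ≤-trans (≤-reflexive (size-1 (g x z ρ))) (m≤n+m 1 _)

ifP : ∀ {Γ τ} {b : Val Γ → Bool} {f g : Val Γ → ⟦ τ ⟧} →
      PolyB b → Poly f → Poly g → Poly (λ ρ → if b ρ then f ρ else g ρ)
ifP {b = b} {f} {g} pb pf pg = Poly-ext (λ ρ → lemma ρ (b ρ)) (caseP pb (wkP pg) (wkP pf))
  where
  lemma : ∀ ρ b → [ (λ _ → g ρ) , (λ _ → f ρ) ]′ (encodeBool b) ≡ (if b then f ρ else g ρ)
  lemma ρ false = refl
  lemma ρ true  = refl

trueP : ∀ {Γ} → PolyB {Γ} (λ _ → true)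
trueP = inrP ttP

falseP : ∀ {Γ} → PolyB {Γ} (λ _ → false)
falseP = inlP ttP

encode-if : ∀ b {c d} → (if b then encodeBool c else encodeBool d) ≡ encodeBool (if b then c else d)
encode-if false = refl
encode-if true  = refl

ifBP : ∀ {Γ} {b c d : Val Γ → Bool} → PolyB b → PolyB c → PolyB d → PolyB (λ ρ → if b ρ then c ρ else d ρ)
ifBP {b = b} pb pc pd = Poly-ext (λ ρ → encode-if (b ρ)) (ifP pb pc pd)

∧P : ∀ {Γ} {b c : Val Γ → Bool} → PolyB b → PolyB c → PolyB (λ ρ → b ρ ∧ c ρ)
∧P {b = b} pb pc = Poly-ext (λ ρ → lemma (b ρ)) (ifP pb pc falseP)
  where
  lemma : ∀ b {c} → (if b then encodeBool c else encodeBool false) ≡ encodeBool (b ∧ c)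
  lemma false = refl
  lemma true  = refl

∨P : ∀ {Γ} {b c : Val Γ → Bool} → PolyB b → PolyB c → PolyB (λ ρ → b ρ ∨ c ρ)
∨P {b = b} pb pc = Poly-ext (λ ρ → lemma (b ρ)) (ifP pb trueP pc)
  where
  lemma : ∀ b {c} → (if b then encodeBool true else encodeBool c) ≡ encodeBool (b ∨ c)
  lemma false = refl
  lemma true  = refl

notP : ∀ {Γ} {b : Val Γ → Bool} → PolyB b → PolyB (λ ρ → not (b ρ))
notP {b = b} pb = Poly-ext (λ ρ → lemma (b ρ)) (ifP pb falseP trueP)
  where
  lemma : ∀ b → (if b then encodeBool false else encodeBool true) ≡ encodeBool (not b)
  lemma false = refl
  lemma true  = refl

isInj₂ : ∀ {A B : Set} → A ⊎ B → Bool
isInj₂ (inj₁ _) = false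
isInj₂ (inj₂ _) = true

isInj₂P : ∀ {Γ σ τ} {e : Val Γ → ⟦ σ ⟧ ⊎ ⟦ τ ⟧} → Poly {τ = σ ⊕ τ} e → PolyB (λ ρ → isInj₂ (e ρ))
isInj₂P {e = e} pe = Poly-ext (λ ρ → lemma (e ρ)) (caseP pe falseP trueP)
  where
  lemma : ∀ {A B : Set} (v : A ⊎ B) → [ (λ _ → encodeBool false) , (λ _ → encodeBool true) ]′ v ≡ encodeBool (isInj₂ v)
  lemma (inj₁ _) = refl
  lemma (inj₂ _) = refl

foldrBP : ∀ {Γ σ} {g : ⟦ σ ⟧ → Bool → Val Γ → Bool} →
  PolyB {σ ∷ bool ∷ Γ} (λ ρ → g (proj₁ ρ) (isInj₂ (proj₁ (proj₂ ρ))) (proj₂ (proj₂ ρ))) →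
  {z : Val Γ → Bool} {xs : Val Γ → List ⟦ σ ⟧} → PolyB z → Poly {τ = list σ} xs →
  PolyB (λ ρ → foldr (λ x b → g x b ρ) (z ρ) (xs ρ))
foldrBP {σ = σ} {g} body {z} {xs} pz pxs =
  Poly-ext (λ ρ → lemma ρ (z ρ) (xs ρ)) (foldr₁P {g = λ x b ρ → encodeBool (g x (isInj₂ b) ρ)} size-bool body pz pxs)
  where
  lemma : ∀ ρ z xs → foldr (λ x b → encodeBool (g x (isInj₂ b) ρ)) (encodeBool z) xs ≡
                     encodeBool (foldr (λ x b → g x b ρ) z xs)
  lemma ρ z []       = refl
  lemma ρ z (x ∷ xs) rewrite lemma ρ z xs with foldr (λ x b → g x b ρ) z xs
  ... | false = refl
  ... | true  = refl

decodeP : ∀ {Γ} {e : Val Γ → ⟦ bool ⟧} → Poly {τ = bool} e → PolyB (λ ρ → isInj₂ (e ρ))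
decodeP = isInj₂P {σ = unit} {unit}

allB anyB : ∀ {A : Set} → (A → Bool) → List A → Bool
allB p = foldr (λ x b → p x ∧ b) true
anyB p = foldr (λ x b → p x ∨ b) false

skipP : ∀ {Γ σ υ τ} {f : Val (σ ∷ Γ) → ⟦ τ ⟧} → Poly f → Poly {σ ∷ υ ∷ Γ} (λ ρ → f (proj₁ ρ , proj₂ (proj₂ ρ)))
skipP {Γ} {σ} {υ} = renameP (λ { (here eq) → here eq ; (there x) → there (there x) }) (λ ρ → proj₁ ρ , proj₂ (proj₂ ρ))
  (λ { ρ (here refl) → refl ; ρ (there x) → refl })
  (λ ρ → +-monoʳ-≤ (size σ (proj₁ ρ)) (m≤n+m _ (size υ (proj₁ (proj₂ ρ)))))

module _ {Γ : Ctx} {σ : Ty} {p : ⟦ σ ⟧ → Val Γ → Bool} {xs : Val Γ → List ⟦ σ ⟧}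
  (pp : PolyB {σ ∷ Γ} (λ ρ → p (proj₁ ρ) (proj₂ ρ))) (pxs : Poly {τ = list σ} xs) where

  allP : PolyB (λ ρ → allB (λ x → p x ρ) (xs ρ))
  allP = foldrBP {g = λ x b ρ → p x ρ ∧ b} (∧P (skipP pp) (decodeP v1)) trueP pxs

  anyP : PolyB (λ ρ → anyB (λ x → p x ρ) (xs ρ))
  anyP = foldrBP {g = λ x b ρ → p x ρ ∨ b} (∨P (skipP pp) (decodeP v1)) falseP pxs

  filterP : Poly {τ = list σ} (λ ρ → L.filterᵇ (λ x → p x ρ) (xs ρ))
  filterP = Poly-ext (λ ρ → lemma ρ (xs ρ))
    (foldrP {τ = list σ} {g = λ x ys ρ → if p x ρ then x ∷ ys else ys} X grows (ifP (skipP pp) (consP v0 v1) v1) []P pxs)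
    where
    grows : ∀ x ys ρ → size (list σ) (if p x ρ then x ∷ ys else ys) ≤
                       size (list σ) ys + (size σ x + sizeᵉ Γ ρ)
    grows x ys ρ with p x ρ
    ... | false = m≤m+n _ _
    ... | true  = s≤s (≤-trans (≤-reflexive (+-comm (size σ x) _)) (+-monoʳ-≤ (sizes σ ys) (m≤m+n _ _)))

    lemma : ∀ ρ xs → foldr (λ x ys → if p x ρ then x ∷ ys else ys) [] xs ≡ L.filterᵇ (λ x → p x ρ) xs
    lemma ρ []       = refl
    lemma ρ (x ∷ xs) with p x ρ
    ... | false = lemma ρ xs
    ... | true  = cong (x ∷_) (lemma ρ xs)

mapP : ∀ {Γ σ τ} {f : ⟦ σ ⟧ → Val Γ → ⟦ τ ⟧} {xs : Val Γ → List ⟦ σ ⟧} →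
  Poly {σ ∷ Γ} {τ} (λ ρ → f (proj₁ ρ) (proj₂ ρ)) → Poly {τ = list σ} xs →
  Poly {τ = list τ} (λ ρ → map (λ x → f x ρ) (xs ρ))
mapP {τ = τ} {f} {xs} pf pxs = Poly-ext (λ ρ → lemma ρ (xs ρ))
  (foldrP {τ = list τ} {g = λ x ys ρ → f x ρ ∷ ys} (bound pf)
    (λ x ys ρ → s≤s (≤-trans (≤-reflexive (+-comm (size τ (f x ρ)) _)) (+-monoʳ-≤ (sizes τ ys) (size≤bound pf (x , ρ)))))
    (consP (skipP pf) v1) []P pxs)
  where
  lemma : ∀ ρ xs → foldr (λ x ys → f x ρ ∷ ys) [] xs ≡ map (λ x → f x ρ) xs
  lemma ρ []       = refl
  lemma ρ (x ∷ xs) = cong (f x ρ ∷_) (lemma ρ xs)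

++P : ∀ {Γ τ} {xs ys : Val Γ → List ⟦ τ ⟧} →
  Poly {τ = list τ} xs → Poly {τ = list τ} ys → Poly {τ = list τ} (λ ρ → xs ρ ++ ys ρ)
++P {τ = τ} {xs} {ys} pxs pys = Poly-ext (λ ρ → lemma (xs ρ) (ys ρ))
  (foldrP {τ = list τ} {g = λ x zs ρ → x ∷ zs} X
    (λ x zs ρ → s≤s (≤-trans (≤-reflexive (+-comm (size τ x) _)) (+-monoʳ-≤ (sizes τ zs) (m≤m+n _ _))))
    (consP v0 v1) pys pxs)
  where
  lemma : ∀ (xs ys : List ⟦ τ ⟧) → foldr _∷_ ys xs ≡ xs ++ ys
  lemma []       ys = refl
  lemma (x ∷ xs) ys = cong (x ∷_) (lemma xs ys)

concatMapP : ∀ {Γ σ τ} {f : ⟦ σ ⟧ → Val Γ → List ⟦ τ ⟧} {xs : Val Γ → List ⟦ σ ⟧} →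
  Poly {σ ∷ Γ} {list τ} (λ ρ → f (proj₁ ρ) (proj₂ ρ)) → Poly {τ = list σ} xs →
  Poly {τ = list τ} (λ ρ → L.concatMap (λ x → f x ρ) (xs ρ))
concatMapP {Γ} {σ} {τ} {f} {xs} pf pxs = Poly-ext (λ ρ → lemma ρ (xs ρ))
  (foldrP {τ = list τ} {g = λ x ys ρ → f x ρ ++ ys} (bound pf) grows
    (++P (skipP pf) v1) []P pxs)
  where
  grows : ∀ x ys ρ → suc (sizes τ (f x ρ ++ ys)) ≤ suc (sizes τ ys) + eval (bound pf) (size σ x + sizeᵉ Γ ρ)
  grows x ys ρ = s≤s (begin
    sizes τ (f x ρ ++ ys)               ≡⟨ sizes-++ τ (f x ρ) ys ⟩
    sizes τ (f x ρ) + sizes τ ys        ≡⟨ +-comm (sizes τ (f x ρ)) _ ⟩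
    sizes τ ys + sizes τ (f x ρ)        ≤⟨ +-monoʳ-≤ (sizes τ ys) (≤-trans (n≤1+n _) (size≤bound pf (x , ρ))) ⟩
    sizes τ ys + eval (bound pf) (size σ x + sizeᵉ Γ ρ) ∎)
    where open ≤-Reasoning

  lemma : ∀ ρ xs → foldr (λ x ys → f x ρ ++ ys) [] xs ≡ L.concatMap (λ x → f x ρ) xs
  lemma ρ []       = refl
  lemma ρ (x ∷ xs) = cong (f x ρ ++_) (lemma ρ xs)

opaque
  sumBy : ∀ {A : Set} → (A → ℕ) → List A → ℕ
  sumBy f = foldr (λ x s → f x + s) 0

  maxBy : ∀ {A : Set} → (A → ℕ) → List A → ℕ
  maxBy f = foldr (λ x m → if f x ≤ᵇ m then m else f x) 0

module _ {Γ : Ctx} {σ : Ty} {f : ⟦ σ ⟧ → Val Γ → ℕ} {xs : Val Γ → List ⟦ σ ⟧}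
  (pf : Poly {σ ∷ Γ} {nat} (λ ρ → f (proj₁ ρ) (proj₂ ρ))) (pxs : Poly {τ = list σ} xs) where

  opaque
    unfolding sumBy

    sumP : Poly {τ = nat} (λ ρ → sumBy (λ x → f x ρ) (xs ρ))
    sumP = foldr₁P {τ = nat} {g = λ x s ρ → f x ρ + s} (λ _ → refl) (addP (skipP pf) v1) (litP 0) pxs

  opaque
    unfolding maxBy

    maxP : Poly {τ = nat} (λ ρ → maxBy (λ x → f x ρ) (xs ρ))
    maxP = foldr₁P {τ = nat} {g = λ x m ρ → if f x ρ ≤ᵇ m then m else f x ρ} (λ _ → refl)
      (ifP (leqP (skipP pf) v1) v1 (skipP pf)) (litP 0) pxs

-- The algorithm

eqℕ : ℕ → ℕ → Bool
eqℕ m n = (m ≤ᵇ n) ∧ (n ≤ᵇ m)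

eqBool : ⟦ bool ⟧ → ⟦ bool ⟧ → Bool
eqBool a b = if isInj₂ a then isInj₂ b else not (isInj₂ b)

opaque
  -- A single pass with a countdown from `suc i`; the element met at count 1 is kept. Truncated
  -- subtraction then holds the counter at 0, so no later element replaces it.
  nth : ∀ {A : Set} → A → List A → ℕ → A
  nth z xs i = proj₂ (foldl (λ (k , y) x → k ∸ 1 , (if eqℕ k 1 then x else y)) (suc i , z) xs)

Cell Partial Entry Global : Ty
-- (is on the server?, completion time) of a scheduled job.
Cell    = unit ⊕ (bool ⊗ nat)
Partial = list Cell
Entry   = nat ⊗ nat ⊗ bool ⊗ nat
-- Deadline, processing times, edges, jobs, and K = n · m and B = n · (m + 1)
-- in unary, where m ≥ 1 / ε.
Global  = nat ⊗ list (nat ⊗ (unit ⊕ nat)) ⊗ list (list (bool ⊗ nat)) ⊗ list nat ⊗ list unit ⊗ list unit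

deadline : ⟦ Global ⟧ → ℕ
deadline (d , _) = d

ids : ⟦ Global ⟧ → List ℕ
ids (_ , _ , _ , js , _) = js

timesOf : ⟦ Global ⟧ → ℕ → ℕ × (⊤ ⊎ ℕ)
timesOf (_ , ts , _) j = nth (0 , inj₁ tt) ts j

arc : ⟦ Global ⟧ → ℕ → ℕ → ⟦ bool ⟧ × ℕ
arc (_ , _ , M , _) i j = nth (inj₁ tt , 0) (nth [] M i) j

edgeB : ⟦ Global ⟧ → ℕ → ℕ → Bool
edgeB g i j = isInj₂ (proj₁ (arc g i j))

cell : ⟦ Partial ⟧ → ℕ → ⟦ Cell ⟧
cell s i = nth (inj₁ tt) s i

assigned : ⟦ Partial ⟧ → ℕ → Bool
assigned s i = isInj₂ (cell s i)

-- An unscheduled job counts as a server job completed at time 0. It then contributes nothing to the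
-- cost or to the release of the server, and both can range over all jobs.
value : ⟦ Cell ⟧ → ⟦ bool ⟧ × ℕ
value = [ (λ _ → inj₂ tt , 0) , (λ v → v) ]′

sideOf : ⟦ Partial ⟧ → ℕ → ⟦ bool ⟧
sideOf s i = proj₁ (value (cell s i))

timeOf : ⟦ Partial ⟧ → ℕ → ℕ
timeOf s i = proj₂ (value (cell s i))

processing : ⟦ Global ⟧ → ℕ → ⟦ bool ⟧ → ⊤ ⊎ ℕ
processing g j b = if isInj₂ b then inj₂ (proj₁ (timesOf g j)) else proj₂ (timesOf g j)

ready : ⟦ Global ⟧ → ⟦ Partial ⟧ → ℕ → ⟦ bool ⟧ → ℕ → ℕ
ready g s j b i =
  if edgeB g i j then timeOf s i + (if eqBool (sideOf s i) b then 0 else proj₂ (arc g i j)) else 0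

opaque
  serverFree : ⟦ Global ⟧ → ⟦ Partial ⟧ → ℕ
  serverFree g s = maxBy (λ i → if isInj₂ (sideOf s i) then timeOf s i else 0) (ids g)

maxℕ : ℕ → ℕ → ℕ
maxℕ m n = if m ≤ᵇ n then n else m

opaque
  start : ⟦ Global ⟧ → ⟦ Partial ⟧ → ℕ → ⟦ bool ⟧ → ℕ
  start g s j b = maxℕ (maxBy (ready g s j b) (ids g)) (if isInj₂ b then serverFree g s else 0)

enabled : ⟦ Global ⟧ → ⟦ Partial ⟧ → ℕ → Bool
enabled g s j = not (assigned s j) ∧ allB (λ i → if edgeB g i j then assigned s i else true) (ids g)

opaque
  place : ⟦ Global ⟧ → ⟦ Partial ⟧ → ℕ → ⟦ bool ⟧ × ℕ → ⟦ Partial ⟧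
  place g s j v = map (λ i → if eqℕ i j then inj₂ v else cell s i) (ids g)

times-K : ⟦ Global ⟧ → ℕ → ℕ
times-K (_ , _ , _ , _ , u , _) x = sumBy (λ _ → x) u

times-B : ⟦ Global ⟧ → ℕ → ℕ
times-B (_ , _ , _ , _ , _ , u) x = sumBy (λ _ → x) u

-- For m > 0 the test reads c ≤ (1 + 1 / m) d. It yields the guarantee on the makespan and keeps
-- times in the range that `bucket` can resolve.
attemptWith : ⟦ Global ⟧ → ⟦ Partial ⟧ → ℕ → ⟦ bool ⟧ → ℕ → List ⟦ Partial ⟧
attemptWith g s j b c =
  if enabled g s j ∧ (times-K g c ≤ᵇ times-B g (deadline g)) then place g s j (b , c) ∷ [] else []

attempt : ⟦ Global ⟧ → ⟦ Partial ⟧ → ℕ → ⟦ bool ⟧ → List ⟦ Partial ⟧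
attempt g s j b = [ (λ _ → []) , (λ p → attemptWith g s j b (start g s j b + p)) ]′ (processing g j b)

candidates : ⟦ Global ⟧ → List ⟦ Partial ⟧ → List ⟦ Partial ⟧
candidates g = L.concatMap λ s → L.concatMap (λ j → attempt g s j (inj₂ tt) ++ attempt g s j (inj₁ tt)) (ids g)

-- ⌊ K x / d ⌋ for K x ≤ B d and d > 0.
bucketStep : ℕ → ℕ × ℕ → ℕ × ℕ
bucketStep d (y , c) = if d ≤ᵇ y then (y ∸ d , suc c) else (y , c)

opaque
  bucket : ⟦ Global ⟧ → ℕ → ℕ
  bucket g@(d , _ , _ , _ , _ , u) x = proj₂ (foldr (λ _ → bucketStep d) (times-K g x , 0) u)

crossing : ⟦ Global ⟧ → ⟦ Partial ⟧ → ℕ → ℕ → Bool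
crossing g s i j = edgeB g i j ∧ (assigned s i ∧ not (assigned s j))

entry : ⟦ Global ⟧ → ⟦ Partial ⟧ → ℕ → ℕ → List ⟦ Entry ⟧
entry g s i j = if crossing g s i j then (i , j , sideOf s i , bucket g (timeOf s i)) ∷ [] else []

-- A tail is repeated for each of its leaving edges, which makes the length exactly the size of the
-- cut.
entries : ⟦ Global ⟧ → ⟦ Partial ⟧ → List ⟦ Entry ⟧
entries g s = L.concatMap (λ i → L.concatMap (entry g s i) (ids g)) (ids g)

opaque
  cost′ : ⟦ Global ⟧ → ⟦ Partial ⟧ → ℕ
  cost′ g s = sumBy (λ i → if isInj₂ (sideOf s i) then 0 else [ (λ _ → 0) , (λ p → p) ]′ (proj₂ (timesOf g i))) (ids g)

eqEntry : ⟦ Entry ⟧ → ⟦ Entry ⟧ → Bool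
eqEntry (i , j , b , c) (i′ , j′ , b′ , c′) = eqℕ i i′ ∧ (eqℕ j j′ ∧ (eqBool b b′ ∧ eqℕ c c′))

subset : List ⟦ Entry ⟧ → List ⟦ Entry ⟧ → Bool
subset xs ys = allB (λ x → anyB (λ y → eqEntry x y) ys) xs

similar : ⟦ Global ⟧ → ⟦ Partial ⟧ → ⟦ Partial ⟧ → Bool
similar g s r = eqℕ (bucket g (serverFree g s)) (bucket g (serverFree g r)) ∧
  (subset (entries g s) (entries g r) ∧ subset (entries g r) (entries g s))

insert : ⟦ Global ⟧ → ⟦ Partial ⟧ → List ⟦ Partial ⟧ → List ⟦ Partial ⟧
insert g s rs =
  if anyB (λ r → similar g r s ∧ (cost′ g r ≤ᵇ cost′ g s)) rs then rs
  else s ∷ L.filterᵇ (λ r → not (similar g r s)) rs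

prune : ⟦ Global ⟧ → List ⟦ Partial ⟧ → List ⟦ Partial ⟧
prune g = foldr (insert g) []

extend : ⟦ Global ⟧ → List ⟦ Partial ⟧ → List ⟦ Partial ⟧
extend g ss = prune g (candidates g ss)

empty : ⟦ Global ⟧ → ⟦ Partial ⟧
empty g = map (λ _ → inj₁ tt) (ids g)

layer : ⟦ Global ⟧ → ℕ → List ⟦ Partial ⟧
layer g zero    = empty g ∷ []
layer g (suc i) = extend g (layer g i)

better : ⟦ Global ⟧ → ⟦ Partial ⟧ → ⊤ ⊎ ⟦ Partial ⟧ → ⊤ ⊎ ⟦ Partial ⟧
better g s = [ (λ _ → inj₂ s) , (λ r → if cost′ g s ≤ᵇ cost′ g r then inj₂ s else inj₂ r) ]′

cheapest : ⟦ Global ⟧ → List ⟦ Partial ⟧ → ⊤ ⊎ ⟦ Partial ⟧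
cheapest g = foldr (better g) (inj₁ tt)

answer : ⟦ Global ⟧ → List ⟦ Partial ⟧ → ⟦ Output ⟧
answer g ss = [ (λ _ → inj₁ tt) , (λ s → inj₂ (map (λ i → value (cell s i)) (ids g))) ]′ (cheapest g ss)

global : List ⊤ → ⟦ Input ⟧ → ⟦ Global ⟧
global u (_ , d , _ , _ , ts , M) = d , ts , M , js , L.concatMap (λ _ → u) js , L.concatMap (λ _ → tt ∷ u) js
  where
  js : List ℕ
  js = foldr (λ _ is → 0 ∷ map suc is) [] ts

-- The algorithm runs in polynomial time

eqℕP : ∀ {Γ} {e f : Val Γ → ℕ} → Poly {τ = nat} e → Poly {τ = nat} f → PolyB (λ ρ → eqℕ (e ρ) (f ρ))
eqℕP pe pf = ∧P (leqP pe pf) (leqP pf pe)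

eqBoolP : ∀ {Γ} {e f : Val Γ → ⟦ bool ⟧} → Poly {τ = bool} e → Poly {τ = bool} f →
          PolyB (λ ρ → eqBool (e ρ) (f ρ))
eqBoolP pe pf = ifBP (decodeP pe) (decodeP pf) (notP (decodeP pf))

opaque
  unfolding nth

  nthP : ∀ {Γ τ} {z : Val Γ → ⟦ τ ⟧} {xs : Val Γ → List ⟦ τ ⟧} {i : Val Γ → ℕ} →
         Poly z → Poly {τ = list τ} xs → Poly {τ = nat} i → Poly {τ = τ} (λ ρ → nth (z ρ) (xs ρ) (i ρ))
  nthP {Γ} {τ} pz pxs pi = sndP {σ = nat} {τ} (foldlP {τ = nat ⊗ τ}
    {g = λ x ky ρ → proj₁ ky ∸ 1 , (if eqℕ (proj₁ ky) 1 then x else proj₂ ky)} X grows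
    (pairP (subP (fstP {τ = τ} v1) (litP 1)) (ifP (eqℕP (fstP {τ = τ} v1) (litP 1)) v0 (sndP {σ = nat} v1)))
    (pairP {σ = nat} (addP (litP 1) pi) pz) pxs)
    where
    grows : ∀ x ky (ρ : Val Γ) → 1 + size τ (if eqℕ (proj₁ ky) 1 then x else proj₂ ky) ≤
                       1 + size τ (proj₂ ky) + (size τ x + sizeᵉ Γ ρ)
    grows x (k , y) ρ with eqℕ k 1
    ... | false = m≤m+n _ _
    ... | true  = s≤s (≤-trans (m≤m+n (size τ x) _) (m≤n+m _ (size τ y)))

deadlineP : Poly {Global ∷ []} {nat} (λ (g , _) → deadline g)
deadlineP = fstP v0

idsP : Poly {Global ∷ []} {list nat} (λ (g , _) → ids g)
idsP = fstP (sndP (sndP (sndP v0)))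

timesOfP : Poly {Global ∷ nat ∷ []} {nat ⊗ (unit ⊕ nat)} (λ (g , j , _) → timesOf g j)
timesOfP = nthP (pairP (litP 0) (inlP ttP)) (fstP (sndP v0)) v1

arcP : Poly {Global ∷ nat ∷ nat ∷ []} {bool ⊗ nat} (λ (g , i , j , _) → arc g i j)
arcP = nthP (pairP falseP (litP 0)) (nthP []P (fstP (sndP (sndP v0))) v1) v2

edgeP : Poly {Global ∷ nat ∷ nat ∷ []} {bool} (λ (g , i , j , _) → encodeBool (edgeB g i j))
edgeP = decodeP (fstP arcP)

cellP : Poly {Partial ∷ nat ∷ []} {Cell} (λ (s , i , _) → cell s i)
cellP = nthP (inlP ttP) v0 v1

assignedP : Poly {Partial ∷ nat ∷ []} {bool} (λ (s , i , _) → encodeBool (assigned s i))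
assignedP = isInj₂P {σ = unit} {bool ⊗ nat} cellP

valueP : Poly {Cell ∷ []} {bool ⊗ nat} (λ (v , _) → value v)
valueP = caseP v0 (pairP trueP (litP 0)) v0

valueOfP : Poly {Partial ∷ nat ∷ []} {bool ⊗ nat} (λ (s , i , _) → value (cell s i))
valueOfP = callP valueP (cellP ∷ᵃ []ᵃ)

sideOfP : Poly {Partial ∷ nat ∷ []} {bool} (λ (s , i , _) → sideOf s i)
sideOfP = fstP valueOfP

timeOfP : Poly {Partial ∷ nat ∷ []} {nat} (λ (s , i , _) → timeOf s i)
timeOfP = sndP valueOfP

processingP : Poly {Global ∷ nat ∷ bool ∷ []} {unit ⊕ nat} (λ (g , j , b , _) → processing g j b)
processingP = ifP (decodeP v2) (inrP (fstP times)) (sndP times)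
  where
  times : Poly {Global ∷ nat ∷ bool ∷ []} {nat ⊗ (unit ⊕ nat)} (λ (g , j , b , _) → timesOf g j)
  times = callP timesOfP (v0 ∷ᵃ v1 ∷ᵃ []ᵃ)

opaque
  unfolding serverFree

  serverFreeP : Poly {Global ∷ Partial ∷ []} {nat} (λ (g , s , _) → serverFree g s)
  serverFreeP = maxP {f = λ i (g , s , _) → if isInj₂ (sideOf s i) then timeOf s i else 0}
    (ifP (decodeP (callP sideOfP (v2 ∷ᵃ v0 ∷ᵃ []ᵃ))) (callP timeOfP (v2 ∷ᵃ v0 ∷ᵃ []ᵃ)) (litP 0))
    (callP idsP (v0 ∷ᵃ []ᵃ))

readyP : Poly {nat ∷ Global ∷ Partial ∷ nat ∷ bool ∷ []} {nat} (λ (i , g , s , j , b , _) → ready g s j b i)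
readyP = ifP (callP edgeP (v1 ∷ᵃ v0 ∷ᵃ v3 ∷ᵃ []ᵃ))
  (addP (callP timeOfP (v2 ∷ᵃ v0 ∷ᵃ []ᵃ))
    (ifP (eqBoolP (callP sideOfP (v2 ∷ᵃ v0 ∷ᵃ []ᵃ)) v4) (litP 0) (sndP {σ = bool} (callP arcP (v1 ∷ᵃ v0 ∷ᵃ v3 ∷ᵃ []ᵃ)))))
  (litP 0)

maxℕP : Poly {nat ∷ nat ∷ []} {nat} (λ (m , n , _) → maxℕ m n)
maxℕP = ifP (leqP v0 v1) v1 v0

opaque
  unfolding start

  startP : Poly {Global ∷ Partial ∷ nat ∷ bool ∷ []} {nat} (λ (g , s , j , b , _) → start g s j b)
  startP = callP maxℕP
    (maxP {f = λ i (g , s , j , b , _) → ready g s j b i} readyP (callP idsP (v0 ∷ᵃ []ᵃ)) ∷ᵃ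
     ifP (decodeP v3) (callP serverFreeP (v0 ∷ᵃ v1 ∷ᵃ []ᵃ)) (litP 0) ∷ᵃ []ᵃ)

enabledP : Poly {Global ∷ Partial ∷ nat ∷ []} {bool} (λ (g , s , j , _) → encodeBool (enabled g s j))
enabledP = ∧P (notP (callP assignedP (v1 ∷ᵃ v2 ∷ᵃ []ᵃ)))
  (allP {p = λ i (g , s , j , _) → if edgeB g i j then assigned s i else true}
    (ifBP (callP edgeP (v1 ∷ᵃ v0 ∷ᵃ v3 ∷ᵃ []ᵃ)) (callP assignedP (v2 ∷ᵃ v0 ∷ᵃ []ᵃ)) trueP)
    (callP idsP (v0 ∷ᵃ []ᵃ)))

opaque
  unfolding place

  placeP : Poly {Global ∷ Partial ∷ nat ∷ bool ⊗ nat ∷ []} {Partial} (λ (g , s , j , v , _) → place g s j v)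
  placeP = mapP {f = λ i (g , s , j , v , _) → if eqℕ i j then inj₂ v else cell s i}
    (ifP (eqℕP v0 v3) (inrP v4) (callP cellP (v2 ∷ᵃ v0 ∷ᵃ []ᵃ)))
    (callP idsP (v0 ∷ᵃ []ᵃ))

times-KP : Poly {Global ∷ nat ∷ []} {nat} (λ (g , x , _) → times-K g x)
times-KP = sumP {f = λ _ (g , x , _) → x} v2 (fstP (sndP (sndP (sndP (sndP v0)))))

times-BP : Poly {Global ∷ nat ∷ []} {nat} (λ (g , x , _) → times-B g x)
times-BP = sumP {f = λ _ (g , x , _) → x} v2 (sndP (sndP (sndP (sndP (sndP v0)))))

attemptWithP : Poly {Global ∷ Partial ∷ nat ∷ bool ∷ nat ∷ []} {list Partial}
  (λ (g , s , j , b , c , _) → attemptWith g s j b c)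
attemptWithP = ifP
  (∧P (callP enabledP (v0 ∷ᵃ v1 ∷ᵃ v2 ∷ᵃ []ᵃ))
      (leqP (callP times-KP (v0 ∷ᵃ v4 ∷ᵃ []ᵃ)) (callP times-BP (v0 ∷ᵃ callP deadlineP (v0 ∷ᵃ []ᵃ) ∷ᵃ []ᵃ))))
  (consP (callP placeP (v0 ∷ᵃ v1 ∷ᵃ v2 ∷ᵃ pairP v3 v4 ∷ᵃ []ᵃ)) []P) []P

attemptP : Poly {Global ∷ Partial ∷ nat ∷ bool ∷ []} {list Partial} (λ (g , s , j , b , _) → attempt g s j b)
attemptP = caseP (callP processingP (v0 ∷ᵃ v2 ∷ᵃ v3 ∷ᵃ []ᵃ)) []P
  (callP attemptWithP (v1 ∷ᵃ v2 ∷ᵃ v3 ∷ᵃ v4 ∷ᵃ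
    addP (callP startP (v1 ∷ᵃ v2 ∷ᵃ v3 ∷ᵃ v4 ∷ᵃ []ᵃ)) v0 ∷ᵃ []ᵃ))

candidatesP : Poly {Global ∷ list Partial ∷ []} {list Partial} (λ (g , ss , _) → candidates g ss)
candidatesP = concatMapP {f = λ s (g , _) → L.concatMap (λ j → attempt g s j (inj₂ tt) ++ attempt g s j (inj₁ tt)) (ids g)}
  (concatMapP {f = λ j (s , g , _) → attempt g s j (inj₂ tt) ++ attempt g s j (inj₁ tt)}
    (++P (callP attemptP (v2 ∷ᵃ v1 ∷ᵃ v0 ∷ᵃ trueP ∷ᵃ []ᵃ)) (callP attemptP (v2 ∷ᵃ v1 ∷ᵃ v0 ∷ᵃ falseP ∷ᵃ []ᵃ)))
    (callP idsP (v1 ∷ᵃ []ᵃ)))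
  v1

bucketStepP : Poly {nat ∷ nat ⊗ nat ∷ []} {nat ⊗ nat} (λ (d , yc , _) → bucketStep d yc)
bucketStepP = ifP (leqP v0 (fstP v1))
  (pairP (subP (fstP v1) v0) (addP (litP 1) (sndP v1))) v1

opaque
  unfolding bucket

  bucketP : Poly {Global ∷ nat ∷ []} {nat} (λ (g , x , _) → bucket g x)
  bucketP = sndP {σ = nat} (foldrP {σ = unit} {nat ⊗ nat} {g = λ _ yc (g , _) → bucketStep (deadline g) yc} (con 0) (λ _ _ _ → ≤-refl)
    (callP bucketStepP (callP deadlineP (v2 ∷ᵃ []ᵃ) ∷ᵃ v1 ∷ᵃ []ᵃ))
    (pairP (callP times-KP (v0 ∷ᵃ v1 ∷ᵃ []ᵃ)) (litP 0))
    (sndP (sndP (sndP (sndP (sndP v0))))))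

crossingP : Poly {Global ∷ Partial ∷ nat ∷ nat ∷ []} {bool} (λ (g , s , i , j , _) → encodeBool (crossing g s i j))
crossingP = ∧P (callP edgeP (v0 ∷ᵃ v2 ∷ᵃ v3 ∷ᵃ []ᵃ))
  (∧P (callP assignedP (v1 ∷ᵃ v2 ∷ᵃ []ᵃ)) (notP (callP assignedP (v1 ∷ᵃ v3 ∷ᵃ []ᵃ))))

entriesP : Poly {Global ∷ Partial ∷ []} {list Entry} (λ (g , s , _) → entries g s)
entriesP = concatMapP {τ = Entry} {f = λ i (g , s , _) → L.concatMap (entry g s i) (ids g)}
  (concatMapP {τ = Entry} {f = λ j (i , g , s , _) → entry g s i j}
    (ifP (callP crossingP (v2 ∷ᵃ v3 ∷ᵃ v1 ∷ᵃ v0 ∷ᵃ []ᵃ))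
      (consP (pairP v1 (pairP v0 (pairP (callP sideOfP (v3 ∷ᵃ v1 ∷ᵃ []ᵃ))
        (callP bucketP (v2 ∷ᵃ callP timeOfP (v3 ∷ᵃ v1 ∷ᵃ []ᵃ) ∷ᵃ []ᵃ))))) []P) []P)
    (callP idsP (v1 ∷ᵃ []ᵃ)))
  (callP idsP (v0 ∷ᵃ []ᵃ))

opaque
  unfolding cost′

  costP : Poly {Global ∷ Partial ∷ []} {nat} (λ (g , s , _) → cost′ g s)
  costP = sumP {f = λ i (g , s , _) → if isInj₂ (sideOf s i) then 0 else [ (λ _ → 0) , (λ p → p) ]′ (proj₂ (timesOf g i))}
    (ifP (decodeP (callP sideOfP (v2 ∷ᵃ v0 ∷ᵃ []ᵃ))) (litP 0)
      (caseP {ρ = unit} {nat} {nat} (sndP {σ = nat} (callP timesOfP (v1 ∷ᵃ v0 ∷ᵃ []ᵃ))) (litP 0) v0))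
    (callP idsP (v0 ∷ᵃ []ᵃ))

eqEntryP : Poly {Entry ∷ Entry ∷ []} {bool} (λ (x , y , _) → encodeBool (eqEntry x y))
eqEntryP = ∧P (eqℕP (fstP v0) (fstP v1)) (∧P (eqℕP (fstP (sndP v0)) (fstP (sndP v1)))
  (∧P (eqBoolP (fstP (sndP (sndP v0))) (fstP (sndP (sndP v1))))
      (eqℕP (sndP (sndP (sndP v0))) (sndP (sndP (sndP v1))))))

subsetP : Poly {list Entry ∷ list Entry ∷ []} {bool} (λ (xs , ys , _) → encodeBool (subset xs ys))
subsetP = allP {σ = Entry} {p = λ x (xs , ys , _) → anyB (λ y → eqEntry x y) ys}
  (anyP {σ = Entry} {p = λ y (x , _) → eqEntry x y} (callP eqEntryP (v1 ∷ᵃ v0 ∷ᵃ []ᵃ)) v2) v0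

similarP : Poly {Global ∷ Partial ∷ Partial ∷ []} {bool} (λ (g , s , r , _) → encodeBool (similar g s r))
similarP = ∧P (eqℕP (callP bucketP (v0 ∷ᵃ callP serverFreeP (v0 ∷ᵃ v1 ∷ᵃ []ᵃ) ∷ᵃ []ᵃ))
                    (callP bucketP (v0 ∷ᵃ callP serverFreeP (v0 ∷ᵃ v2 ∷ᵃ []ᵃ) ∷ᵃ []ᵃ)))
  (∧P (callP subsetP (es ∷ᵃ er ∷ᵃ []ᵃ)) (callP subsetP (er ∷ᵃ es ∷ᵃ []ᵃ)))
  where
  es : Poly {Global ∷ Partial ∷ Partial ∷ []} {list Entry} (λ (g , s , r , _) → entries g s)
  es = callP entriesP (v0 ∷ᵃ v1 ∷ᵃ []ᵃ)

  er : Poly {Global ∷ Partial ∷ Partial ∷ []} {list Entry} (λ (g , s , r , _) → entries g r)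
  er = callP entriesP (v0 ∷ᵃ v2 ∷ᵃ []ᵃ)

insertP : Poly {Global ∷ Partial ∷ list Partial ∷ []} {list Partial} (λ (g , s , rs , _) → insert g s rs)
insertP = ifP
  (anyP {p = λ r (g , s , _) → similar g r s ∧ (cost′ g r ≤ᵇ cost′ g s)}
    (∧P (callP similarP (v1 ∷ᵃ v0 ∷ᵃ v2 ∷ᵃ []ᵃ))
        (leqP (callP costP (v1 ∷ᵃ v0 ∷ᵃ []ᵃ)) (callP costP (v1 ∷ᵃ v2 ∷ᵃ []ᵃ)))) v2)
  v2
  (consP v1 (filterP {p = λ r (g , s , _) → not (similar g r s)} (notP (callP similarP (v1 ∷ᵃ v0 ∷ᵃ v2 ∷ᵃ []ᵃ))) v2))

sizes-filter : ∀ τ (p : ⟦ τ ⟧ → Bool) vs → sizes τ (L.filterᵇ p vs) ≤ sizes τ vs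
sizes-filter τ p []       = z≤n
sizes-filter τ p (v ∷ vs) with p v
... | false = m≤n⇒m≤o+n (size τ v) (sizes-filter τ p vs)
... | true  = +-monoʳ-≤ (size τ v) (sizes-filter τ p vs)

-- This is the additive growth that a fold requires: `insert` adds at most the one state `s`, and
-- filtering only shrinks the list.
size-insert : ∀ g s rs → size (list Partial) (insert g s rs) ≤ size (list Partial) rs + size Partial s
size-insert g s rs with anyB (λ r → similar g r s ∧ (cost′ g r ≤ᵇ cost′ g s)) rs
... | true  = m≤m+n _ _
... | false = s≤s (≤-trans (≤-reflexive (+-comm (size Partial s) _))
                           (+-monoˡ-≤ (size Partial s) (sizes-filter Partial _ rs)))

pruneP : Poly {Global ∷ list Partial ∷ []} {list Partial} (λ (g , ss , _) → prune g ss)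
pruneP = foldrP {g = λ s rs (g , _) → insert g s rs} X
  (λ s rs (g , _) → ≤-trans (size-insert g s rs) (+-monoʳ-≤ (size (list Partial) rs) (m≤m+n _ _)))
  (callP insertP (v2 ∷ᵃ v0 ∷ᵃ v1 ∷ᵃ []ᵃ)) []P v1

extendP : Poly {Global ∷ list Partial ∷ []} {list Partial} (λ (g , ss , _) → extend g ss)
extendP = callP pruneP (v0 ∷ᵃ candidatesP ∷ᵃ []ᵃ)

emptyP : Poly {Global ∷ []} {Partial} (λ (g , _) → empty g)
emptyP = mapP {τ = Cell} {f = λ _ _ → inj₁ tt} (inlP ttP) idsP

betterP : Poly {Global ∷ Partial ∷ unit ⊕ Partial ∷ []} {unit ⊕ Partial} (λ (g , s , r , _) → better g s r)
betterP = caseP v2 (inrP v2)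
  (ifP (leqP (callP costP (v1 ∷ᵃ v2 ∷ᵃ []ᵃ)) (callP costP (v1 ∷ᵃ v0 ∷ᵃ []ᵃ))) (inrP v2) (inrP v0))

size-better : ∀ g s r → size (unit ⊕ Partial) (better g s r) ≤ size (unit ⊕ Partial) r + size Partial s
size-better g s (inj₁ _) = n≤1+n _
size-better g s (inj₂ r) with cost′ g s ≤ᵇ cost′ g r
... | true  = m≤n+m (size Partial s) (size Partial r)
... | false = m≤m+n _ _

cheapestP : Poly {Global ∷ list Partial ∷ []} {unit ⊕ Partial} (λ (g , ss , _) → cheapest g ss)
cheapestP = foldrP {τ = unit ⊕ Partial} {g = λ s r (g , _) → better g s r} X
  (λ s r (g , _) → ≤-trans (size-better g s r) (+-monoʳ-≤ (size (unit ⊕ Partial) r) (m≤m+n _ _)))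
  (callP betterP (v2 ∷ᵃ v0 ∷ᵃ v1 ∷ᵃ []ᵃ)) (inlP ttP) v1

answerP : Poly {Global ∷ list Partial ∷ []} {Output} (λ (g , ss , _) → answer g ss)
answerP = caseP cheapestP (inlP ttP)
  (inrP (mapP {τ = bool ⊗ nat} {f = λ i (s , _) → value (cell s i)}
    (callP valueOfP (v1 ∷ᵃ v0 ∷ᵃ []ᵃ)) (callP idsP (v1 ∷ᵃ []ᵃ))))

globalP : Poly {list unit ∷ Input ∷ []} {Global} (λ (u , x , _) → global u x)
globalP = pairP (fstP (sndP v1)) (pairP times (pairP (sndP (sndP (sndP (sndP (sndP v1)))))
  (pairP jobs (pairP (concatMapP {σ = nat} {unit} {f = λ _ (u , _) → u} v1 jobs)
                     (concatMapP {σ = nat} {unit} {f = λ _ (u , _) → tt ∷ u} (consP ttP v1) jobs)))))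
  where
  times : Poly {list unit ∷ Input ∷ []} {list (nat ⊗ (unit ⊕ nat))} (λ (u , x , _) → proj₁ (proj₂ (proj₂ (proj₂ (proj₂ x)))))
  times = fstP (sndP (sndP (sndP (sndP v1))))

  sizes-map-suc : ∀ is → sizes nat (map suc is) ≡ sizes nat is
  sizes-map-suc []       = refl
  sizes-map-suc (i ∷ is) = cong suc (sizes-map-suc is)

  jobs : Poly {list unit ∷ Input ∷ []} {list nat} (λ (u , x , _) →
    foldr (λ _ is → 0 ∷ map suc is) [] (proj₁ (proj₂ (proj₂ (proj₂ (proj₂ x))))))
  jobs = foldrP {σ = nat ⊗ (unit ⊕ nat)} {list nat} {g = λ _ is _ → 0 ∷ map suc is} (con 1)
    (λ _ is _ → s≤s (≤-reflexive (trans (cong suc (sizes-map-suc is)) (+-comm 1 _))))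
    (consP (litP 0) (mapP {τ = nat} {f = λ i _ → suc i} (addP (litP 1) v0) v1)) []P times

numerator denominator : ⟦ Input ⟧ → ℕ
numerator   x = proj₁ (proj₁ x)
denominator x = proj₂ (proj₁ x)

-- ⌈ 1 / ε ⌉ in unary, by repeated addition of the numerator of ε.
enough : Tm (nat ⊗ list unit ∷ Input ∷ []) bool
enough = leq (snd (fst (var ix1))) (fst (var ix0))

unaryBody : Tm (nat ⊗ list unit ∷ Input ∷ []) ((nat ⊗ list unit) ⊕ list unit)
unaryBody = caseSum enough
  (inl (pair (add (fst (var ix1)) (fst (fst (var ix2)))) (cons triv (snd (var ix1)))))
  (inr (snd (var ix1)))

unaryTm : Tm (Input ∷ []) (list unit)
unaryTm = iter (pair (lit 0) nil) unaryBody

sizes-unit : ∀ u → sizes unit u ≡ length u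
sizes-unit []      = refl
sizes-unit (_ ∷ u) = cong suc (sizes-unit u)

enough-⇓ : ∀ (x : ⟦ Input ⟧) y (u : List ⊤) {b} → (denominator x ≤ᵇ y) ≡ b →
           (y , u) ∷ x ∷ [] ⊢ enough ⇓ encodeBool b ∣ 6
enough-⇓ x y u refl = ⇓leq (⇓snd (⇓fst ⇓var)) (⇓fst ⇓var)

-- The second hypothesis says that the stopping test succeeds after at most `fuel` more rounds. A
-- round that continues takes exactly 20 steps, the last one 11. About the result `v`, standing for
-- m, only m ε ≥ 1 and an upper bound are retained.
unary-loop : ∀ (x : ⟦ Input ⟧) y fuel (u : List ⊤) → y ≡ length u * numerator x →
  denominator x ≤ (length u + fuel) * numerator x →
  ∃[ v ] ∃[ t ] (x ∷ [] ⊢ unaryBody ↻ (y , u) ⇓ v ∣ t) ×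
    denominator x ≤ length v * numerator x × length v ≤ length u + fuel × t ≤ suc fuel * 20
unary-loop x y fuel u y≡ h with denominator x ≤ᵇ y in eq
... | true = u , 11 , stop (⇓case₂ (enough-⇓ x y u eq) (⇓inr (⇓snd ⇓var))) ,
  subst (denominator x ≤_) y≡ (≤ᵇ⇒≤ (denominator x) y (subst T (sym eq) tt)) ,
  m≤m+n _ _ , ≤-trans (m≤m+n 11 9) (m≤m+n 20 _)
-- Without fuel, the hypothesis is the stopping test itself, which has just failed.
unary-loop x y zero u y≡ h | false = ⊥-elim (subst T eq (≤⇒≤ᵇ
  (subst (denominator x ≤_) (trans (cong (_* numerator x) (+-identityʳ (length u))) (sym y≡)) h)))
unary-loop x y (suc fuel) u y≡ h | false
  with unary-loop x (y + numerator x) fuel (tt ∷ u) (trans (+-comm y _) (cong (numerator x +_) y≡))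
         (subst (λ l → denominator x ≤ l * numerator x) (+-suc (length u) fuel) h)
... | v , t , r , hv , lv , ht = v , _ ,
  step (⇓case₁ (enough-⇓ x y u eq)
         (⇓inl (⇓pair (⇓add (⇓fst ⇓var) (⇓fst (⇓fst ⇓var))) (⇓cons ⇓triv (⇓snd ⇓var))))) r ,
  hv , subst (length v ≤_) (sym (+-suc (length u) fuel)) lv , +-monoʳ-≤ 20 ht

unaryBound : Pol
unaryBound = con 30 ⊠ (con 1 ⊞ X)

unary-Ev : ∀ (x : ⟦ Input ⟧) fuel → denominator x ≤ fuel * numerator x →
  ∃[ v ] Ev {Input ∷ []} (x , tt) unaryTm v (eval unaryBound fuel) × denominator x ≤ length v * numerator x × length v ≤ fuel
unary-Ev x fuel h with unary-loop x 0 fuel [] refl h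
... | v , t , r , hv , lv , ht = v , (_ , ⇓iter (⇓pair ⇓lit ⇓nil) r , fits) , hv , lv
  where
  identity : ∀ f → 30 * (1 + f) ≡ suc (3 + (1 + f) * 20) + (1 + f) + (5 + 9 * f)
  identity = solve-∀

  fits : suc (3 + t) + suc (sizes unit v) ≤ 30 * (1 + fuel)
  fits = ≤-trans (+-mono-≤ (s≤s (+-monoʳ-≤ 3 ht)) (s≤s (≤-trans (≤-reflexive (sizes-unit v)) lv)))
    (subst (suc (3 + suc fuel * 20) + suc fuel ≤_) (sym (identity fuel)) (m≤m+n _ _))

-- The program, with its running time in terms of the sizes of the layers

private
  Γ₃ : Ctx
  Γ₃ = Global ∷ list unit ∷ Input ∷ []

  abstract
    extendBody : Poly {nat ∷ list Partial ∷ Γ₃} {list Partial} (λ (_ , ss , g , _) → extend g ss)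
    extendBody = callP extendP (v2 ∷ᵃ v1 ∷ᵃ []ᵃ)

    initialBody : Poly {Γ₃} {list Partial} (λ (g , _) → empty g ∷ [])
    initialBody = consP (callP emptyP (v0 ∷ᵃ []ᵃ)) []P

    idsBody : Poly {Γ₃} {list nat} (λ (g , _) → ids g)
    idsBody = callP idsP (v0 ∷ᵃ []ᵃ)

    answerBody : Poly {list Partial ∷ Γ₃} {Output} (λ (ss , g , _) → answer g ss)
    answerBody = callP answerP (v1 ∷ᵃ v0 ∷ᵃ []ᵃ)

    globalBody : Poly {list unit ∷ Input ∷ []} {Global} (λ (u , x , _) → global u x)
    globalBody = globalP

opaque
  -- One program serves every φ; the dependence on φ lies in the bound on its running time.
  algorithm : Program Input Output
  algorithm = bind unaryTm (bind (term globalBody) (bind (foldlTm (term extendBody) (term initialBody) (term idsBody)) (term answerBody)))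

foldl-layer : ∀ g i (js : List ℕ) → foldl (λ ss _ → extend g ss) (layer g i) js ≡ layer g (length js + i)
foldl-layer g i []       = refl
foldl-layer g i (j ∷ js) = trans (foldl-layer g (suc i) js) (cong (layer g) (+-suc (length js) i))

-- `foldlP` does not cover this loop, as `extend` can multiply the size of its argument. A common
-- bound `m` on all layers replaces the additive growth.
layer-steps : ∀ (ρ : Val Γ₃) {m} i js → let (g , _) = ρ in
  (∀ k → k ≤ length js + i → size (list Partial) (layer g k) ≤ m) →
  EachStep (term extendBody) (λ ss _ → extend g ss) ρ (eval (bound extendBody) (1 + (m + sizeᵉ Γ₃ ρ))) (layer g i) js
layer-steps ρ i []       h = tt
layer-steps ρ {m} i (j ∷ js) h =
  Ev-weaken (eval-mono (bound extendBody) (s≤s (+-monoˡ-≤ (sizeᵉ Γ₃ ρ) (h i (m≤n+m i _)))))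
    (runs extendBody (j , layer _ i , ρ)) ,
  layer-steps ρ (suc i) js (λ k k≤ → h k (subst (k ≤_) (+-suc (length js) i) k≤))

opaque
  unfolding algorithm

  -- The size of the layers is left as a premise, to be discharged by counting states. `timeBound`
  -- is chosen before the input, so it depends on `sizeBound` alone.
  algorithm-runs : (sizeBound : Pol) → ∃[ timeBound ] ∀ x fuel → denominator x ≤ fuel * numerator x →
    ∃[ u ] denominator x ≤ length u * numerator x × length u ≤ fuel ×
      let g = global u x in
      ((∀ k → k ≤ length (ids g) → size (list Partial) (layer g k) ≤ eval sizeBound (size Input x + fuel)) →
       ∃[ t ] Runs algorithm x (answer g (layer g (length (ids g)))) t × t ≤ eval timeBound (size Input x + fuel))
  algorithm-runs sizeBound = timeBound , λ x fuel h → let (u , unary , hu , lu) = unary-Ev x fuel h in u , hu , lu , Main.main x fuel u unary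
    where
    U G S Js C timeBound : Pol
    U = unaryBound
    G = bound globalBody ⊚ (U ⊞ X)
    S = G ⊞ (U ⊞ X)
    Js = bound idsBody ⊚ S
    C = bound extendBody ⊚ (con 1 ⊞ (sizeBound ⊞ S))
    timeBound = con 1 ⊞ (U ⊞ (con 1 ⊞ (G ⊞ (con 1 ⊞
      ((con 9 ⊞ (Js ⊞ bound initialBody ⊚ S) ⊞ Js ⊠ (con 12 ⊞ C) ⊞ sizeBound) ⊞ bound answerBody ⊚ (sizeBound ⊞ S))))))

    module Main (x : ⟦ Input ⟧) (fuel : ℕ) (u : List ⊤) (unary : Ev {Input ∷ []} (x , tt) unaryTm u (eval unaryBound fuel)) where
      g : ⟦ Global ⟧
      g = global u x

      N : ℕ
      N = size Input x + fuel

      ρ : Val Γ₃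
      ρ = g , u , x , tt

      unary′ : Ev (x , tt) unaryTm u (eval U N)
      unary′ = Ev-weaken (eval-mono U (m≤n+m fuel (size Input x))) unary

      x≤N : size Input x + 0 ≤ N
      x≤N = +-monoʳ-≤ (size Input x) z≤n

      global′ : Ev (u , x , tt) (term globalBody) g (eval G N)
      global′ = Ev-weaken (eval-mono (bound globalBody) (+-mono-≤ (Ev-size unary′) x≤N)) (runs globalBody _)

      ρ≤ : sizeᵉ Γ₃ ρ ≤ eval S N
      ρ≤ = +-mono-≤ (Ev-size global′) (+-mono-≤ (Ev-size unary′) x≤N)

      ids≤ : length (ids g) ≤ eval Js N
      ids≤ = ≤-trans (length≤sizes nat (ids g)) (≤-trans (n≤1+n _)
        (≤-trans (size≤bound idsBody ρ) (eval-mono (bound idsBody) ρ≤)))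

      main : (∀ k → k ≤ length (ids g) → size (list Partial) (layer g k) ≤ eval sizeBound N) →
             ∃[ t ] Runs algorithm x (answer g (layer g (length (ids g)))) t × t ≤ eval timeBound N
      main small = let (t , r , b) = all in t , r , m+n≤o⇒m≤o t {size Output (answer g (layer g (length (ids g))))} b
        where
        last : foldl (λ ss _ → extend g ss) (layer g 0) (ids g) ≡ layer g (length (ids g))
        last = trans (foldl-layer g 0 (ids g)) (cong (layer g) (+-identityʳ (length (ids g))))

        loopBound : ℕ
        loopBound = 9 + (eval Js N + eval (bound initialBody ⊚ S) N) + length (ids g) * (12 + eval C N) + eval sizeBound N

        loop : Ev ρ (foldlTm (term extendBody) (term initialBody) (term idsBody)) (layer g (length (ids g))) loopBound
        loop = subst (λ ss → Ev ρ (foldlTm (term extendBody) (term initialBody) (term idsBody)) ss loopBound) last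
          (foldl-Ev (term extendBody) (λ ss _ → extend g ss) ρ (eval C N)
            (Ev-weaken (eval-mono (bound initialBody) ρ≤) (runs initialBody ρ))
            (Ev-weaken (eval-mono (bound idsBody) ρ≤) (runs idsBody ρ))
            (weakenSteps (ids g) (layer g 0) (layer-steps ρ 0 (ids g) (λ k k≤ → small k (subst (k ≤_) (+-identityʳ (length (ids g))) k≤))))
            {m = eval sizeBound N} (subst (λ ss → size (list Partial) ss ≤ eval sizeBound N) (sym last) (small (length (ids g)) ≤-refl)))
          where
          C≤ : eval (bound extendBody) (1 + (eval sizeBound N + sizeᵉ Γ₃ ρ)) ≤ eval C N
          C≤ = eval-mono (bound extendBody) (s≤s (+-monoʳ-≤ (eval sizeBound N) ρ≤))
          weakenSteps : ∀ js ss → EachStep (term extendBody) (λ ss _ → extend g ss) ρ (eval (bound extendBody) (1 + (eval sizeBound N + sizeᵉ Γ₃ ρ))) ss js →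
                        EachStep (term extendBody) (λ ss _ → extend g ss) ρ (eval C N) ss js
          weakenSteps []       ss _        = tt
          weakenSteps (j ∷ js) ss (e , es) = Ev-weaken C≤ e , weakenSteps js (extend g ss) es

        all : Ev (x , tt) algorithm (answer g (layer g (length (ids g)))) (eval timeBound N)
        all = Ev-bind unary′ (Ev-bind global′ (Ev-bind
          (Ev-weaken (+-monoˡ-≤ (eval sizeBound N) (+-monoʳ-≤ (9 + (eval Js N + eval (bound initialBody ⊚ S) N))
            (*-monoˡ-≤ (12 + eval C N) ids≤))) loop)
          (Ev-weaken (eval-mono (bound answerBody) (+-mono-≤ (small (length (ids g)) ≤-refl) ρ≤)) (runs answerBody (layer g (length (ids g)) , ρ)))))

-- Semantics of the auxiliary functions

true≢false : ∀ {A : Set} → true ≡ false → A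
true≢false ()

T⇒≡true : ∀ {b} → T b → b ≡ true
T⇒≡true {true} _ = refl

≡true⇒T : ∀ {b} → b ≡ true → T b
≡true⇒T refl = tt

if-elim : ∀ {A : Set} (P : A → Set) b {x y} → (b ≡ true → P x) → (b ≡ false → P y) → P (if b then x else y)
if-elim P true  t f = t refl
if-elim P false t f = f refl

∧-true : ∀ {b c} → b ∧ c ≡ true → b ≡ true × c ≡ true
∧-true {true} {true} _ = refl , refl

true-∧ : ∀ {b c} → b ≡ true → c ≡ true → b ∧ c ≡ true
true-∧ refl refl = refl

not-true : ∀ {b} → not b ≡ true → b ≡ false
not-true {false} _ = refl

≤ᵇ-true : ∀ {m n} → m ≤ n → (m ≤ᵇ n) ≡ true
≤ᵇ-true p = T⇒≡true (≤⇒≤ᵇ p)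

≤ᵇ-sound : ∀ m n → (m ≤ᵇ n) ≡ true → m ≤ n
≤ᵇ-sound m n p = ≤ᵇ⇒≤ m n (≡true⇒T p)

eqℕ-refl : ∀ n → eqℕ n n ≡ true
eqℕ-refl n = true-∧ (≤ᵇ-true (≤-refl {n})) (≤ᵇ-true (≤-refl {n}))

eqℕ-sound : ∀ m n → eqℕ m n ≡ true → m ≡ n
eqℕ-sound m n p with ∧-true {m ≤ᵇ n} p
... | q , r = ≤-antisym (≤ᵇ-sound m n q) (≤ᵇ-sound n m r)

eqℕ-≢ : ∀ m n → m ≢ n → eqℕ m n ≡ false
eqℕ-≢ m n m≢n with eqℕ m n in eq
... | false = refl
... | true  = ⊥-elim (m≢n (eqℕ-sound m n eq))

eqBool-refl : ∀ b → eqBool b b ≡ true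
eqBool-refl (inj₁ _) = refl
eqBool-refl (inj₂ _) = refl

eqBool-sound : ∀ b c → eqBool b c ≡ true → b ≡ c
eqBool-sound (inj₁ _) (inj₁ _) _ = refl
eqBool-sound (inj₂ _) (inj₂ _) _ = refl

isInj₂-encodeBool : ∀ b → isInj₂ (encodeBool b) ≡ b
isInj₂-encodeBool false = refl
isInj₂-encodeBool true  = refl

allB-tabulate : ∀ {A : Set} {n} p (f : Fin n → A) → (∀ i → p (f i) ≡ true) → allB p (L.tabulate f) ≡ true
allB-tabulate {n = zero}  p f h = refl
allB-tabulate {n = suc n} p f h = true-∧ (h zero) (allB-tabulate p (f ∘ suc) (h ∘ suc))

allB-∈ : ∀ {A : Set} (p : A → Bool) {xs x} → allB p xs ≡ true → x ∈ xs → p x ≡ true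
allB-∈ p {y ∷ xs} h (here refl) = proj₁ (∧-true {p y} h)
allB-∈ p {y ∷ xs} h (there x∈)  = allB-∈ p (proj₂ (∧-true {p y} h)) x∈

∈-allB : ∀ {A : Set} (p : A → Bool) xs → (∀ {x} → x ∈ xs → p x ≡ true) → allB p xs ≡ true
∈-allB p []       h = refl
∈-allB p (x ∷ xs) h = true-∧ (h (here refl)) (∈-allB p xs (h ∘ there))

anyB-∈ : ∀ {A : Set} (p : A → Bool) xs → anyB p xs ≡ true → ∃[ x ] x ∈ xs × p x ≡ true
anyB-∈ p (x ∷ xs) h with p x in eq
... | true  = x , here refl , eq
... | false with anyB-∈ p xs h
...   | y , y∈ , py = y , there y∈ , py

∈-anyB : ∀ {A : Set} (p : A → Bool) {xs x} → x ∈ xs → p x ≡ true → anyB p xs ≡ true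
∈-anyB p {y ∷ xs} (here refl) px rewrite px = refl
∈-anyB p {y ∷ xs} (there x∈)  px with p y
... | true  = refl
... | false = ∈-anyB p x∈ px

maxℕ-≥ˡ : ∀ m n → m ≤ maxℕ m n
maxℕ-≥ˡ m n with m ≤ᵇ n in eq
... | true  = ≤ᵇ-sound m n eq
... | false = ≤-refl

maxℕ-≥ʳ : ∀ m n → n ≤ maxℕ m n
maxℕ-≥ʳ m n with m ≤ᵇ n in eq
... | true  = ≤-refl
... | false = ≰⇒≥ λ m≤n → true≢false (trans (sym (≤ᵇ-true m≤n)) eq)

maxℕ-elim : ∀ (P : ℕ → Set) m n → P m → P n → P (maxℕ m n)
maxℕ-elim P m n pm pn with m ≤ᵇ n
... | true  = pn
... | false = pm

opaque
  unfolding maxBy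

  maxBy-≥ : ∀ {A : Set} {n} f (g : Fin n → A) i → f (g i) ≤ maxBy f (L.tabulate g)
  maxBy-≥ f g zero    = maxℕ-≥ˡ (f (g zero)) _
  maxBy-≥ f g (suc i) = ≤-trans (maxBy-≥ f (g ∘ suc) i) (maxℕ-≥ʳ (f (g zero)) _)

  -- The maximum is 0 or attained, so it inherits an arbitrary property of the values. This directly
  -- gives upper bounds on multiples K x, which is the form in which times are compared.
  maxBy-elim : ∀ (P : ℕ → Set) {A : Set} {n} f (g : Fin n → A) → P 0 → (∀ i → P (f (g i))) → P (maxBy f (L.tabulate g))
  maxBy-elim P {n = zero}  f g p₀ p = p₀
  maxBy-elim P {n = suc n} f g p₀ p = maxℕ-elim P (f (g zero)) _ (p zero) (maxBy-elim P f (g ∘ suc) p₀ (p ∘ suc))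

opaque
  unfolding sumBy

  Σᶠ : ∀ {n} → (Fin n → ℕ) → ℕ
  Σᶠ {zero}  f = 0
  Σᶠ {suc n} f = f zero + Σᶠ (f ∘ suc)

  sumBy-tabulate : ∀ {A : Set} {n} f (g : Fin n → A) → sumBy f (L.tabulate g) ≡ Σᶠ (f ∘ g)
  sumBy-tabulate {n = zero}  f g = refl
  sumBy-tabulate {n = suc n} f g = cong (f (g zero) +_) (sumBy-tabulate f (g ∘ suc))

  Σᶠ-cong : ∀ {n} {f h : Fin n → ℕ} → (∀ i → f i ≡ h i) → Σᶠ f ≡ Σᶠ h
  Σᶠ-cong {zero}  eq = refl
  Σᶠ-cong {suc n} eq = cong₂ _+_ (eq zero) (Σᶠ-cong (eq ∘ suc))

  -- Changing one summand, written without subtraction: each side receives the value that the other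
  -- sum has at `j`.
  Σᶠ-update : ∀ {n} {f h : Fin n → ℕ} j → (∀ i → i ≢ j → f i ≡ h i) → Σᶠ f + h j ≡ Σᶠ h + f j
  Σᶠ-update {f = f} {h} zero eq = begin
    f zero + Σᶠ (f ∘ suc) + h zero   ≡⟨ cong (λ s → f zero + s + h zero) (Σᶠ-cong λ i → eq (suc i) λ ()) ⟩
    f zero + Σᶠ (h ∘ suc) + h zero   ≡⟨ exchange (f zero) (Σᶠ (h ∘ suc)) (h zero) ⟩
    h zero + Σᶠ (h ∘ suc) + f zero   ∎
    where
    open ≡-Reasoning
    exchange : ∀ a b c → a + b + c ≡ c + b + a
    exchange = solve-∀
  Σᶠ-update {f = f} {h} (suc j) eq = begin
    f zero + Σᶠ (f ∘ suc) + h (suc j)     ≡⟨ +-assoc (f zero) _ _ ⟩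
    f zero + (Σᶠ (f ∘ suc) + h (suc j))   ≡⟨ cong₂ _+_ (eq zero λ ()) (Σᶠ-update j λ i i≢j → eq (suc i) (i≢j ∘ F.suc-injective)) ⟩
    h zero + (Σᶠ (h ∘ suc) + f (suc j))   ≡⟨ sym (+-assoc (h zero) _ _) ⟩
    h zero + Σᶠ (h ∘ suc) + f (suc j)     ∎
    where open ≡-Reasoning

  Σᶠ-0 : ∀ {n} {f : Fin n → ℕ} → (∀ i → f i ≡ 0) → Σᶠ f ≡ 0
  Σᶠ-0 {zero}  eq = refl
  Σᶠ-0 {suc n} eq = cong₂ _+_ (eq zero) (Σᶠ-0 (eq ∘ suc))

count : ∀ {n} → (Fin n → Bool) → ℕ
count p = Σᶠ (λ i → if p i then 1 else 0)

opaque
  unfolding Σᶠ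

  count≤ : ∀ {n} (p : Fin n → Bool) → count p ≤ n
  count≤ {zero}  p = z≤n
  count≤ {suc n} p with p zero
  ... | true  = s≤s (count≤ (p ∘ suc))
  ... | false = m≤n⇒m≤1+n (count≤ (p ∘ suc))

  count≡n : ∀ {n} (p : Fin n → Bool) → count p ≡ n → ∀ i → p i ≡ true
  count≡n {suc n} p eq i with p zero in p₀
  count≡n {suc n} p eq zero    | true  = p₀
  count≡n {suc n} p eq (suc i) | true  = count≡n (p ∘ suc) (suc-injective eq) i
  count≡n {suc n} p eq i       | false = ⊥-elim (1+n≰n (subst (_≤ n) eq (count≤ (p ∘ suc))))

  count<n : ∀ {n} (p : Fin n → Bool) → count p < n → ∃[ i ] p i ≡ false
  count<n {suc n} p lt with p zero in p₀
  ... | false = zero , p₀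
  ... | true  with count<n (p ∘ suc) (s≤s⁻¹ lt)
  ...   | i , pi = suc i , pi

opaque
  unfolding nth

  nth-tabulate : ∀ {A : Set} {n} z (f : Fin n → A) i → nth z (L.tabulate f) (toℕ i) ≡ f i
  nth-tabulate z f i = go z f i
    where
    stay : ∀ {A : Set} (y : A) xs → proj₂ (foldl (λ (k , y) x → k ∸ 1 , (if eqℕ k 1 then x else y)) (0 , y) xs) ≡ y
    stay y []       = refl
    stay y (x ∷ xs) = stay y xs

    go : ∀ {A : Set} {n} z (f : Fin n → A) i → nth z (L.tabulate f) (toℕ i) ≡ f i
    go z f zero    = stay (f zero) (L.tabulate (f ∘ suc))
    go z f (suc i) = go z (f ∘ suc) i

-- The bucket of y is ⌊ y / d ⌋, unless this exceeds the length of u.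
module _ (d y : ℕ) where

  bucketed : List ⊤ → ℕ × ℕ
  bucketed = foldr (λ _ → bucketStep d) (y , 0)

  bucketed-sum : ∀ u → proj₁ (bucketed u) + proj₂ (bucketed u) * d ≡ y
  bucketed-sum []      = +-identityʳ y
  bucketed-sum (_ ∷ u) with bucketed u | bucketed-sum u
  ... | x , c | eq with d ≤ᵇ x in le
  ...   | false = eq
  ...   | true  = begin
    x ∸ d + (d + c * d)   ≡⟨ sym (+-assoc (x ∸ d) d _) ⟩
    x ∸ d + d + c * d     ≡⟨ cong (_+ c * d) (m∸n+n≡m (≤ᵇ-sound d x le)) ⟩
    x + c * d             ≡⟨ eq ⟩
    y                     ∎
    where open ≡-Reasoning

  bucketed-≤ : ∀ u → proj₂ (bucketed u) ≤ length u
  bucketed-≤ []      = z≤n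
  bucketed-≤ (_ ∷ u) with bucketed u | bucketed-≤ u
  ... | x , c | le with d ≤ᵇ x
  ...   | false = m≤n⇒m≤1+n le
  ...   | true  = s≤s le

  -- The second alternative says that every round so far has subtracted d. The weak inequality in
  -- the first is what a closed range up to `length u * d` allows when d = 0.
  bucketed-rest : ∀ u → proj₁ (bucketed u) ≤ d ⊎ proj₁ (bucketed u) + length u * d ≤ y
  bucketed-rest []      = inj₂ (≤-reflexive (+-identityʳ y))
  bucketed-rest (_ ∷ u) with bucketed u | bucketed-rest u
  ... | x , c | r with d ≤ᵇ x in le
  ...   | false = inj₁ (≰⇒≥ λ d≤x → true≢false (trans (sym (≤ᵇ-true d≤x)) le))
  bucketed-rest (_ ∷ u) | x , c | inj₁ x≤d | true = inj₁ (≤-trans (m∸n≤m x d) x≤d)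
  bucketed-rest (_ ∷ u) | x , c | inj₂ h   | true = inj₂ (begin
    x ∸ d + (d + length u * d)   ≡⟨ sym (+-assoc (x ∸ d) d _) ⟩
    x ∸ d + d + length u * d     ≡⟨ cong (_+ length u * d) (m∸n+n≡m (≤ᵇ-sound d x le)) ⟩
    x + length u * d             ≤⟨ h ⟩
    y                            ∎)
    where open ≤-Reasoning

  bucketed-remainder : ∀ u → y ≤ length u * d → proj₁ (bucketed u) ≤ d
  bucketed-remainder u h with bucketed-rest u
  ... | inj₁ le = le
  ... | inj₂ le = ≤-trans (m+n≤o⇒m≤o∸n _ le) (≤-trans (≤-reflexive (m≤n⇒m∸n≡0 h)) z≤n)

-- `x` exceeds the lower end of its bucket by at most d, and `y` is not below that end. The range
-- condition on `x` will be met by the state that survives pruning.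
same-bucket-close : ∀ d x y u → x ≤ length u * d → proj₂ (bucketed d x u) ≡ proj₂ (bucketed d y u) → x ≤ y + d
same-bucket-close d x y u h eq = begin
  x                                                          ≡⟨ sym (bucketed-sum d x u) ⟩
  proj₁ (bucketed d x u) + proj₂ (bucketed d x u) * d        ≤⟨ +-monoˡ-≤ _ (bucketed-remainder d x u h) ⟩
  d + proj₂ (bucketed d x u) * d                             ≡⟨ cong (λ c → d + c * d) eq ⟩
  d + proj₂ (bucketed d y u) * d                             ≤⟨ +-monoʳ-≤ d (m≤n+m _ (proj₁ (bucketed d y u))) ⟩
  d + (proj₁ (bucketed d y u) + proj₂ (bucketed d y u) * d)  ≡⟨ cong (d +_) (bucketed-sum d y u) ⟩
  d + y                                                      ≡⟨ +-comm d y ⟩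
  y + d                                                      ∎
  where open ≤-Reasoning

opaque
  unfolding sumBy

  sumBy-const : ∀ {A : Set} x (xs : List A) → sumBy (λ _ → x) xs ≡ length xs * x
  sumBy-const x []       = refl
  sumBy-const x (_ ∷ xs) = cong (x +_) (sumBy-const x xs)

length-concatMap : ∀ {A C : Set} (ys : List C) (xs : List A) → length (L.concatMap (λ _ → ys) xs) ≡ length xs * length ys
length-concatMap ys []       = refl
length-concatMap ys (x ∷ xs) = trans (length-++ ys) (cong (length ys +_) (length-concatMap ys xs))

-- An interface between the lists handled by the program and the instance. Everything about states
-- and layers rests on these equations with an arbitrary m; ε returns only when the makespan is
-- bounded at the end.
record Encodes (I : Instance) (m d : ℕ) (g : ⟦ Global ⟧) : Set where
  open Instance I renaming (jobs to n)

  field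
    deadline≡    : deadline g ≡ d
    ids≡         : ids g ≡ L.tabulate {n = n} toℕ
    edge≡        : ∀ i j → edgeB g (toℕ i) (toℕ j) ≡ edge i j
    delay≡       : ∀ i j → proj₂ (arc g (toℕ i) (toℕ j)) ≡ delay i j
    times≡       : ∀ j → timesOf g (toℕ j) ≡ (serverTime j , maybe′ inj₂ (inj₁ tt) (cloudTime j))
    times-K≡     : ∀ x → times-K g x ≡ n * m * x
    times-B≡     : ∀ x → times-B g x ≡ n * suc m * x
    bucket-close : ∀ {x y} → n * m * x ≤ n * suc m * d → bucket g x ≡ bucket g y → n * m * x ≤ n * m * y + d
    bucket≤      : ∀ x → bucket g x ≤ n * suc m

module _ (I : Instance) (ε : ℚ) (d : ℕ) (u : List ⊤) where
  open Instance I renaming (jobs to n)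

  private
    m : ℕ
    m = length u

    times : List (ℕ × (⊤ ⊎ ℕ))
    times = L.tabulate λ j → serverTime j , maybe′ inj₂ (inj₁ tt) (cloudTime j)

    number : List (ℕ × (⊤ ⊎ ℕ)) → List ℕ
    number = foldr (λ _ is → 0 ∷ map suc is) []

    js : List ℕ
    js = number times

    uK uB : List ⊤
    uK = L.concatMap (λ _ → u) js
    uB = L.concatMap (λ _ → tt ∷ u) js

    js≡ : js ≡ L.tabulate {n = n} toℕ
    js≡ = go _
      where
      go : ∀ {n} (f : Fin n → ℕ × (⊤ ⊎ ℕ)) → number (L.tabulate f) ≡ L.tabulate {n = n} toℕ
      go {zero}  f = refl
      go {suc n} f = cong (0 ∷_) (trans (cong (map suc) (go (f ∘ suc))) (map-tabulate toℕ suc))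

    length-js : length js ≡ n
    length-js = trans (cong length js≡) (length-tabulate toℕ)

    length-uB : length uB ≡ n * suc m
    length-uB = trans (length-concatMap (tt ∷ u) js) (cong (_* suc m) length-js)

    times-K≡ : ∀ x → sumBy (λ _ → x) uK ≡ n * m * x
    times-K≡ x = trans (sumBy-const x uK) (cong (_* x) (trans (length-concatMap u js) (cong (_* m) length-js)))

    times-B≡ : ∀ x → sumBy (λ _ → x) uB ≡ n * suc m * x
    times-B≡ x = trans (sumBy-const x uB) (cong (_* x) length-uB)

    entry≡ : ∀ i j → arc (global u (encodeInput I ε d)) (toℕ i) (toℕ j) ≡ (encodeBool (edge i j) , delay i j)
    entry≡ i j = trans (cong (λ row → nth (inj₁ tt , 0) row (toℕ j))
        (nth-tabulate [] (λ i → L.tabulate λ j → encodeBool (edge i j) , delay i j) i))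
      (nth-tabulate (inj₁ tt , 0) (λ j → encodeBool (edge i j) , delay i j) j)

  opaque
    unfolding bucket

    global-encodes : Encodes I m d (global u (encodeInput I ε d))
    global-encodes = record
      { deadline≡    = refl
      ; ids≡         = js≡
      ; edge≡        = λ i j → trans (cong (isInj₂ ∘ proj₁) (entry≡ i j)) (isInj₂-encodeBool (edge i j))
      ; delay≡       = λ i j → cong proj₂ (entry≡ i j)
      ; times≡       = nth-tabulate (0 , inj₁ tt) (λ j → serverTime j , maybe′ inj₂ (inj₁ tt) (cloudTime j))
      ; times-K≡     = times-K≡
      ; times-B≡     = times-B≡
      ; bucket-close = λ {x} {y} h eq → subst₂ (λ a b → a ≤ b + d) (times-K≡ x) (times-K≡ y)
          (same-bucket-close d _ _ uB (subst₂ _≤_ (sym (times-K≡ x)) (cong (_* d) (sym length-uB)) h) eq)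
      ; bucket≤      = λ x → subst (proj₂ (bucketed d (sumBy (λ _ → x) uK) uB) ≤_) length-uB (bucketed-≤ d _ uB)
      }

-- Task graphs

module Graph (I : Instance) where
  open Instance I renaming (jobs to n)

  ⟶⁺-isSPO : IsStrictPartialOrder _≡_ (TransClosure _⟶_)
  ⟶⁺-isSPO = record
    { isEquivalence = isEquivalence
    ; irrefl        = λ { refl → acyclic _ }
    ; trans         = TC._++_
    ; <-resp-≈      = resp₂ (TransClosure _⟶_)
    }

  ⟵⁺-isSPO : IsStrictPartialOrder _≡_ (λ i j → TransClosure _⟶_ j i)
  ⟵⁺-isSPO = record
    { isEquivalence = isEquivalence
    ; irrefl        = λ { refl → acyclic _ }
    ; trans         = λ p q → q TC.++ p
    ; <-resp-≈      = resp₂ (λ i j → TransClosure _⟶_ j i)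
    }

  -- Acyclicity is irreflexivity of the transitive closure, and a strict partial order on a finite
  -- type is well-founded. The same holds in the opposite direction, for walks towards the sink.
  ⟶-wellFounded : WellFounded _⟶_
  ⟶-wellFounded = Subrelation.wellFounded TC.[_] (spo-wellFounded ⟶⁺-isSPO)

  ⟵-wellFounded : WellFounded (λ i j → j ⟶ i)
  ⟵-wellFounded = Subrelation.wellFounded TC.[_] (spo-wellFounded ⟵⁺-isSPO)

  predecessor : ∀ j → j ≢ source → ∃[ i ] i ⟶ j
  predecessor j j≢s = decidable-stable (F.any? λ i → T? (edge i j))
    λ none → j≢s (Equivalence.to (unique-source j) λ i e → none (i , e))

  successor : ∀ i → i ≢ sink → ∃[ j ] i ⟶ j
  successor i i≢t = decidable-stable (F.any? λ j → T? (edge i j))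
    λ none → i≢t (Equivalence.to (unique-sink i) λ j e → none (j , e))

-- Partial schedules

module Partials {I : Instance} {m d : ℕ} {g : ⟦ Global ⟧} (enc : Encodes I m d g) where
  open Instance I renaming (jobs to n) public
  open Encodes enc public
  open Graph I public

  At : ⟦ Partial ⟧ → Fin n → ⟦ bool ⟧ → ℕ → Set
  At s i b c = cell s (toℕ i) ≡ inj₂ (b , c)

  Un : ⟦ Partial ⟧ → Fin n → Set
  Un s i = cell s (toℕ i) ≡ inj₁ tt

  view : ∀ s i → Un s i ⊎ ∃[ b ] ∃[ c ] At s i b c
  view s i with cell s (toℕ i)
  ... | inj₁ _       = inj₁ refl
  ... | inj₂ (b , c) = inj₂ (b , c , refl)

  At-assigned : ∀ {s i b c} → At s i b c → assigned s (toℕ i) ≡ true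
  At-assigned at = cong isInj₂ at

  Un-assigned : ∀ {s i} → Un s i → assigned s (toℕ i) ≡ false
  Un-assigned un = cong isInj₂ un

  assigned-At : ∀ {s i} → assigned s (toℕ i) ≡ true → ∃[ b ] ∃[ c ] At s i b c
  assigned-At {s} {i} a with view s i
  ... | inj₂ at = at
  ... | inj₁ un = true≢false (trans (sym a) (Un-assigned {s} un))

  assigned-Un : ∀ {s i} → assigned s (toℕ i) ≡ false → Un s i
  assigned-Un {s} {i} a with view s i
  ... | inj₁ un = un
  ... | inj₂ (b , c , at) = true≢false (trans (sym (At-assigned {s} at)) a)

  Un⇒¬At : ∀ {s i b c} {A : Set} → Un s i → At s i b c → A
  Un⇒¬At un at with trans (sym un) at
  ... | ()

  At-unique : ∀ {s i b c b′ c′} → At s i b c → At s i b′ c′ → b ≡ b′ × c ≡ c′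
  At-unique p q with trans (sym p) q
  ... | refl = refl , refl

  lag : ⟦ bool ⟧ → ⟦ bool ⟧ → Fin n → Fin n → ℕ
  lag b b′ i j = if eqBool b b′ then 0 else delay i j

  edge-true : ∀ {i j} → i ⟶ j → edgeB g (toℕ i) (toℕ j) ≡ true
  edge-true {i} {j} e = trans (edge≡ i j) (T⇒≡true e)

  ready≡ : ∀ {s i b c j} b′ → At s i b c → i ⟶ j → ready g s (toℕ j) b′ (toℕ i) ≡ c + lag b b′ i j
  ready≡ {i = i} {j = j} b′ at e rewrite edge-true {i} {j} e | at | delay≡ i j = refl

  processing-server : ∀ j → processing g (toℕ j) (inj₂ tt) ≡ inj₂ (serverTime j)
  processing-server j rewrite times≡ j = refl

  processing-cloud : ∀ j → processing g (toℕ j) (inj₁ tt) ≡ maybe′ inj₂ (inj₁ tt) (cloudTime j)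
  processing-cloud j rewrite times≡ j = refl

  opaque
    unfolding serverFree

    serverFree≡ : ∀ s → serverFree g s ≡ maxBy (λ i → if isInj₂ (sideOf s i) then timeOf s i else 0) (L.tabulate {n = n} toℕ)
    serverFree≡ s = cong (maxBy _) ids≡

  ≤serverFree : ∀ {s i c} → At s i (inj₂ tt) c → c ≤ serverFree g s
  ≤serverFree {s} {i} {c} at = subst₂ _≤_ eq (sym (serverFree≡ s))
    (maxBy-≥ (λ i → if isInj₂ (sideOf s i) then timeOf s i else 0) toℕ i)
    where
    eq : (if isInj₂ (sideOf s (toℕ i)) then timeOf s (toℕ i) else 0) ≡ c
    eq rewrite at = refl

  serverFree-elim : ∀ (P : ℕ → Set) {s} → P 0 → (∀ {i c} → At s i (inj₂ tt) c → P c) → P (serverFree g s)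
  serverFree-elim P {s} p₀ p = subst P (sym (serverFree≡ s)) (maxBy-elim P _ toℕ p₀ each)
    where
    each : ∀ (i : Fin n) → P (if isInj₂ (sideOf s (toℕ i)) then timeOf s (toℕ i) else 0)
    each i with cell s (toℕ i) in eq
    ... | inj₁ _              = p₀
    ... | inj₂ (inj₁ _ , _)   = p₀
    ... | inj₂ (inj₂ tt , c)  = p eq

  opaque
    unfolding start

    ≤start : ∀ {s i b c j} b′ → At s i b c → i ⟶ j → c + lag b b′ i j ≤ start g s (toℕ j) b′
    ≤start {s} {i} {j = j} b′ at e = ≤-trans
      (subst₂ _≤_ (ready≡ b′ at e) (cong (maxBy (ready g s (toℕ j) b′)) (sym ids≡)) (maxBy-≥ (ready g s (toℕ j) b′) toℕ i))
      (maxℕ-≥ˡ _ _)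

  opaque
    unfolding start

    free≤start : ∀ s (j : Fin n) → serverFree g s ≤ start g s (toℕ j) (inj₂ tt)
    free≤start s j = maxℕ-≥ʳ (maxBy (ready g s (toℕ j) (inj₂ tt)) (ids g)) _

  opaque
    unfolding start

    start-elim : ∀ (P : ℕ → Set) s (j : Fin n) b → P 0 →
      (∀ i → i ⟶ j → P (timeOf s (toℕ i) + lag (sideOf s (toℕ i)) b i j)) →
      (b ≡ inj₂ tt → P (serverFree g s)) → P (start g s (toℕ j) b)
    start-elim P s j b p₀ pr pf = maxℕ-elim P (maxBy (ready g s (toℕ j) b) (ids g)) _
      (subst (λ is → P (maxBy (ready g s (toℕ j) b) is)) (sym ids≡) (maxBy-elim P (ready g s (toℕ j) b) toℕ p₀ each))
      (free b pf)
      where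
      each : ∀ (i : Fin n) → P (ready g s (toℕ j) b (toℕ i))
      each i = if-elim P (edgeB g (toℕ i) (toℕ j))
        (λ eq → subst (λ l → P (timeOf s (toℕ i) + (if eqBool (sideOf s (toℕ i)) b then 0 else l))) (sym (delay≡ i j))
          (pr i (≡true⇒T (trans (sym (edge≡ i j)) eq))))
        λ _ → p₀

      free : ∀ (b : ⟦ bool ⟧) → (b ≡ inj₂ tt → P (serverFree g s)) → P (if isInj₂ b then serverFree g s else 0)
      free (inj₁ _)  pf = p₀
      free (inj₂ tt) pf = pf refl

  enabled-Un : ∀ {s j} → enabled g s (toℕ j) ≡ true → Un s j
  enabled-Un {s} {j} h = assigned-Un {s} (not-true (proj₁ (∧-true {not (assigned s (toℕ j))} h)))

  enabled-At : ∀ {s i j} → enabled g s (toℕ j) ≡ true → i ⟶ j → ∃[ b ] ∃[ c ] At s i b c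
  enabled-At {s} {i} {j} h e = assigned-At {s} (subst (λ b → (if b then assigned s (toℕ i) else true) ≡ true) (edge-true {i} {j} e)
    (allB-∈ (λ i → if edgeB g i (toℕ j) then assigned s i else true) (proj₂ (∧-true {not (assigned s (toℕ j))} h))
      (subst (toℕ i ∈_) (sym ids≡) (∈-tabulate⁺ i))))

  enabled⁺ : ∀ {s j} → Un s j → (∀ i → i ⟶ j → assigned s (toℕ i) ≡ true) → enabled g s (toℕ j) ≡ true
  enabled⁺ {s} {j} un h = true-∧ (cong not (Un-assigned {s} un))
    (subst (λ is → allB (λ i → if edgeB g i (toℕ j) then assigned s i else true) is ≡ true) (sym ids≡)
      (allB-tabulate _ toℕ each))
    where
    each : ∀ (i : Fin n) → (if edgeB g (toℕ i) (toℕ j) then assigned s (toℕ i) else true) ≡ true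
    each i = if-elim (_≡ true) (edgeB g (toℕ i) (toℕ j))
      (λ eq → h i (≡true⇒T (trans (sym (edge≡ i j)) eq))) λ _ → refl

  cell-map : ∀ (f : ℕ → ⟦ Cell ⟧) i → cell (map f (ids g)) (toℕ i) ≡ f (toℕ i)
  cell-map f i = trans (cong (λ is → cell (map f is) (toℕ i)) ids≡)
    (trans (cong (λ s → cell s (toℕ i)) (map-tabulate toℕ f)) (nth-tabulate (inj₁ tt) (f ∘ toℕ) i))

  empty-Un : ∀ i → Un (empty g) i
  empty-Un = cell-map (λ _ → inj₁ tt)

  length-ids : length (ids g) ≡ n
  length-ids = trans (cong length ids≡) (length-tabulate toℕ)

  opaque
    unfolding place

    length-place : ∀ s j v → length (place g s j v) ≡ n
    length-place s j v = trans (length-map _ (ids g)) length-ids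

  module _ {s : ⟦ Partial ⟧} {j : Fin n} {b : ⟦ bool ⟧} {c : ℕ} where

    opaque
      unfolding place

      place-new : At (place g s (toℕ j) (b , c)) j b c
      place-new = trans (cell-map _ j) (cong (λ t → if t then inj₂ (b , c) else cell s (toℕ j)) (eqℕ-refl (toℕ j)))

    opaque
      unfolding place

      place-old : ∀ {i} → i ≢ j → cell (place g s (toℕ j) (b , c)) (toℕ i) ≡ cell s (toℕ i)
      place-old {i} i≢j = trans (cell-map _ i)
        (cong (λ t → if t then inj₂ (b , c) else cell s (toℕ i)) (eqℕ-≢ (toℕ i) (toℕ j) (i≢j ∘ toℕ-injective)))

    place-At : ∀ {i b′ c′} → Un s j → At s i b′ c′ → At (place g s (toℕ j) (b , c)) i b′ c′
    place-At {i} un at = trans (place-old λ { refl → Un⇒¬At {s} un at }) at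

    place-At⁻ : ∀ {i b′ c′} → At (place g s (toℕ j) (b , c)) i b′ c′ →
                (i ≡ j × b′ ≡ b × c′ ≡ c) ⊎ (i ≢ j × At s i b′ c′)
    place-At⁻ {i} at with i F.≟ j
    ... | no i≢j   = inj₂ (i≢j , trans (sym (place-old i≢j)) at)
    ... | yes refl with At-unique {place g s (toℕ j) (b , c)} at place-new
    ...   | refl , refl = inj₁ (refl , refl , refl)

    place-Un⁻ : ∀ {i} → Un (place g s (toℕ j) (b , c)) i → i ≢ j × Un s i
    place-Un⁻ {i} un with i F.≟ j
    ... | no i≢j   = i≢j , trans (sym (place-old i≢j)) un
    ... | yes refl = Un⇒¬At {place g s (toℕ j) (b , c)} un place-new

    place-count : Un s j → count {n} (λ i → assigned (place g s (toℕ j) (b , c)) (toℕ i)) ≡ suc (count {n} (λ i → assigned s (toℕ i)))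
    place-count un = begin
      count p                                              ≡⟨ sym (+-identityʳ _) ⟩
      count p + 0                                          ≡⟨ cong (λ a → count p + (if a then 1 else 0)) (sym (Un-assigned {s} un)) ⟩
      count p + (if q j then 1 else 0)                     ≡⟨ Σᶠ-update j (λ i i≢j → cong (λ v → if isInj₂ v then 1 else 0) (place-old i≢j)) ⟩
      count q + (if p j then 1 else 0)                     ≡⟨ cong (λ a → count q + (if a then 1 else 0)) (At-assigned {place g s (toℕ j) (b , c)} place-new) ⟩
      count q + 1                                          ≡⟨ +-comm _ 1 ⟩
      suc (count q)                                        ∎
      where
      open ≡-Reasoning
      p q : Fin n → Bool
      p i = assigned (place g s (toℕ j) (b , c)) (toℕ i)
      q i = assigned s (toℕ i)

  -- Validity restricted to the scheduled jobs, with exact times. `fits` also makes the scheduled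
  -- set closed under predecessors, `counts` ties the state to its layer, and `bounded` is the
  -- relaxed deadline imposed on every job.
  record Good (k : ℕ) (s : ⟦ Partial ⟧) : Set where
    field
      len       : length s ≡ n
      counts    : count {n} (λ i → assigned s (toℕ i)) ≡ k
      fits      : ∀ {j b c} → At s j b c → ∃[ p ] processing g (toℕ j) b ≡ inj₂ p × p ≤ c ×
                    (∀ {i} → i ⟶ j → ∃[ b′ ] ∃[ c′ ] At s i b′ c′ × c′ + lag b′ b i j + p ≤ c)
      exclusive : ∀ {i j c c′} → i ≢ j → At s i (inj₂ tt) c → At s j (inj₂ tt) c′ →
                    c + serverTime j ≤ c′ ⊎ c′ + serverTime i ≤ c
      bounded   : ∀ {j b c} → At s j b c → n * m * c ≤ n * suc m * d

  open Good public

  empty-good : Good 0 (empty g)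
  empty-good = record
    { len       = trans (length-map _ (ids g)) length-ids
    ; counts    = Σᶠ-0 λ i → cong (λ v → if isInj₂ v then 1 else 0) (empty-Un i)
    ; fits      = λ {j} at → Un⇒¬At {empty g} {j} (empty-Un j) at
    ; exclusive = λ {i} _ at → Un⇒¬At {empty g} {i} (empty-Un i) at
    ; bounded   = λ {j} at → Un⇒¬At {empty g} {j} (empty-Un j) at
    }

  module _ {k : ℕ} {s : ⟦ Partial ⟧} {j : Fin n} {b : ⟦ bool ⟧} {p : ℕ} (good : Good k s) (en : enabled g s (toℕ j) ≡ true)
    (pr : processing g (toℕ j) b ≡ inj₂ p)
    (bd : n * m * (start g s (toℕ j) b + p) ≤ n * suc m * d) where

    private
      c : ℕ
      c = start g s (toℕ j) b + p

      s′ : ⟦ Partial ⟧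
      s′ = place g s (toℕ j) (b , c)

      un : Un s j
      un = enabled-Un {s} en

      fits′ : ∀ {i b′ c′} → At s′ i b′ c′ → ∃[ p ] processing g (toℕ i) b′ ≡ inj₂ p × p ≤ c′ ×
              (∀ {h} → h ⟶ i → ∃[ b″ ] ∃[ c″ ] At s′ h b″ c″ × c″ + lag b″ b′ h i + p ≤ c′)
      fits′ at with place-At⁻ {s} at
      ... | inj₁ (refl , refl , refl) = p , pr , m≤n+m p _ , λ {h} e →
        let (b″ , c″ , at″) = enabled-At {s} en e in
        b″ , c″ , place-At {s} un at″ , +-monoˡ-≤ p (≤start {s} b at″ e)
      ... | inj₂ (i≢j , at₀) = let (q , prq , q≤ , preds) = fits good at₀ in
        q , prq , q≤ , λ e → let (b″ , c″ , at″ , le) = preds e in b″ , c″ , place-At {s} un at″ , le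

      after : ∀ {i c′} → b ≡ inj₂ tt → At s i (inj₂ tt) c′ → c′ + serverTime j ≤ c
      after refl at with trans (sym pr) (processing-server j)
      ... | refl = +-monoˡ-≤ p (≤-trans (≤serverFree {s} at) (free≤start s j))

      exclusive′ : ∀ {h i c₁ c₂} → h ≢ i → At s′ h (inj₂ tt) c₁ → At s′ i (inj₂ tt) c₂ →
                   c₁ + serverTime i ≤ c₂ ⊎ c₂ + serverTime h ≤ c₁
      exclusive′ h≢i at₁ at₂ with place-At⁻ {s} at₁ | place-At⁻ {s} at₂
      ... | inj₁ (refl , _ , _)    | inj₁ (refl , _ , _)    = ⊥-elim (h≢i refl)
      ... | inj₁ (refl , eq , refl) | inj₂ (_ , old)         = inj₂ (after (sym eq) old)
      ... | inj₂ (_ , old)         | inj₁ (refl , eq , refl) = inj₁ (after (sym eq) old)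
      ... | inj₂ (_ , old₁)        | inj₂ (_ , old₂)        = exclusive good h≢i old₁ old₂

      bounded′ : ∀ {i b′ c′} → At s′ i b′ c′ → n * m * c′ ≤ n * suc m * d
      bounded′ at with place-At⁻ {s} at
      ... | inj₁ (refl , refl , refl) = bd
      ... | inj₂ (_ , old)            = bounded good old

    -- `start` is at least each ready time and, on the server, at least every earlier server
    -- completion. The new job therefore comes after everything it could conflict with, and
    -- conditions among older jobs are untouched.
    place-good : Good (suc k) (place g s (toℕ j) (b , start g s (toℕ j) b + p))
    place-good = record
      { len       = length-place s (toℕ j) (b , c)
      ; counts    = trans (place-count {s} un) (cong suc (counts good))
      ; fits      = fits′
      ; exclusive = exclusive′
      ; bounded   = bounded′
      }

  within≡ : ∀ c → (times-K g c ≤ᵇ times-B g (deadline g)) ≡ (n * m * c ≤ᵇ n * suc m * d)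
  within≡ c = cong₂ _≤ᵇ_ (times-K≡ c) (trans (cong (times-B g) deadline≡) (times-B≡ d))

  Extends : ⟦ Partial ⟧ → ⟦ Partial ⟧ → Set
  Extends s s′ = Σ[ j ∈ Fin n ] ∃[ b ] ∃[ p ] enabled g s (toℕ j) ≡ true × processing g (toℕ j) b ≡ inj₂ p ×
    n * m * (start g s (toℕ j) b + p) ≤ n * suc m * d × s′ ≡ place g s (toℕ j) (b , start g s (toℕ j) b + p)

  attempt⁻ : ∀ {s s′} (j : Fin n) b → s′ ∈ attempt g s (toℕ j) b → Extends s s′
  attempt⁻ {s} j b s′∈ with processing g (toℕ j) b in pr
  ... | inj₂ p with enabled g s (toℕ j) in en | times-K g (start g s (toℕ j) b + p) ≤ᵇ times-B g (deadline g) in le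
  attempt⁻ {s} j b (here eq) | inj₂ p | true | true = j , b , p , en , pr ,
    ≤ᵇ-sound _ _ (trans (sym (within≡ (start g s (toℕ j) b + p))) le) , eq

  attempt⁺ : ∀ {s} (j : Fin n) b {p} → enabled g s (toℕ j) ≡ true → processing g (toℕ j) b ≡ inj₂ p →
    n * m * (start g s (toℕ j) b + p) ≤ n * suc m * d →
    place g s (toℕ j) (b , start g s (toℕ j) b + p) ∈ attempt g s (toℕ j) b
  attempt⁺ {s} j b {p} en pr le rewrite pr | en | within≡ (start g s (toℕ j) b + p)
    | ≤ᵇ-true le = here refl

  candidates⁻ : ∀ {ss s′} → s′ ∈ candidates g ss → ∃[ s ] s ∈ ss × Extends s s′
  candidates⁻ {ss} {s′} s′∈ with find (∈-concatMap⁻ _ {xs = ss} s′∈)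
  ... | s , s∈ , in-s with find (∈-concatMap⁻ (λ j → attempt g s j (inj₂ tt) ++ attempt g s j (inj₁ tt)) {xs = ids g} in-s)
  ...   | j , j∈ , in-j with ∈-tabulate⁻ (subst (j ∈_) ids≡ j∈)
  ...     | i , refl with ∈-++⁻ (attempt g s (toℕ i) (inj₂ tt)) in-j
  ...       | inj₁ at = s , s∈ , attempt⁻ i (inj₂ tt) at
  ...       | inj₂ at = s , s∈ , attempt⁻ i (inj₁ tt) at

  candidates⁺ : ∀ {ss s s′} (j : Fin n) b → s ∈ ss → s′ ∈ attempt g s (toℕ j) b → s′ ∈ candidates g ss
  candidates⁺ {s = s} {s′} j b s∈ s′∈ = ∈-concatMap⁺ _ (lose s∈
    (∈-concatMap⁺ (λ j → attempt g s j (inj₂ tt) ++ attempt g s j (inj₁ tt))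
      (lose (subst (toℕ j ∈_) (sym ids≡) (∈-tabulate⁺ j)) (side b s′∈))))
    where
    side : ∀ b → s′ ∈ attempt g s (toℕ j) b → s′ ∈ attempt g s (toℕ j) (inj₂ tt) ++ attempt g s (toℕ j) (inj₁ tt)
    side (inj₁ tt) = ∈-++⁺ʳ (attempt g s (toℕ j) (inj₂ tt))
    side (inj₂ tt) = ∈-++⁺ˡ

-- Pruning

eqEntry-refl : ∀ x → eqEntry x x ≡ true
eqEntry-refl (i , j , b , c) = true-∧ (eqℕ-refl i) (true-∧ (eqℕ-refl j) (true-∧ (eqBool-refl b) (eqℕ-refl c)))

eqEntry-sound : ∀ x y → eqEntry x y ≡ true → x ≡ y
eqEntry-sound (i , j , b , c) (i′ , j′ , b′ , c′) h with ∧-true {eqℕ i i′} h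
... | h₁ , h′ with ∧-true {eqℕ j j′} h′
...   | h₂ , h″ with ∧-true {eqBool b b′} h″
...     | h₃ , h₄ with eqℕ-sound i i′ h₁ | eqℕ-sound j j′ h₂ | eqBool-sound b b′ h₃ | eqℕ-sound c c′ h₄
...       | refl | refl | refl | refl = refl

subset-sound : ∀ xs ys → subset xs ys ≡ true → ∀ {x} → x ∈ xs → x ∈ ys
subset-sound xs ys h {x} x∈ with anyB-∈ (eqEntry x) ys (allB-∈ (λ x → anyB (eqEntry x) ys) h x∈)
... | y , y∈ , eq = subst (_∈ ys) (sym (eqEntry-sound x y eq)) y∈

subset-complete : ∀ xs ys → (∀ {x} → x ∈ xs → x ∈ ys) → subset xs ys ≡ true
subset-complete xs ys h = ∈-allB _ xs λ {x} x∈ → ∈-anyB (eqEntry x) (h x∈) (eqEntry-refl x)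

module Pruning (g : ⟦ Global ⟧) where

  record Sim (s r : ⟦ Partial ⟧) : Set where
    field
      free : bucket g (serverFree g s) ≡ bucket g (serverFree g r)
      to   : ∀ {x} → x ∈ entries g s → x ∈ entries g r
      from : ∀ {x} → x ∈ entries g r → x ∈ entries g s

  Sim-refl : ∀ {s} → Sim s s
  Sim-refl = record { free = refl ; to = λ x → x ; from = λ x → x }

  Sim-sym : ∀ {s r} → Sim s r → Sim r s
  Sim-sym p = record { free = sym (Sim.free p) ; to = Sim.from p ; from = Sim.to p }

  Sim-trans : ∀ {s r q} → Sim s r → Sim r q → Sim s q
  Sim-trans p q = record
    { free = trans (Sim.free p) (Sim.free q)
    ; to   = Sim.to q ∘ Sim.to p
    ; from = Sim.from p ∘ Sim.from q
    }

  similar-sound : ∀ {s r} → similar g s r ≡ true → Sim s r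
  similar-sound {s} {r} h with ∧-true {eqℕ (bucket g (serverFree g s)) (bucket g (serverFree g r))} h
  ... | h₁ , h₂ with ∧-true {subset (entries g s) (entries g r)} h₂
  ...   | h₃ , h₄ = record
    { free = eqℕ-sound _ _ h₁
    ; to   = subset-sound (entries g s) (entries g r) h₃
    ; from = subset-sound (entries g r) (entries g s) h₄
    }

  similar-complete : ∀ {s r} → Sim s r → similar g s r ≡ true
  similar-complete {s} {r} p = true-∧
    (subst (λ b → eqℕ (bucket g (serverFree g s)) b ≡ true) (Sim.free p) (eqℕ-refl (bucket g (serverFree g s))))
    (true-∧ (subset-complete (entries g s) (entries g r) (Sim.to p))
            (subset-complete (entries g r) (entries g s) (Sim.from p)))

  private
    dominates : ⟦ Partial ⟧ → ⟦ Partial ⟧ → Bool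
    dominates s r = similar g r s ∧ (cost′ g r ≤ᵇ cost′ g s)

    distinct? : ∀ s r → Dec (T (not (similar g r s)))
    distinct? s r = T? (not (similar g r s))

  insert-⊆ : ∀ s rs {r} → r ∈ insert g s rs → r ≡ s ⊎ r ∈ rs
  insert-⊆ s rs r∈ with anyB (dominates s) rs
  insert-⊆ s rs r∈         | true  = inj₂ r∈
  insert-⊆ s rs (here eq)  | false = inj₁ eq
  insert-⊆ s rs (there r∈) | false = inj₂ (proj₁ (∈-filter⁻ (distinct? s) {xs = rs} r∈))

  Represents : List ⟦ Partial ⟧ → ⟦ Partial ⟧ → Set
  Represents rs s = ∃[ r ] r ∈ rs × Sim r s × cost′ g r ≤ cost′ g s

  insert-new : ∀ s rs → Represents (insert g s rs) s
  insert-new s rs with anyB (dominates s) rs in eq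
  ... | false = s , here refl , Sim-refl , ≤-refl
  ... | true  with anyB-∈ (dominates s) rs eq
  ...   | r , r∈ , h with ∧-true {similar g r s} h
  ...     | sim , le = r , r∈ , similar-sound sim , ≤ᵇ-sound _ _ le

  -- A representative `r` is evicted only for being similar to `s`. Then `s` costs no more than `r`,
  -- since otherwise `r` would have dominated `s` and prevented its insertion; by transitivity `s`
  -- takes over what `r` represented.
  insert-old : ∀ s rs {t} → Represents rs t → Represents (insert g s rs) t
  insert-old s rs (r , r∈ , sim , le) with anyB (dominates s) rs in eq
  ... | true  = r , r∈ , sim , le
  ... | false with similar g r s in eq′
  ...   | false = r , there (∈-filter⁺ (distinct? s) r∈ (subst (T ∘ not) (sym eq′) tt)) , sim , le
  ...   | true  = s , here refl , Sim-trans (Sim-sym (similar-sound eq′)) sim ,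
    ≤-trans (≰⇒≥ λ r≤s → true≢false (trans (sym (∈-anyB (dominates s) r∈ (true-∧ eq′ (≤ᵇ-true r≤s)))) eq)) le

  prune-⊆ : ∀ ss {r} → r ∈ prune g ss → r ∈ ss
  prune-⊆ (s ∷ ss) r∈ with insert-⊆ s (prune g ss) r∈
  ... | inj₁ refl = here refl
  ... | inj₂ r∈′  = there (prune-⊆ ss r∈′)

  prune-represents : ∀ ss {s} → s ∈ ss → Represents (prune g ss) s
  prune-represents (s ∷ ss) (here refl) = insert-new s (prune g ss)
  prune-represents (s ∷ ss) (there s∈)  = insert-old s (prune g ss) (prune-represents ss s∈)

  prune-distinct : ∀ ss → AllPairs (λ s r → ¬ Sim s r) (prune g ss)
  prune-distinct []       = []
  prune-distinct (s ∷ ss) with anyB (dominates s) (prune g ss)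
  ... | true  = prune-distinct ss
  ... | false = All.tabulate (λ {r} r∈ sim →
      absurd (proj₂ (∈-filter⁻ (distinct? s) {xs = prune g ss} r∈)) (similar-complete (Sim-sym sim))) ∷
    AllPairs.filter⁺ (distinct? s) (prune-distinct ss)
    where
    absurd : ∀ {b} → T (not b) → ¬ b ≡ true
    absurd () refl

-- Similar states have the same set of scheduled jobs

module States {I : Instance} {m d : ℕ} {g : ⟦ Global ⟧} (enc : Encodes I m d g) where
  open Partials enc public
  open Pruning g public

  crossing⁺ : ∀ {s i j b c} → At s i b c → i ⟶ j → Un s j → crossing g s (toℕ i) (toℕ j) ≡ true
  crossing⁺ {s} at e un = true-∧ (edge-true e) (true-∧ (At-assigned {s} at) (cong not (Un-assigned {s} un)))

  entries⁺ : ∀ {s i j b c} → At s i b c → i ⟶ j → Un s j → (toℕ i , toℕ j , b , bucket g c) ∈ entries g s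
  entries⁺ {s} {i} {j} {b} {c} at e un =
    ∈-concatMap⁺ _ (lose (subst (toℕ i ∈_) (sym ids≡) (∈-tabulate⁺ i))
      (∈-concatMap⁺ _ (lose (subst (toℕ j ∈_) (sym ids≡) (∈-tabulate⁺ j)) single)))
    where
    single : (toℕ i , toℕ j , b , bucket g c) ∈ entry g s (toℕ i) (toℕ j)
    single rewrite crossing⁺ {s} at e un | at = here refl

  entries⁻ : ∀ {s x} → x ∈ entries g s → Σ[ i ∈ Fin n ] Σ[ j ∈ Fin n ] ∃[ b ] ∃[ c ]
             At s i b c × i ⟶ j × Un s j × x ≡ (toℕ i , toℕ j , b , bucket g c)
  entries⁻ {s} {x} x∈ with find (∈-concatMap⁻ _ {xs = ids g} x∈)
  ... | k , k∈ , x∈′ with find (∈-concatMap⁻ (entry g s k) {xs = ids g} x∈′)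
  ...   | l , l∈ , x∈″ with ∈-tabulate⁻ (subst (k ∈_) ids≡ k∈) | ∈-tabulate⁻ (subst (l ∈_) ids≡ l∈)
  ...     | i , refl | j , refl with crossing g s (toℕ i) (toℕ j) in eq
  entries⁻ {s} x∈ | _ | _ , _ , here x≡ | i , refl | j , refl | true
    with ∧-true {edgeB g (toℕ i) (toℕ j)} eq
  ... | e , h with ∧-true {assigned s (toℕ i)} h
  ...   | a , u with assigned-At {s} a
  ...     | b , c , at = i , j , b , c , at , ≡true⇒T (trans (sym (edge≡ i j)) e) , assigned-Un {s} (not-true u) ,
    trans x≡ (cong (λ v → toℕ i , toℕ j , proj₁ (value v) , bucket g (proj₂ (value v))) at)

  Rooted : ⟦ Partial ⟧ → Set
  Rooted s = assigned s (toℕ source) ≡ true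

  -- Every scheduled job other than the source has a predecessor, which is scheduled too; a walk
  -- along predecessors can end only at the source.
  rooted : ∀ {k s j b c} → Good k s → At s j b c → Rooted s
  rooted {s = s} {j} good = go (⟶-wellFounded j)
    where
    go : ∀ {j b c} → Acc _⟶_ j → At s j b c → Rooted s
    go {j} (acc rec) at with j F.≟ source
    ... | yes refl = At-assigned {s} at
    ... | no j≢s with predecessor j j≢s
    ...   | i , e with fits good at
    ...     | _ , _ , _ , preds with preds e
    ...       | _ , _ , at′ , _ = go (rec e) at′

  -- Suppose `j` is scheduled in `s` but not in `r`. It is not the source, and by induction some
  -- predecessor `i` is scheduled in both. The edge from `i` to `j` then leaves the scheduled set of
  -- `r`, so by similarity it is an entry of `s` as well, and `j` would be unscheduled in `s`.
  sim-assigned : ∀ {k s r} → Good k s → Rooted r → Sim s r → ∀ {j b c} → At s j b c → Σ[ b′ ∈ ⟦ bool ⟧ ] ∃[ c′ ] At r j b′ c′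
  sim-assigned {s = s} {r} good root sim {j} at = go (⟶-wellFounded j) at
    where
    go : ∀ {j b c} → Acc _⟶_ j → At s j b c → ∃[ b′ ] ∃[ c′ ] At r j b′ c′
    go {j} (acc rec) at with view r j
    ... | inj₂ found = found
    ... | inj₁ un with predecessor j (λ { refl → true≢false (trans (sym root) (Un-assigned {r} un)) })
    ...   | i , e with fits good at
    ...     | _ , _ , _ , preds with preds e
    ...       | _ , _ , at′ , _ with go (rec e) at′
    ...         | b″ , c″ , at″ with entries⁻ {s} (Sim.from sim (entries⁺ {r} at″ e un))
    ...           | i₁ , j₁ , _ , _ , _ , _ , un₁ , eq =
      Un⇒¬At {s} (subst (Un s) (sym (toℕ-injective (cong (λ e → proj₁ (proj₂ e)) eq))) un₁) at

  sim-Un : ∀ {k s r} → Good k s → Rooted r → Sim s r → ∀ {j} → Un r j → Un s j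
  sim-Un {s = s} {r} good root sim {j} un with view s j
  ... | inj₁ un′ = un′
  ... | inj₂ (_ , _ , at) with sim-assigned good root sim at
  ...   | _ , _ , at′ = Un⇒¬At {r} un at′

  sim-same : ∀ {k l s r} → Good k s → Good l r → Rooted s → Rooted r → Sim s r →
             ∀ j → assigned s (toℕ j) ≡ assigned r (toℕ j)
  sim-same {s = s} {r} gs gr rs rr sim j with view s j | view r j
  ... | inj₁ u | inj₁ v = trans (Un-assigned {s} u) (sym (Un-assigned {r} v))
  ... | inj₂ (_ , _ , a) | inj₂ (_ , _ , b) = trans (At-assigned {s} a) (sym (At-assigned {r} b))
  ... | inj₁ u | inj₂ (_ , _ , b) with sim-Un gr rs (Sim-sym sim) u
  ...   | v = Un⇒¬At {r} v b
  sim-same {s = s} {r} gs gr rs rr sim j | inj₂ (_ , _ , a) | inj₁ v = Un⇒¬At {s} (sim-Un gs rr sim v) a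

  charge : ⟦ bool ⟧ → ℕ → ℕ
  charge b i = if isInj₂ b then 0 else [ (λ _ → 0) , (λ p → p) ]′ (proj₂ (timesOf g i))

  opaque
    unfolding cost′

    cost≡ : ∀ s → cost′ g s ≡ Σᶠ {n} (λ i → charge (sideOf s (toℕ i)) (toℕ i))
    cost≡ s = trans (cong (sumBy (λ i → charge (sideOf s i) i)) ids≡) (sumBy-tabulate (λ i → charge (sideOf s i) i) toℕ)

  At-side : ∀ {s i b c} → At s i b c → sideOf s (toℕ i) ≡ b
  At-side at = cong (proj₁ ∘ value) at

  At-time : ∀ {s i b c} → At s i b c → timeOf s (toℕ i) ≡ c
  At-time at = cong (proj₂ ∘ value) at

  Un-side : ∀ {s i} → Un s i → sideOf s (toℕ i) ≡ inj₂ tt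
  Un-side un = cong (proj₁ ∘ value) un

-- Comparison with an arbitrary schedule that meets the deadline

record Target {I : Instance} {m d : ℕ} {g : ⟦ Global ⟧} (enc : Encodes I m d g) : Set where
  open States enc
  field
    side        : Fin n → ⟦ bool ⟧
    startAt     : Fin n → ℕ
    endAt       : Fin n → ℕ
    duration    : Fin n → ℕ
    processing≡ : ∀ j → processing g (toℕ j) (side j) ≡ inj₂ (duration j)
    lasts       : ∀ j → startAt j + duration j ≡ endAt j
    edges       : ∀ {i j} → i ⟶ j → endAt i + lag (side i) (side j) i j ≤ startAt j
    exclusive   : ∀ {i j} → i ≢ j → side i ≡ inj₂ tt → side j ≡ inj₂ tt → endAt i ≤ startAt j ⊎ endAt j ≤ startAt i
    punctual    : ∀ j → endAt j ≤ d

module Compare {I : Instance} {m d : ℕ} {g : ⟦ Global ⟧} (enc : Encodes I m d g) (target : Target enc) where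
  open States enc hiding (exclusive)
  open Target target

  K : ℕ
  K = n * m

  start≤end : ∀ j → startAt j ≤ endAt j
  start≤end j = subst (startAt j ≤_) (lasts j) (m≤m+n _ _)

  -- `e` counts the buckets lost so far. The release of the server is compared with the target's
  -- start of each server job still to come, and the cost with what the target pays for the same
  -- jobs. Nothing is claimed about scheduled jobs without leaving edges: pruning may have exchanged
  -- their sides and times.
  record Dom (e : ℕ) (s : ⟦ Partial ⟧) : Set where
    field
      active  : ∀ {i j b c} → At s i b c → i ⟶ j → Un s j → b ≡ side i × K * c ≤ K * endAt i + e * d
      free    : ∀ {j} → Un s j → side j ≡ inj₂ tt → K * serverFree g s ≤ K * startAt j + e * d
      cheaper : cost′ g s ≤ Σᶠ {n} (λ i → if assigned s (toℕ i) then charge (side i) (toℕ i) else 0)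

  -- Scheduling the jobs in the order of startAt + endAt respects both the
  -- edges and the order on the server, even if durations are 0.
  weight : Fin n → ℕ
  weight j = startAt j + endAt j

  edge-weight : ∀ {i j} → i ⟶ j → weight i ≤ weight j
  edge-weight {i} {j} e = ≤-trans (+-mono-≤ (start≤end i) ≤-refl)
    (≤-trans (+-mono-≤ i≤j i≤j) (+-monoʳ-≤ (startAt j) (start≤end j)))
    where
    i≤j : endAt i ≤ startAt j
    i≤j = ≤-trans (m≤m+n _ _) (edges e)

  -- If the exclusion holds the other way round, `endAt j ≤ startAt i`, and cancelling `startAt i`
  -- in the comparison of weights gives the claim again. Both jobs then have duration 0 and share a
  -- point in time.
  server-order : ∀ {i j} → i ≢ j → side i ≡ inj₂ tt → side j ≡ inj₂ tt → weight i ≤ weight j → endAt i ≤ startAt j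
  server-order {i} {j} i≢j si sj w with exclusive i≢j si sj
  ... | inj₁ le = le
  ... | inj₂ le = +-cancelˡ-≤ (startAt i) (endAt i) (startAt j)
    (≤-trans w (≤-trans (+-monoʳ-≤ (startAt j) le) (≤-reflexive (+-comm (startAt j) (startAt i)))))

  Minimal : ⟦ Partial ⟧ → Fin n → Set
  Minimal s j = Un s j × (∀ i → Un s i → weight j ≤ weight i)

  Un? : ∀ s (i : Fin n) → Dec (Un s i)
  Un? s i with view s i
  ... | inj₁ un          = yes un
  ... | inj₂ (_ , _ , at) = no λ un → Un⇒¬At {s} un at

  minimal : ∀ s j → Un s j → ∃[ j ] Minimal s j
  minimal s j = go j (<-wellFounded (weight j))
    where
    go : ∀ j → Acc _<_ (weight j) → Un s j → ∃[ j ] Minimal s j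
    go j (acc rec) un with F.any? (λ i → Un? s i ×-dec (weight i <? weight j))
    ... | yes (i , un′ , lt) = go i (rec lt) un′
    ... | no none = j , un , λ i un′ → ≮⇒≥ λ lt → none (i , un′ , lt)

  -- An unscheduled predecessor of a job of least weight has least weight itself. Descending along
  -- such predecessors terminates at a job whose predecessors are all scheduled.
  next : ∀ s j → Minimal s j → ∃[ j ] Minimal s j × (∀ i → i ⟶ j → assigned s (toℕ i) ≡ true)
  next s j = go j (⟶-wellFounded j)
    where
    go : ∀ j → Acc _⟶_ j → Minimal s j → ∃[ j ] Minimal s j × (∀ i → i ⟶ j → assigned s (toℕ i) ≡ true)
    go j (acc rec) (un , min) with F.any? (λ i → T? (edge i j) ×-dec Un? s i)
    ... | yes (i , e , un′) = go i (rec e) (un′ , λ k un″ → ≤-trans (edge-weight e) (min k un″))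
    ... | no none = j , (un , min) , λ i e → case i e (view s i)
      where
      case : ∀ i → i ⟶ j → Un s i ⊎ ∃[ b ] ∃[ c ] At s i b c → assigned s (toℕ i) ≡ true
      case i e (inj₁ un′)          = ⊥-elim (none (i , e , un′))
      case i e (inj₂ (_ , _ , at)) = At-assigned {s} at

-- The layers, and the surviving state that follows the target

module Layers {I : Instance} {m d : ℕ} {g : ⟦ Global ⟧} (enc : Encodes I m d g) where
  open States enc public

  extends-good : ∀ {k s s′} → Good k s → Extends s s′ → Good (suc k) s′ × Rooted s′
  extends-good good (j , b , p , en , pr , le , refl) = good′ , rooted good′ (place-new {b = b})
    where
    good′ : Good _ (place g _ (toℕ j) (b , start g _ (toℕ j) b + p))
    good′ = place-good good en pr le

  layer-good : ∀ k {s} → s ∈ layer g k → Good k s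
  layer-rooted : ∀ k {s} → s ∈ layer g (suc k) → Good (suc k) s × Rooted s

  layer-good zero    (here refl) = empty-good
  layer-good (suc k) s∈          = proj₁ (layer-rooted k s∈)

  layer-rooted k s∈ with candidates⁻ {layer g k} (prune-⊆ (candidates g (layer g k)) s∈)
  ... | s , s∈′ , ext = extends-good (layer-good k s∈′) ext

module Domination {I : Instance} {m d : ℕ} {g : ⟦ Global ⟧} (enc : Encodes I m d g) (target : Target enc) where
  open Layers enc hiding (exclusive)
  open Target target
  open Compare enc target

  private
    -- This explains the cap n (m + 1) d: the scaled deadline n m d plus one bucket for each of n
    -- steps. A state that lags by no more than its allowance is never cut off.
    within : ∀ k → k ≤ n → ∀ j → K * endAt j + k * d ≤ n * suc m * d
    within k k≤n j = ≤-trans (+-mono-≤ (*-monoʳ-≤ K (punctual j)) (*-monoˡ-≤ d k≤n)) (≤-reflexive (identity n m d))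
      where
      identity : ∀ n m d → n * m * d + n * d ≡ n * (1 + m) * d
      identity = solve-∀

    shift : ∀ K x y z w → (K * x ≤ K * y + w) → K * (x + z) ≤ K * (y + z) + w
    shift K x y z w h = begin
      K * (x + z)          ≡⟨ *-distribˡ-+ K x z ⟩
      K * x + K * z        ≤⟨ +-monoˡ-≤ (K * z) h ⟩
      K * y + w + K * z    ≡⟨ swap K y z w ⟩
      K * (y + z) + w      ∎
      where
      open ≤-Reasoning
      swap : ∀ K y z w → K * y + w + K * z ≡ K * (y + z) + w
      swap = solve-∀

  Choice : ⟦ Partial ⟧ → Fin n → Set
  Choice s j = Minimal s j × (∀ i → i ⟶ j → assigned s (toℕ i) ≡ true)

  choose : ∀ {k s} → Good k s → k < n → ∃[ j ] Choice s j
  choose {s = s} good k<n with count<n (λ i → assigned s (toℕ i)) (subst (_< n) (sym (counts good)) k<n)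
  ... | j , free-j with minimal s j (assigned-Un {s} free-j)
  ...   | i , min = next s i min

  module Step {k : ℕ} {s : ⟦ Partial ⟧} (k<n : k < n) (dom : Dom k s) {j : Fin n} (choice : Choice s j) where

    private
      open Dom dom

      un : Un s j
      un = proj₁ (proj₁ choice)

      least : ∀ i → Un s i → weight j ≤ weight i
      least = proj₂ (proj₁ choice)

      c : ℕ
      c = start g s (toℕ j) (side j) + duration j

    s′ : ⟦ Partial ⟧
    s′ = place g s (toℕ j) (side j , c)

    private
      -- Every term of the maximum that defines `start` has a counterpart in the target that is at
      -- most `startAt j`. Each lags by at most `k` buckets, and a maximum does not add lags up.
      start-bound : K * start g s (toℕ j) (side j) ≤ K * startAt j + k * d
      start-bound = start-elim (λ x → K * x ≤ K * startAt j + k * d) s j (side j)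
        (subst (_≤ K * startAt j + k * d) (sym (*-zeroʳ K)) z≤n) each (λ eq → free un eq)
        where
        each : ∀ i → i ⟶ j → K * (timeOf s (toℕ i) + lag (sideOf s (toℕ i)) (side j) i j) ≤ K * startAt j + k * d
        each i e with assigned-At {s} (proj₂ choice i e)
        ... | b , t , at with active at e un
        -- The tail is on the target's side, so its communication delay is the target's.
        ...   | refl , le rewrite At-time {s} at | At-side {s} at =
          ≤-trans (shift K t (endAt i) (lag (side i) (side j) i j) (k * d) le)
                  (+-monoˡ-≤ (k * d) (*-monoʳ-≤ K (edges e)))

      end-bound : K * c ≤ K * endAt j + k * d
      end-bound = subst (λ x → K * c ≤ K * x + k * d) (lasts j)
        (shift K (start g s (toℕ j) (side j)) (startAt j) (duration j) (k * d) start-bound)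

    extends : s′ ∈ attempt g s (toℕ j) (side j)
    extends = attempt⁺ {s} j (side j) (enabled⁺ {s} un (proj₂ choice)) (processing≡ j)
      (≤-trans end-bound (within k (<⇒≤ k<n) j))

    private
      new : At s′ j (side j) c
      new = place-new {s}

      active′ : ∀ {i l b t} → At s′ i b t → i ⟶ l → Un s′ l → b ≡ side i × K * t ≤ K * endAt i + k * d
      active′ at e un′ with place-At⁻ {s} at
      ... | inj₁ (refl , refl , refl) = refl , end-bound
      ... | inj₂ (_ , old)            = active old e (proj₂ (place-Un⁻ {s} un′))

      -- Either an older job releases the server last, which `free` covers, or `j` does. As `j` has
      -- least weight, the target completes it before starting `l`.
      free′ : ∀ {l} → Un s′ l → side l ≡ inj₂ tt → K * serverFree g s′ ≤ K * startAt l + k * d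
      free′ {l} un′ sl = serverFree-elim (λ x → K * x ≤ K * startAt l + k * d) {s′}
        (subst (_≤ K * startAt l + k * d) (sym (*-zeroʳ K)) z≤n) each
        where
        un-l : l ≢ j × Un s l
        un-l = place-Un⁻ {s} un′

        each : ∀ {i t} → At s′ i (inj₂ tt) t → K * t ≤ K * startAt l + k * d
        each at with place-At⁻ {s} at
        ... | inj₁ (refl , sj , refl) = ≤-trans end-bound (+-monoˡ-≤ (k * d) (*-monoʳ-≤ K
          (server-order (λ j≡l → proj₁ un-l (sym j≡l)) (sym sj) sl (least l (proj₂ un-l)))))
        ... | inj₂ (_ , old) = ≤-trans (*-monoʳ-≤ K (≤serverFree {s} old)) (free (proj₂ un-l) sl)

      paid paid′ bill bill′ : Fin n → ℕ
      paid  i = charge (sideOf s (toℕ i)) (toℕ i)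
      paid′ i = charge (sideOf s′ (toℕ i)) (toℕ i)
      bill  i = if assigned s (toℕ i) then charge (side i) (toℕ i) else 0
      bill′ i = if assigned s′ (toℕ i) then charge (side i) (toℕ i) else 0

      cost-j : ℕ
      cost-j = charge (side j) (toℕ j)

      cheaper′ : cost′ g s′ ≤ Σᶠ bill′
      cheaper′ = subst₂ _≤_ (sym (trans (cost≡ s′) paid-step)) (sym bill-step)
        (+-monoˡ-≤ cost-j (subst (_≤ Σᶠ bill) (cost≡ s) cheaper))
        where
        paid-step : Σᶠ paid′ ≡ Σᶠ paid + cost-j
        -- The added 0 is the charge of `j` in `s`, where an unscheduled job counts as a server job.
        paid-step = trans (sym (+-identityʳ _)) (trans
          (cong (λ b → Σᶠ paid′ + charge b (toℕ j)) (sym (Un-side {s} un)))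
          (trans (Σᶠ-update j λ i i≢j → cong (λ v → charge (proj₁ (value v)) (toℕ i)) (place-old {s} i≢j))
                 (cong (λ b → Σᶠ paid + charge b (toℕ j)) (At-side {s′} new))))

        bill-step : Σᶠ bill′ ≡ Σᶠ bill + cost-j
        bill-step = trans (sym (+-identityʳ _)) (trans
          (cong (λ a → Σᶠ bill′ + (if a then cost-j else 0)) (sym (Un-assigned {s} un)))
          (trans (Σᶠ-update j λ i i≢j → cong (λ v → if isInj₂ v then charge (side i) (toℕ i) else 0) (place-old {s} i≢j))
                 (cong (λ a → Σᶠ bill + (if a then cost-j else 0)) (At-assigned {s′} new))))

    dom′ : Dom k s′
    dom′ = record { active = active′ ; free = free′ ; cheaper = cheaper′ }

  -- Replacing a state by a similar one costs at most one bucket of time.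
  dom-similar : ∀ {k l e r s} → Good k r → Good l s → Rooted r → Rooted s → Sim r s →
                cost′ g r ≤ cost′ g s → Dom e s → Dom (suc e) r
  dom-similar {e = e} {r} {s} gr gs rr rs sim le dom = record { active = active′ ; free = free′ ; cheaper = cheaper′ }
    where
    open Dom dom

    slack : ∀ {x y z} → K * x ≤ K * y + d → K * y ≤ K * z + e * d → K * x ≤ K * z + suc e * d
    slack {x} {y} {z} h₁ h₂ = ≤-trans h₁ (≤-trans (+-monoˡ-≤ d h₂)
      (≤-reflexive (trans (+-assoc (K * z) (e * d) d) (cong (K * z +_) (+-comm (e * d) d)))))

    active′ : ∀ {i j b c} → At r i b c → i ⟶ j → Un r j → b ≡ side i × K * c ≤ K * endAt i + suc e * d
    -- The same edge leaves the scheduled set of `s`, with the same side and bucket, so the bound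
    -- known for `s` applies up to one d.
    active′ {i} {j} at edge un with entries⁻ {s} (Sim.to sim (entries⁺ {r} at edge un))
    ... | i′ , j′ , b′ , c′ , at′ , edge′ , un′ , eq
      with toℕ-injective {i = i} {i′} (cong proj₁ eq) | toℕ-injective {i = j} {j′} (cong (λ x → proj₁ (proj₂ x)) eq)
    ... | refl | refl with active at′ edge′ un′
    ...   | refl , le′ = cong (λ x → proj₁ (proj₂ (proj₂ x))) eq ,
      slack (bucket-close (bounded gr at) (cong (λ x → proj₂ (proj₂ (proj₂ x))) eq)) le′

    free′ : ∀ {j} → Un r j → side j ≡ inj₂ tt → K * serverFree g r ≤ K * startAt j + suc e * d
    free′ {j} un sj = slack (bucket-close bounded-free (Sim.free sim)) (free (sim-Un gs rr (Sim-sym sim) un) sj)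
      where
      bounded-free : K * serverFree g r ≤ n * suc m * d
      bounded-free = serverFree-elim (λ x → K * x ≤ n * suc m * d) {r}
        (subst (_≤ n * suc m * d) (sym (*-zeroʳ K)) z≤n) (bounded gr)

    cheaper′ : cost′ g r ≤ Σᶠ {n} (λ i → if assigned r (toℕ i) then charge (side i) (toℕ i) else 0)
    cheaper′ = ≤-trans le (≤-trans cheaper (≤-reflexive (Σᶠ-cong λ i →
      cong (λ a → if a then charge (side i) (toℕ i) else 0) (sim-same gs gr rs rr (Sim-sym sim) i))))

  empty-dom : Dom 0 (empty g)
  empty-dom = record
    { active  = λ {i} at → Un⇒¬At {empty g} {i} (empty-Un i) at
    ; free    = λ {j} _ _ → serverFree-elim (λ x → K * x ≤ K * startAt j + 0) {empty g}
        (subst (_≤ K * startAt j + 0) (sym (*-zeroʳ K)) z≤n) (λ {i} at → Un⇒¬At {empty g} {i} (empty-Un i) at)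
    ; cheaper = ≤-trans (≤-reflexive (trans (cost≡ (empty g)) (Σᶠ-0 λ i → cong (λ b → charge b (toℕ i)) (Un-side {empty g} (empty-Un i))))) z≤n
    }

  layer-dom : ∀ k → k ≤ n → ∃[ s ] s ∈ layer g k × Dom k s
  layer-dom zero    _   = empty g , here refl , empty-dom
  layer-dom (suc k) k<n with layer-dom k (<⇒≤ k<n)
  ... | s , s∈ , dom with choose (layer-good k s∈) k<n
  ...   | j , choice with prune-represents (candidates g (layer g k))
                            (candidates⁺ {layer g k} j (Target.side target j) s∈ (Step.extends k<n dom choice))
  ...     | r , r∈ , sim , le
    with layer-rooted k r∈ | extends-good (layer-good k s∈) (attempt⁻ {s} j (Target.side target j) (Step.extends k<n dom choice))
  ...       | gr , rr | gs , rs = r , r∈ , dom-similar gr gs rr rs sim le (Step.dom′ k<n dom choice)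

-- The number of states in a layer

-- No decidable equality is involved: `x` is cut out of `ys` at the position given by its membership
-- proof, and uniqueness keeps the other elements away from that position.
Unique-⊆-length : ∀ {A : Set} {xs ys : List A} → Unique xs → (∀ {x} → x ∈ xs → x ∈ ys) → length xs ≤ length ys
Unique-⊆-length []             ⊆ys = z≤n
Unique-⊆-length {xs = x ∷ xs} (x∉ ∷ unique) ⊆ys with ∈-∃++ (⊆ys (here refl))
... | as , bs , refl = begin
  suc (length xs)             ≤⟨ s≤s (Unique-⊆-length unique shrink) ⟩
  suc (length (as ++ bs))   ≡⟨ cong suc (length-++ as) ⟩
  suc (length as + length bs) ≡⟨ sym (+-suc (length as) (length bs)) ⟩
  length as + length (x ∷ bs) ≡⟨ sym (length-++ as) ⟩
  length (as ++ x ∷ bs)     ∎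
  where
  open ≤-Reasoning
  shrink : ∀ {y} → y ∈ xs → y ∈ as ++ bs
  shrink y∈ with ∈-++⁻ as (⊆ys (there y∈))
  ... | inj₁ y∈as         = ∈-++⁺ˡ y∈as
  ... | inj₂ (here refl)  = ⊥-elim (All.lookup x∉ y∈ refl)
  ... | inj₂ (there y∈bs) = ∈-++⁺ʳ as y∈bs

length-cartesianProductWith : ∀ {A B C : Set} (f : A → B → C) xs ys →
  length (cartesianProductWith f xs ys) ≡ length xs * length ys
length-cartesianProductWith f []       ys = refl
length-cartesianProductWith f (x ∷ xs) ys = trans (length-++ (map (f x) ys))
  (cong₂ _+_ (length-map (f x) ys) (length-cartesianProductWith f xs ys))

words : ∀ {A : Set} → ℕ → List A → List (List A)
words zero    as = [] ∷ []
words (suc l) as = [] ∷ cartesianProductWith _∷_ as (words l as)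

∈-words : ∀ {A : Set} l {as xs : List A} → (∀ {x} → x ∈ xs → x ∈ as) → length xs ≤ l → xs ∈ words l as
∈-words zero    {xs = []}     h le       = here refl
∈-words (suc l) {xs = []}     h le       = here refl
∈-words (suc l) {xs = x ∷ xs} h (s≤s le) = there (∈-cartesianProductWith⁺ _∷_ (h (here refl)) (∈-words l (h ∘ there) le))

-- A word of length at most `l` can be padded to length `l` with one additional blank letter, whence
-- the base `suc (length as)`.
length-words : ∀ {A : Set} l (as : List A) → length (words l as) ≤ suc (length as) ^ l
length-words zero    as = ≤-refl
length-words (suc l) as = begin
  suc (length (cartesianProductWith _∷_ as (words l as)))  ≡⟨ cong suc (length-cartesianProductWith _∷_ as (words l as)) ⟩
  suc (length as * length (words l as))                    ≤⟨ +-mono-≤ (m^n>0 (suc (length as)) l) (*-monoʳ-≤ (length as) (length-words l as)) ⟩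
  suc (length as) ^ l + length as * suc (length as) ^ l    ∎
  where open ≤-Reasoning

∈-subsets : ∀ {n} (A : Subset n) → A ∈ subsets n
∈-subsets V.[]           = here refl
∈-subsets (true  V.∷ A)  = ∈-++⁺ˡ (∈-map⁺ (inside V.∷_) (∈-subsets A))
∈-subsets {suc n} (false V.∷ A) = ∈-++⁺ʳ (map (inside V.∷_) (subsets n)) (∈-map⁺ (outside V.∷_) (∈-subsets A))

cutSize≤ : ∀ I A → Dividing I A → cutSize I A ≤ maxDividingCut I
cutSize≤ I A div = All.lookup (xs≤max 0 (map (cutSize I) (filter (dividing? I) (subsets (Instance.jobs I)))))
  (∈-map⁺ (cutSize I) (∈-filter⁺ (dividing? I) (∈-subsets A) div))

module Counting {I : Instance} {m d : ℕ} {g : ⟦ Global ⟧} (enc : Encodes I m d g) where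
  open Layers enc public

  scheduled : ⟦ Partial ⟧ → Subset n
  scheduled s = V.tabulate (λ i → assigned s (toℕ i))

  ∈-scheduled⁺ : ∀ {s i} → assigned s (toℕ i) ≡ true → i S.∈ scheduled s
  ∈-scheduled⁺ {s} {i} a = lookup⇒[]= i (scheduled s) (trans (lookup∘tabulate (λ i → assigned s (toℕ i)) i) a)

  ∈-scheduled⁻ : ∀ {s i} → i S.∈ scheduled s → assigned s (toℕ i) ≡ true
  ∈-scheduled⁻ {s} {i} i∈ = trans (sym (lookup∘tabulate (λ i → assigned s (toℕ i)) i)) ([]=⇒lookup i∈)

  scheduled-dividing : ∀ {k s} → Good k s → Rooted s → Dividing I (scheduled s)
  scheduled-dividing {s = s} good root = ∈-scheduled⁺ {s} root , λ i j (e , i∉ , j∈) →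
    let (b , c , at) = assigned-At {s} (∈-scheduled⁻ {s} j∈)
        (_ , _ , _ , preds) = fits good at
        (_ , _ , at′ , _) = preds e
    in i∉ (∈-scheduled⁺ {s} (At-assigned {s} at′))

  -- Both sides run through the pairs of jobs row by row with equivalent tests, so the lists can be
  -- matched element by element.
  length-entries : ∀ s → length (entries g s) ≡ cutSize I (scheduled s)
  length-entries s = trans
    (cong (λ is → length (L.concatMap (λ i → L.concatMap (entry g s i) is) is)) (trans ids≡ (sym (map-tabulate (λ i → i) toℕ))))
    (outer (allFin n) (allFin n))
    where
    A : Subset n
    A = scheduled s

    sound : ∀ i j → crossing g s (toℕ i) (toℕ j) ≡ true → Crosses I A (i , j)
    sound i j h with ∧-true {edgeB g (toℕ i) (toℕ j)} h
    ... | e , h′ with ∧-true {assigned s (toℕ i)} h′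
    ...   | a , u = ≡true⇒T (trans (sym (edge≡ i j)) e) , ∈-scheduled⁺ {s} a ,
      λ j∈ → true≢false (trans (sym (∈-scheduled⁻ {s} j∈)) (not-true u))

    complete : ∀ i j → Crosses I A (i , j) → crossing g s (toℕ i) (toℕ j) ≡ true
    complete i j (e , i∈ , j∉) = true-∧ (edge-true e) (true-∧ (∈-scheduled⁻ {s} i∈) (unassigned (assigned s (toℕ j)) refl))
      where
      unassigned : ∀ b → assigned s (toℕ j) ≡ b → not b ≡ true
      unassigned false _ = refl
      unassigned true  a = ⊥-elim (j∉ (∈-scheduled⁺ {s} a))

    inner : ∀ i js → length (L.concatMap (entry g s (toℕ i)) (map toℕ js)) ≡ length (filter (crosses? I A) (map (i ,_) js))
    inner i []       = refl
    inner i (j ∷ js) with crossing g s (toℕ i) (toℕ j) in eq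
    ... | true  = trans (cong suc (inner i js))
      (cong length (sym (filter-accept (crosses? I A) {xs = map (i ,_) js} (sound i j eq))))
    ... | false = trans (inner i js)
      (cong length (sym (filter-reject (crosses? I A) {xs = map (i ,_) js} λ c → true≢false (trans (sym (complete i j c)) eq))))

    outer : ∀ is js → length (L.concatMap (λ i → L.concatMap (entry g s i) (map toℕ js)) (map toℕ is)) ≡
                      length (filter (crosses? I A) (cartesianProduct is js))
    outer []       js = refl
    outer (i ∷ is) js = begin
      length (L.concatMap (entry g s (toℕ i)) (map toℕ js) ++ _)
        ≡⟨ length-++ (L.concatMap (entry g s (toℕ i)) (map toℕ js)) ⟩
      length (L.concatMap (entry g s (toℕ i)) (map toℕ js)) + _
        ≡⟨ cong₂ _+_ (inner i js) (outer is js) ⟩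
      length (filter (crosses? I A) (map (i ,_) js)) + length (filter (crosses? I A) (cartesianProduct is js))
        ≡⟨ sym (length-++ (filter (crosses? I A) (map (i ,_) js))) ⟩
      length (filter (crosses? I A) (map (i ,_) js) ++ filter (crosses? I A) (cartesianProduct is js))
        ≡⟨ cong length (sym (filter-++ (crosses? I A) (map (i ,_) js) (cartesianProduct is js))) ⟩
      length (filter (crosses? I A) (cartesianProduct (i ∷ is) js)) ∎
      where open ≡-Reasoning

  sides : List ⟦ bool ⟧
  sides = inj₁ tt ∷ inj₂ tt ∷ []

  ∈-sides : ∀ b → b ∈ sides
  ∈-sides (inj₁ tt) = here refl
  ∈-sides (inj₂ tt) = there (here refl)

  buckets : List ℕ
  buckets = upTo (suc (n * suc m))

  ∈-buckets : ∀ x → bucket g x ∈ buckets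
  ∈-buckets x = ∈-upTo⁺ (s≤s (bucket≤ x))

  alphabet : List ⟦ Entry ⟧
  alphabet = cartesianProduct (upTo n) (cartesianProduct (upTo n) (cartesianProduct sides buckets))

  Key : Set
  Key = ℕ × List ⟦ Entry ⟧

  key : ⟦ Partial ⟧ → Key
  key s = bucket g (serverFree g s) , entries g s

  keys : ℕ → List Key
  keys φ = cartesianProduct buckets (words φ alphabet)

  ∈-alphabet : ∀ {s x} → x ∈ entries g s → x ∈ alphabet
  ∈-alphabet {s} x∈ with entries⁻ {s} x∈
  ... | i , j , b , c , _ , _ , _ , refl = ∈-cartesianProduct⁺ (∈-upTo⁺ (toℕ<n i))
    (∈-cartesianProduct⁺ (∈-upTo⁺ (toℕ<n j)) (∈-cartesianProduct⁺ (∈-sides b) (∈-buckets c)))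

  key-∈ : ∀ {φ k s} → maxDividingCut I ≤ φ → Good k s → Rooted s → key s ∈ keys φ
  key-∈ {φ} {s = s} cut good root = ∈-cartesianProduct⁺ (∈-buckets (serverFree g s)) (∈-words φ (∈-alphabet {s})
    (≤-trans (≤-reflexive (length-entries s)) (≤-trans (cutSize≤ I (scheduled s) (scheduled-dividing good root)) cut)))

  -- Similarity compares entries as sets, keys compare them as lists. Equal keys imply similarity,
  -- so pairwise dissimilar states have distinct keys, and counting keys bounds the states.
  key-injective : ∀ {s r} → key s ≡ key r → Sim s r
  key-injective {s} {r} eq = record
    { free = cong proj₁ eq
    ; to   = λ {x} → subst (x ∈_) (cong proj₂ eq)
    ; from = λ {x} → subst (x ∈_) (sym (cong proj₂ eq))
    }

  layer-length : ∀ {φ} → maxDividingCut I ≤ φ → ∀ k → length (layer g (suc k)) ≤ length (keys φ)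
  layer-length {φ} cut k = subst (_≤ length (keys φ)) (length-map key (layer g (suc k)))
    (Unique-⊆-length
      (AllPairs.map⁺ (AllPairs.map (λ ¬sim eq → ¬sim (key-injective eq)) (prune-distinct (candidates g (layer g k)))))
      λ x∈ → let (s , s∈ , x≡) = ∈-map⁻ key x∈ ; (good , root) = layer-rooted k s∈ in
             subst (_∈ keys φ) (sym x≡) (key-∈ cut good root))

  -- The buckets for the release of the server, times the words of length at most φ over entries
  -- made of two jobs, a side and a bucket.
  states : ℕ → ℕ
  states φ = suc (n * suc m) * suc (n * (n * (2 * suc (n * suc m)))) ^ φ

  length-keys : ∀ φ → length (keys φ) ≤ states φ
  length-keys φ = begin
    length (keys φ)                              ≡⟨ length-cartesianProductWith _,_ buckets (words φ alphabet) ⟩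
    length buckets * length (words φ alphabet)   ≤⟨ *-mono-≤ (≤-reflexive (length-upTo (suc (n * suc m)))) (length-words φ alphabet) ⟩
    suc (n * suc m) * suc (length alphabet) ^ φ  ≡⟨ cong (λ a → suc (n * suc m) * suc a ^ φ) length-alphabet ⟩
    states φ                                     ∎
    where
    open ≤-Reasoning
    length-alphabet : length alphabet ≡ n * (n * (2 * suc (n * suc m)))
    length-alphabet = trans (length-cartesianProductWith _,_ (upTo n) _) (cong₂ _*_ (length-upTo n)
      (trans (length-cartesianProductWith _,_ (upTo n) _) (cong₂ _*_ (length-upTo n)
      (trans (length-cartesianProductWith _,_ sides buckets) (cong (2 *_) (length-upTo (suc (n * suc m))))))))

  size-state : ∀ {k s} → Good k s → size Partial s ≤ suc (n * 2)
  size-state {s = s} good = s≤s (subst (λ l → sizes Cell s ≤ l * 2) (len good) (sizes≤ Cell s λ {v} _ → size-cell v))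
    where
    size-cell : ∀ v → size Cell v ≤ 2
    size-cell (inj₁ _)             = s≤s z≤n
    size-cell (inj₂ (inj₁ _ , _))  = ≤-refl
    size-cell (inj₂ (inj₂ _ , _))  = ≤-refl

  layer-size : ∀ {φ} → maxDividingCut I ≤ φ → ∀ k → size (list Partial) (layer g k) ≤ suc (suc (states φ) * suc (n * 2))
  layer-size {φ} cut k = s≤s (≤-trans (sizes≤ Partial (layer g k) (λ s∈ → size-state (layer-good k s∈)))
    (*-monoˡ-≤ (suc (n * 2)) (count-states k)))
    where
    count-states : ∀ k → length (layer g k) ≤ suc (states φ)
    -- In layer 0 not even the source is scheduled, so the key argument starts at layer 1; the outer
    -- `suc` allows for the empty state.
    count-states zero    = s≤s z≤n
    count-states (suc k) = m≤n⇒m≤1+n (≤-trans (layer-length cut k) (length-keys φ))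

-- Arithmetic of ε

-- The ceiling of x is minus the floor of -x. Division of minus the denominator of ε by its
-- numerator leaves a remainder r ≥ 0, hence denominator + r = ⌈ 1 / ε ⌉ · numerator.
≤-inverseCeil : ∀ ε .{{_ : Positive ε}} → ↧ₙ ε ≤ inverseCeil ε * ∣ ↥ ε ∣
≤-inverseCeil (mkℚ (pos (suc a)) b _) = subst (suc b ≤_) magnitude (m≤m+n (suc b) r)
  where
  q : ℤ.ℤ
  q = -[1+ b ] ℤ./ pos (suc a)

  r : ℕ
  r = -[1+ b ] ℤ.% pos (suc a)

  negate : ∀ x y z s → x ≡ y ℤ.+ z ℤ.* s → ℤ.- x ℤ.+ y ≡ (ℤ.- z) ℤ.* s
  negate x y z s refl = ring y z s
    where
    ring : ∀ y z s → ℤ.- (y ℤ.+ z ℤ.* s) ℤ.+ y ≡ (ℤ.- z) ℤ.* s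
    ring = solve-∀ℤ

  magnitude : suc b + r ≡ ∣ ℤ.- q ∣ * suc a
  magnitude = trans (cong ∣_∣ (negate -[1+ b ] (pos r) q (pos (suc a)) (ℤ.a≡a%n+[a/n]*n -[1+ b ] (pos (suc a)))))
    (ℤ.abs-* (ℤ.- q) (pos (suc a)))

-- Here ε = p / q. If c = d + e, the second hypothesis leaves m e ≤ d, so q e ≤ m p e ≤ p d. Working
-- with products avoids dividing by m.
stretch : ∀ m p q c d → q ≤ m * p → m * c ≤ suc m * d → c * q ≤ (q + p) * d
stretch m p q c d h₁ h₂ with ≤-total c d
... | inj₁ c≤d = begin
  c * q           ≤⟨ *-monoˡ-≤ q c≤d ⟩
  d * q           ≡⟨ *-comm d q ⟩
  q * d           ≤⟨ *-monoˡ-≤ d (m≤m+n q p) ⟩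
  (q + p) * d     ∎
  where open ≤-Reasoning
... | inj₂ d≤c = subst (λ c → c * q ≤ (q + p) * d) (m+[n∸m]≡n d≤c) (begin
  (d + e) * q           ≡⟨ expand d e q ⟩
  q * d + q * e         ≤⟨ +-monoʳ-≤ (q * d) (*-monoˡ-≤ e h₁) ⟩
  q * d + m * p * e     ≡⟨ cong (q * d +_) (trans (cong (_* e) (*-comm m p)) (*-assoc p m e)) ⟩
  q * d + p * (m * e)   ≤⟨ +-monoʳ-≤ (q * d) (*-monoʳ-≤ p me≤d) ⟩
  q * d + p * d         ≡⟨ sym (*-distribʳ-+ d q p) ⟩
  (q + p) * d           ∎)
  where
  open ≤-Reasoning
  e : ℕ
  e = c ∸ d
  expand : ∀ d e q → (d + e) * q ≡ q * d + q * e
  expand = solve-∀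
  me≤d : m * e ≤ d
  me≤d = +-cancelˡ-≤ (m * d) (m * e) d (begin
    m * d + m * e   ≡⟨ sym (*-distribˡ-+ m d e) ⟩
    m * (d + e)     ≡⟨ cong (m *_) (m+[n∸m]≡n d≤c) ⟩
    m * c           ≤⟨ h₂ ⟩
    d + m * d       ≡⟨ +-comm d _ ⟩
    m * d + d       ∎)

-- As unnormalised fractions both sides can be cross-multiplied, without knowing the reduced form of
-- the right-hand side.
within-factor : ∀ ε .{{_ : Positive ε}} c d → c * ↧ₙ ε ≤ (↧ₙ ε + ∣ ↥ ε ∣) * d →
                fromℕ c ℚ.≤ (1ℚ ℚ.+ ε) ℚ.* fromℕ d
within-factor ε@(mkℚ (pos (suc a)) b _) c d h = ℚ.toℚᵘ-cancel-≤
  (ℚᵘ.≤-respˡ-≃ (ℚᵘ.≃-sym (ℚ.toℚᵘ-fromℚᵘ (mkℚᵘ (pos c) 0)))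
    (ℚᵘ.≤-respʳ-≃ (ℚᵘ.≃-sym product) (ℚᵘ.*≤* integers)))
  where
  εᵘ : ℚᵘ.ℚᵘ
  εᵘ = mkℚᵘ (pos (suc a)) b

  product : toℚᵘ ((1ℚ ℚ.+ ε) ℚ.* fromℕ d) ℚᵘ.≃ (ℚᵘ.1ℚᵘ ℚᵘ.+ εᵘ) ℚᵘ.* mkℚᵘ (pos d) 0
  product = ℚᵘ.≃-trans (ℚ.toℚᵘ-homo-* (1ℚ ℚ.+ ε) (fromℕ d))
    (ℚᵘ.*-cong (ℚ.toℚᵘ-homo-+ 1ℚ ε) (ℚ.toℚᵘ-fromℚᵘ (mkℚᵘ (pos d) 0)))

  numerators : (pos 1 ℤ.* pos (suc b) ℤ.+ pos (suc a) ℤ.* pos 1) ℤ.* pos d ℤ.* pos 1 ≡ pos ((suc b + suc a) * d)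
  numerators = begin
    (pos 1 ℤ.* pos (suc b) ℤ.+ pos (suc a) ℤ.* pos 1) ℤ.* pos d ℤ.* pos 1 ≡⟨ ring (pos (suc b)) (pos (suc a)) (pos d) ⟩
    (pos (suc b) ℤ.+ pos (suc a)) ℤ.* pos d                           ≡⟨ sym (ℤ.pos-* (suc b + suc a) d) ⟩
    pos ((suc b + suc a) * d)                                  ∎
    where
    open ≡-Reasoning
    ring : ∀ x y z → (pos 1 ℤ.* x ℤ.+ y ℤ.* pos 1) ℤ.* z ℤ.* pos 1 ≡ (x ℤ.+ y) ℤ.* z
    ring = solve-∀ℤ

  integers : pos c ℤ.* pos (1 * suc b * 1) ℤ.≤ (pos 1 ℤ.* pos (suc b) ℤ.+ pos (suc a) ℤ.* pos 1) ℤ.* pos d ℤ.* pos 1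
  integers = subst₂ ℤ._≤_ (trans (ℤ.pos-* c (suc b)) (cong (λ x → pos c ℤ.* pos x) (sym (trans (*-identityʳ (1 * suc b)) (*-identityˡ (suc b))))))
    (sym numerators) (ℤ.+≤+ h)

-- Schedules

decodeSide : ⟦ bool ⟧ → Side
decodeSide b = if isInj₂ b then server else cloud

encode-decode : ∀ b → encodeSide (decodeSide b) ≡ b
encode-decode (inj₁ tt) = refl
encode-decode (inj₂ tt) = refl

starts-elim : ∀ {t c} x → just t +∞ x ≤⁺ just c → ∃[ p ] x ≡ just p × t + p ≤ c
starts-elim (just p) [ le ] = p , refl , le

-- As `f` vanishes on server jobs, the sum over the filtered list of cloud jobs becomes a sum over
-- all jobs; as it agrees with the cloud time on the others, the sum is finite.
cost-Σ : ∀ I π (f : Fin (Instance.jobs I) → ℕ) →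
  (∀ j → Schedule.side π j ≡ cloud → Instance.cloudTime I j ≡ just (f j)) →
  (∀ j → Schedule.side π j ≡ server → f j ≡ 0) → cost I π ≡ just (Σᶠ f)
cost-Σ I π f on-cloud on-server = trans (go (allFin _)) (cong just (sumBy-tabulate f (λ i → i)))
  where
  open Instance I
  open Schedule π
  opaque
    unfolding sumBy

    go : ∀ js → sum∞ (map cloudTime (filter (λ j → side j ≟ˢ cloud) js)) ≡ just (sumBy f js)
    go []       = refl
    go (j ∷ js) with side j in eq
    ... | server rewrite on-server j eq = go js
    ... | cloud  rewrite on-cloud j eq | go js = refl

module Schedules {I : Instance} {m d : ℕ} {g : ⟦ Global ⟧} (enc : Encodes I m d g) where
  open Counting enc public

  timeOn⇒processing : ∀ π s j {p} → timeOn I π s j ≡ just p → processing g (toℕ j) (encodeSide s) ≡ inj₂ p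
  timeOn⇒processing π server j eq = trans (processing-server j) (cong inj₂ (Maybe.just-injective eq))
  timeOn⇒processing π cloud  j eq = trans (processing-cloud j) (cong (maybe′ inj₂ (inj₁ tt)) eq)

  processing⇒timeOn : ∀ π s j {p} → processing g (toℕ j) (encodeSide s) ≡ inj₂ p → timeOn I π s j ≡ just p
  processing⇒timeOn π server j eq = cong just (inj₂-injective (trans (sym (processing-server j)) eq))
  processing⇒timeOn π cloud  j eq = finite (cloudTime j) (trans (sym (processing-cloud j)) eq)
    where
    finite : ∀ (x : ℕ∞) {p} → maybe′ inj₂ (inj₁ tt) x ≡ inj₂ p → x ≡ just p
    finite (just p) refl = refl

  charge-cloud : ∀ (j : Fin n) {p} → processing g (toℕ j) (encodeSide cloud) ≡ inj₂ p → charge (encodeSide cloud) (toℕ j) ≡ p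
  charge-cloud j eq = cong [ (λ (_ : ⊤) → 0) , (λ p → p) ]′ eq

  lag-same : ∀ s i j → lag (encodeSide s) (encodeSide s) i j ≡ 0
  lag-same s i j = cong (λ b → if b then 0 else delay i j) (eqBool-refl (encodeSide s))

  lag-cross : ∀ {s s′} i j → s ≢ s′ → lag (encodeSide s) (encodeSide s′) i j ≡ delay i j
  lag-cross {server} {server} i j ne = ⊥-elim (ne refl)
  lag-cross {server} {cloud}  i j ne = refl
  lag-cross {cloud}  {server} i j ne = refl
  lag-cross {cloud}  {cloud}  i j ne = ⊥-elim (ne refl)

  encodeSide-server : ∀ s → encodeSide s ≡ inj₂ tt → s ≡ server
  encodeSide-server server _ = refl

  cost-schedule : ∀ π (p : Fin n → ℕ) →
    (∀ j → processing g (toℕ j) (encodeSide (Schedule.side π j)) ≡ inj₂ (p j)) →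
    cost I π ≡ just (Σᶠ (λ j → charge (encodeSide (Schedule.side π j)) (toℕ j)))
  cost-schedule π p pr = cost-Σ I π _
    (λ j eq → let pr′ = subst (λ s → processing g (toℕ j) (encodeSide s) ≡ inj₂ (p j)) eq (pr j) in
      trans (processing⇒timeOn π cloud j pr′)
        (cong just (sym (trans (cong (λ s → charge (encodeSide s) (toℕ j)) eq) (charge-cloud j pr′)))))
    (λ j eq → cong (λ s → charge (encodeSide s) (toℕ j)) eq)

  module FromValid (π : Schedule n) (valid : Valid I π) (meets : makespan I π ≤ d) where
    open Schedule π renaming (completion to C)
    open Valid valid

    private
      finite : ∀ {t} j → StartsAfter I π t j → ∃[ p ] procTime I π j ≡ just p × t + p ≤ C j
      finite j = starts-elim (procTime I π j)

    -- `starts` makes the duration finite, for the source and sink too: no infinite cloud time fits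
    -- below a natural completion time. It also makes the truncated subtractions below exact.
    length-of : Fin n → ℕ
    length-of j = proj₁ (finite j (starts j))

    processing-of : ∀ j → processing g (toℕ j) (encodeSide (side j)) ≡ inj₂ (length-of j)
    processing-of j = timeOn⇒processing π (side j) j (proj₁ (proj₂ (finite j (starts j))))

    private
      after : ∀ {t j} → StartsAfter I π t j → t ≤ C j ∸ length-of j
      after {t} {j} sa with finite j sa
      ... | p , eq , le = m+n≤o⇒m≤o∸n t (subst (λ p → t + p ≤ C j)
        (Maybe.just-injective (trans (sym eq) (proj₁ (proj₂ (finite j (starts j)))))) le)

      edge-after : ∀ {i j} → i ⟶ j → C i + lag (encodeSide (side i)) (encodeSide (side j)) i j ≤ C j ∸ length-of j
      edge-after {i} {j} e with side i ≟ˢ side j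
      ... | yes eq = subst (_≤ C j ∸ length-of j)
        (sym (trans (cong (λ s → C i + lag (encodeSide s) (encodeSide (side j)) i j) eq)
          (trans (cong (C i +_) (lag-same (side j) i j)) (+-identityʳ (C i)))))
        (after (same-side i j e eq))
      ... | no ne = subst (λ l → C i + l ≤ C j ∸ length-of j) (sym (lag-cross i j ne)) (after (cross-side i j e ne))

      lengths : ∀ j → C j ∸ length-of j + length-of j ≡ C j
      lengths j = m∸n+n≡m (proj₂ (proj₂ (finite j (starts j))))

      -- Completion times do not decrease along edges, and from every job successors lead to the
      -- sink, which meets the deadline.
      early : ∀ j → C j ≤ d
      early j = go j (⟵-wellFounded j)
        where
        go : ∀ j → Acc (λ i j → j ⟶ i) j → C j ≤ d
        go j (acc rec) with j F.≟ sink
        ... | yes refl = meets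
        ... | no j≢t with successor j j≢t
        ...   | k , e = ≤-trans (≤-trans (m≤m+n (C j) _) (≤-trans (edge-after e) (m∸n≤m (C k) (length-of k)))) (go k (rec e))

    target : Target enc
    target = record
      { side        = encodeSide ∘ side
      ; startAt     = λ j → C j ∸ length-of j
      ; endAt       = C
      ; duration    = length-of
      ; processing≡ = processing-of
      ; lasts       = lengths
      ; edges       = edge-after
      ; exclusive   = λ {i} {j} i≢j si sj → [ inj₁ ∘ after , inj₂ ∘ after ]′
          (Valid.exclusive valid i j i≢j (encodeSide-server (side i) si) (encodeSide-server (side j) sj))
      ; punctual    = early
      }

  all-assigned : ∀ {s} → Good n s → ∀ i → assigned s (toℕ i) ≡ true
  all-assigned {s} good = count≡n (λ i → assigned s (toℕ i)) (counts good)

  -- In layer n every job is scheduled, so the part of the target's cost in `Dom` is its whole cost.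
  -- Feasibility within the deadline thus makes that layer nonempty.
  covered : ∀ π → Valid I π → makespan I π ≤ d →
            ∃[ s ] s ∈ layer g n × just (cost′ g s) ≤⁺ cost I π
  covered π valid meets with Domination.layer-dom enc (FromValid.target π valid meets) n ≤-refl
  ... | s , s∈ , dom = s , s∈ , subst (just (cost′ g s) ≤⁺_) (sym (cost-schedule π length-of processing-of))
    [ ≤-trans (Compare.Dom.cheaper dom) (≤-reflexive (Σᶠ-cong λ i →
        cong (λ a → if a then charge (encodeSide (Schedule.side π i)) (toℕ i) else 0) (all-assigned (layer-good n s∈) i))) ]
    where open FromValid π valid meets

  module ToValid {s : ⟦ Partial ⟧} (good : Good n s) where

    schedule : Schedule n
    schedule = record { side = λ j → decodeSide (sideOf s (toℕ j)) ; completion = λ j → timeOf s (toℕ j) }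

    private
      at : ∀ j → At s j (sideOf s (toℕ j)) (timeOf s (toℕ j))
      at j with assigned-At {s} (all-assigned good j)
      ... | b , c , at-j = subst₂ (At s j) (sym (At-side {s} at-j)) (sym (At-time {s} at-j)) at-j

      fit : ∀ j → ∃[ p ] processing g (toℕ j) (sideOf s (toℕ j)) ≡ inj₂ p × p ≤ timeOf s (toℕ j) ×
        (∀ {i} → i ⟶ j → timeOf s (toℕ i) + lag (sideOf s (toℕ i)) (sideOf s (toℕ j)) i j + p ≤ timeOf s (toℕ j))
      fit j with fits good (at j)
      ... | p , pr , le , preds = p , pr , le , earlier
        where
        earlier : ∀ {i} → i ⟶ j → timeOf s (toℕ i) + lag (sideOf s (toℕ i)) (sideOf s (toℕ j)) i j + p ≤ timeOf s (toℕ j)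
        earlier {i} e with preds e
        ... | b , c , at-i , le′ with At-unique {s} (at i) at-i
        ...   | refl , refl = le′

      processing-of : ∀ j → processing g (toℕ j) (encodeSide (Schedule.side schedule j)) ≡ inj₂ (proj₁ (fit j))
      processing-of j = trans (cong (processing g (toℕ j)) (encode-decode (sideOf s (toℕ j)))) (proj₁ (proj₂ (fit j)))

      starts-after : ∀ t j → t + proj₁ (fit j) ≤ timeOf s (toℕ j) → StartsAfter I schedule t j
      starts-after t j le = subst (λ x → just t +∞ x ≤⁺ just (timeOf s (toℕ j)))
        (sym (processing⇒timeOn schedule (Schedule.side schedule j) j (processing-of j))) [ le ]

      on-server : ∀ j → Schedule.side schedule j ≡ server → sideOf s (toℕ j) ≡ inj₂ tt
      on-server j eq = trans (sym (encode-decode (sideOf s (toℕ j)))) (cong encodeSide eq)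

      server-length : ∀ j → Schedule.side schedule j ≡ server → proj₁ (fit j) ≡ serverTime j
      server-length j eq = inj₂-injective (trans (sym (processing-of j))
        (trans (cong (λ x → processing g (toℕ j) (encodeSide x)) eq) (processing-server j)))

      At-server : ∀ j → Schedule.side schedule j ≡ server → At s j (inj₂ tt) (timeOf s (toℕ j))
      At-server j eq = subst (λ b → At s j b (timeOf s (toℕ j))) (on-server j eq) (at j)

    valid : Valid I schedule
    valid = record
      { starts     = λ j → starts-after 0 j (proj₁ (proj₂ (proj₂ (fit j))))
      ; exclusive  = λ i j i≢j si sj → [
            (λ le → inj₁ (starts-after _ j (subst (λ p → timeOf s (toℕ i) + p ≤ timeOf s (toℕ j)) (sym (server-length j sj)) le))) ,
            (λ le → inj₂ (starts-after _ i (subst (λ p → timeOf s (toℕ j) + p ≤ timeOf s (toℕ i)) (sym (server-length i si)) le))) ]′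
          (exclusive good i≢j (At-server i si) (At-server j sj))
      ; same-side  = λ i j e _ → starts-after _ j
          (≤-trans (+-monoˡ-≤ (proj₁ (fit j)) (m≤m+n (timeOf s (toℕ i)) _)) (proj₂ (proj₂ (proj₂ (fit j))) e))
      ; cross-side = λ i j e ne → starts-after _ j (subst (λ l → timeOf s (toℕ i) + l + proj₁ (fit j) ≤ timeOf s (toℕ j))
          (trans (cong₂ (λ b b′ → lag b b′ i j) (sym (encode-decode (sideOf s (toℕ i)))) (sym (encode-decode (sideOf s (toℕ j)))))
                 (lag-cross i j ne))
          (proj₂ (proj₂ (proj₂ (fit j))) e))
      }

    schedule-cost : cost I schedule ≡ just (cost′ g s)
    schedule-cost = trans (cost-schedule schedule (proj₁ ∘ fit) processing-of)
      (cong just (sym (trans (cost≡ s) (Σᶠ-cong λ i → cong (λ b → charge b (toℕ i)) (sym (encode-decode (sideOf s (toℕ i))))))))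

    -- The cap on completion times at the sink, with the factor n cancelled; the existence of the
    -- sink makes n positive.
    schedule-makespan : m * makespan I schedule ≤ suc m * d
    schedule-makespan = cancel n (toℕ<n sink) (bounded good (at sink))
      where
      cancel : ∀ n {i x y} → i < n → n * m * x ≤ n * suc m * y → m * x ≤ suc m * y
      cancel (suc n) {x = x} {y} _ h = *-cancelˡ-≤ (suc n)
        (subst₂ _≤_ (*-assoc (suc n) m x) (*-assoc (suc n) (suc m) y) h)

    encoded : map (λ i → value (cell s i)) (ids g) ≡ encodeSchedule schedule
    encoded = trans (cong (map (λ i → value (cell s i))) ids≡) (trans (map-tabulate toℕ (λ i → value (cell s i)))
      (tabulate-cong λ i → cong (_, timeOf s (toℕ i)) (sym (encode-decode (sideOf s (toℕ i))))))

-- Correctness of the selected answer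

data Cheapest (g : ⟦ Global ⟧) (ss : List ⟦ Partial ⟧) : ⊤ ⊎ ⟦ Partial ⟧ → Set where
  none : ss ≡ [] → Cheapest g ss (inj₁ tt)
  some : ∀ {r} → r ∈ ss → (∀ {s} → s ∈ ss → cost′ g r ≤ cost′ g s) → Cheapest g ss (inj₂ r)

cheapest-correct : ∀ g ss → Cheapest g ss (cheapest g ss)
cheapest-correct g []       = none refl
cheapest-correct g (s ∷ ss) with cheapest g ss | cheapest-correct g ss
... | inj₁ tt | none refl = some (here refl) λ { (here refl) → ≤-refl }
... | inj₂ r  | some r∈ least with cost′ g s ≤ᵇ cost′ g r in le
...   | true  = some (here refl) λ { (here refl) → ≤-refl ; (there s∈) → ≤-trans (≤ᵇ-sound _ _ le) (least s∈) }
...   | false = some (there r∈) λ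
  { (here refl) → ≰⇒≥ λ s≤r → true≢false (trans (sym (≤ᵇ-true s≤r)) le)
  ; (there s∈)  → least s∈ }

-- An empty last layer certifies infeasibility, since `covered` would place a state in it. Otherwise
-- the cheapest state costs at most as much as the state that `covered` supplies for any competitor.
answer-solves : ∀ {I ε d u} .{{_ : Positive ε}} → let g = global u (encodeInput I ε d) in
  ↧ₙ ε ≤ length u * ∣ ↥ ε ∣ → Solves I ε d (answer g (layer g (Instance.jobs I)))
answer-solves {I} {ε} {d} {u} h = solves (cheapest-correct g (layer g n))
  where
  g : ⟦ Global ⟧
  g = global u (encodeInput I ε d)

  open Schedules (global-encodes I ε d u)

  solves : ∀ {r} → Cheapest g (layer g n) r →
    Solves I ε d ([ (λ _ → inj₁ tt) , (λ s → inj₂ (map (λ i → value (cell s i)) (ids g))) ]′ r)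
  solves (none eq) π valid meets with covered π valid meets
  ... | s , s∈ , _ with subst (s ∈_) eq s∈
  ...   | ()
  solves (some {r} r∈ least) = schedule , encoded , ToValid.valid (layer-good n r∈) , optimal ,
    within-factor ε (makespan I schedule) d (stretch (length u) ∣ ↥ ε ∣ (↧ₙ ε) (makespan I schedule) d h schedule-makespan)
    where
    open ToValid (layer-good n r∈)

    optimal : ∀ π′ → Valid I π′ → makespan I π′ ≤ d → cost I schedule ≤⁺ cost I π′
    optimal π′ valid′ meets with covered π′ valid′ meets
    ... | s , s∈ , le = subst (_≤⁺ cost I π′) (sym schedule-cost) (lower (cost I π′) (least s∈) le)
      where
      lower : ∀ x {a b} → a ≤ b → just b ≤⁺ x → just a ≤⁺ x
      lower (just x) a≤b [ b≤x ] = [ ≤-trans a≤b b≤x ]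
      lower nothing  a≤b _       = _ ≤⊤⁺

-- From bounds in the input size to bounds in n and 1 / ε

sizes-tabulate : ∀ τ {c n} (f : Fin n → ⟦ τ ⟧) → (∀ i → size τ (f i) ≤ c) → sizes τ (L.tabulate f) ≤ n * c
sizes-tabulate τ {n = zero}  f h = z≤n
sizes-tabulate τ {n = suc n} f h = +-mono-≤ (h zero) (sizes-tabulate τ (f ∘ suc) (h ∘ suc))

-- 5 accounts for the numerator and denominator of ε, the deadline, the source and the sink; the
-- list of processing times and the edge matrix follow. Numbers have size 1 regardless of magnitude.
inputBound : Pol
inputBound = con 5 ⊞ ((con 1 ⊞ X ⊠ con 2) ⊞ (con 1 ⊞ X ⊠ (con 1 ⊞ X ⊠ con 2)))

size-input : ∀ I ε d → size Input (encodeInput I ε d) ≤ eval inputBound (Instance.jobs I)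
size-input I ε d = +-monoʳ-≤ 5 (+-mono-≤
  (s≤s (sizes-tabulate (nat ⊗ (unit ⊕ nat)) _ λ j → s≤s (size-time (cloudTime j))))
  (s≤s (sizes-tabulate (list (bool ⊗ nat)) _ λ i → s≤s (sizes-tabulate (bool ⊗ nat) _ λ j →
    ≤-reflexive (cong (_+ 1) (size-bool (encodeBool (edge i j))))))))
  where
  open Instance I
  size-time : ∀ (x : ℕ∞) → size (unit ⊕ nat) (maybe′ inj₂ (inj₁ tt) x) ≤ 1
  size-time (just _) = ≤-refl
  size-time nothing  = ≤-refl

jobs≤size-input : ∀ I ε d → Instance.jobs I ≤ size Input (encodeInput I ε d)
jobs≤size-input I ε d = m≤n⇒m≤o+n 5 (m≤n⇒m≤n+o _ (m≤n⇒m≤1+n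
  (subst (_≤ sizes (nat ⊗ (unit ⊕ nat)) times) (length-tabulate _) (length≤sizes (nat ⊗ (unit ⊕ nat)) times))))
  where
  open Instance I
  times : List (ℕ × (⊤ ⊎ ℕ))
  times = L.tabulate λ j → serverTime j , maybe′ inj₂ (inj₁ tt) (cloudTime j)

infixr 8 _⊡_

-- With φ fixed, the φ-th power in the number of states is a polynomial whose degree depends on φ.
_⊡_ : Pol → ℕ → Pol
p ⊡ zero  = con 1
p ⊡ suc k = p ⊠ p ⊡ k

eval-⊡ : ∀ p k n → eval (p ⊡ k) n ≡ eval p n ^ k
eval-⊡ p zero    n = refl
eval-⊡ p (suc k) n = cong (eval p n *_) (eval-⊡ p k n)

module _ (φ : ℕ) where

  bucketBound alphabetBound stateBound layerBound : Pol
  bucketBound   = con 1 ⊞ X ⊠ (con 1 ⊞ X)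
  alphabetBound = con 1 ⊞ X ⊠ (X ⊠ (con 2 ⊠ bucketBound))
  stateBound    = bucketBound ⊠ alphabetBound ⊡ φ
  layerBound    = con 1 ⊞ (con 1 ⊞ stateBound) ⊠ (con 1 ⊞ X ⊠ con 2)

  layer-size≤ : ∀ {I m d g} (enc : Encodes I m d g) → maxDividingCut I ≤ φ →
    ∀ {x} → Instance.jobs I ≤ x → m ≤ x → ∀ k → size (list Partial) (layer g k) ≤ eval layerBound x
  layer-size≤ {I} {m} enc cut {x} n≤x m≤x k = ≤-trans (Counting.layer-size enc cut k)
    (s≤s (*-mono-≤ (s≤s (*-mono-≤ buckets≤ powers≤)) (s≤s (*-monoˡ-≤ 2 n≤x))))
    where
    open Instance I renaming (jobs to n)

    buckets≤ : suc (n * suc m) ≤ eval bucketBound x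
    buckets≤ = s≤s (*-mono-≤ n≤x (s≤s m≤x))

    powers≤ : suc (n * (n * (2 * suc (n * suc m)))) ^ φ ≤ eval (alphabetBound ⊡ φ) x
    powers≤ = subst (suc (n * (n * (2 * suc (n * suc m)))) ^ φ ≤_) (sym (eval-⊡ alphabetBound φ x))
      (^-monoˡ-≤ φ (s≤s (*-mono-≤ n≤x (*-mono-≤ n≤x (*-monoʳ-≤ 2 buckets≤)))))

jobs≥1 : ∀ I → 1 ≤ Instance.jobs I
jobs≥1 I = ≤-trans (s≤s z≤n) (toℕ<n (Instance.source I))

algorithm-solves : ∀ φ → ∃[ b ] ∀ (I : Instance) → maxDividingCut I ≤ φ → ∀ (ε : ℚ) .{{_ : Positive ε}} (d : ℕ) →
  ∃[ result ] ∃[ t ] Runs algorithm (encodeInput I ε d) result t ×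
    t ≤ eval b (size Input (encodeInput I ε d) + inverseCeil ε) × Solves I ε d result
algorithm-solves φ = timeBound , solve
  where
  timeBound : Pol
  timeBound = proj₁ (algorithm-runs (layerBound φ))

  solve : ∀ (I : Instance) → maxDividingCut I ≤ φ → ∀ (ε : ℚ) .{{_ : Positive ε}} (d : ℕ) →
    ∃[ result ] ∃[ t ] Runs algorithm (encodeInput I ε d) result t ×
      t ≤ eval timeBound (size Input (encodeInput I ε d) + inverseCeil ε) × Solves I ε d result
  solve I cut ε d with proj₂ (algorithm-runs (layerBound φ)) (encodeInput I ε d) (inverseCeil ε) (≤-inverseCeil ε)
  ... | u , u≥ , u≤ , run with run (λ k _ → layer-size≤ φ (global-encodes I ε d u) cut
        (≤-trans (jobs≤size-input I ε d) (m≤m+n (size Input (encodeInput I ε d)) (inverseCeil ε)))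
        (≤-trans u≤ (m≤n+m (inverseCeil ε) (size Input (encodeInput I ε d)))) k)
  ...   | t , r , t≤ = answer g (layer g (length (ids g))) , t , r , t≤ ,
    subst (λ k → Solves I ε d (answer g (layer g k))) (sym length-ids) (answer-solves {I} {ε} {d} {u} u≥)
    where
    g : ⟦ Global ⟧
    g = global u (encodeInput I ε d)

    length-ids : length (ids g) ≡ Instance.jobs I
    length-ids = trans (cong length (Encodes.ids≡ (global-encodes I ε d u))) (length-tabulate toℕ)

module _ (b : Pol) {a k : ℕ} (bounded : ∀ n → eval (b ⊚ (inputBound ⊞ X)) n ≤ a * suc n ^ k) where

  polynomial-time : ∀ I ε d .{{_ : Positive ε}} {t} → t ≤ eval b (size Input (encodeInput I ε d) + inverseCeil ε) →
    t ≤ a * 2 ^ k * (Instance.jobs I + inverseCeil ε) ^ k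
  polynomial-time I ε d {t} t≤ = begin
    t                                                 ≤⟨ t≤ ⟩
    eval b (size Input (encodeInput I ε d) + c)       ≤⟨ eval-mono b (+-mono-≤ (≤-trans (size-input I ε d) (eval-mono inputBound (m≤m+n n c))) (m≤n+m c n)) ⟩
    eval (b ⊚ (inputBound ⊞ X)) (n + c)               ≤⟨ bounded (n + c) ⟩
    -- There is at least one job, so `suc (n + c)` is at most `2 * (n + c)`; this is the origin of
    -- the factor `2 ^ k`.
    a * suc (n + c) ^ k                               ≤⟨ *-monoʳ-≤ a (^-monoˡ-≤ k (+-mono-≤ (≤-trans (jobs≥1 I) (m≤m+n n c)) (m≤m+n (n + c) 0))) ⟩
    a * (2 * (n + c)) ^ k                             ≡⟨ cong (a *_) (^-distrib-* 2 (n + c) k) ⟩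
    a * (2 ^ k * (n + c) ^ k)                         ≡⟨ sym (*-assoc a (2 ^ k) _) ⟩
    a * 2 ^ k * (n + c) ^ k                           ∎
    where
    open ≤-Reasoning
    n c : ℕ
    n = Instance.jobs I
    c = inverseCeil ε

theorem8 : ∀ (φ : ℕ) →
    Σ[ algorithm ∈ Program Input Output ] ∃[ a ] ∃[ k ]
    ∀ (I : Instance) → maxDividingCut I ≤ φ →
    ∀ (ε : ℚ) .{{_ : Positive ε}} (d : ℕ) →
    ∃[ result ] ∃[ t ]
    Runs algorithm (encodeInput I ε d) result t ×
    t ≤ a * (Instance.jobs I + inverseCeil ε) ^ k ×
    Solves I ε d result
theorem8 φ =
  let (b , solves) = algorithm-solves φ
      (a , k , bounded) = eval-bound (b ⊚ (inputBound ⊞ X))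
  in algorithm , a * 2 ^ k , k , λ I cut ε d →
    let (result , t , r , t≤ , correct) = solves I cut ε d
    in result , t , r , polynomial-time b {a} {k} bounded I ε d t≤ , correct
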